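{- Let $\widetilde W$ be the smooth projective model over $\mathbb{Q}$ of the Wiman sextic $$W:\ X^6+Y^6+Z^6+(X^2+Y^2+Z^2)(X^4+Y^4+Z^4)-12X^2Y^2Z^2=0\ \subset\mathbb{P}^2_{\mathbb{Q}},$$ and let $S_5$ denote its full automorphism group $\mathrm{Aut}_{\mathbb{Q}}(\widetilde W)=\mathrm{Aut}_{\overline{\mathbb{Q}}}(\widetilde W)\simeq S_5$. Then the rational function $$\beta(X,Y,Z)=\frac{3125 \left(\frac{3 (X^2 Y^2+Y^2 Z^2+Z^2 X^2)}{(X^2+Y^2+Z^2)^2}-1\right)^2 \left(\frac{X^2 Y^2+Y^2 Z^2+Z^2 X^2}{(X^2+Y^2+Z^2)^2}+5\right)^3}{\left(\frac{5 (X^2 Y^2+Y^2 Z^2+Z^2 X^2)}{(X^2+Y^2+Z^2)^2}-2\right) \left(-\frac{75 (X^2 Y^2+Y^2 Z^2+Z^2 X^2)^2}{(X^2+Y^2+Z^2)^4}+\frac{1010 (X^2 Y^2+Y^2 Z^2+Z^2 X^2)}{(X^2+Y^2+Z^2)^2}+13\right)^2}$$ on $\widetilde W$ is a generator over $\mathbb{Q}$ of the invariant field $\mathbb{Q}(\widetilde W)^{S_5}=\mathbb{Q}(W)^{S_5}$, and it gives rise to an algebraic Belyi map over $\mathbb{Q}$ $$\beta:\widetilde W\longrightarrow S_5\backslash\widetilde W\simeq\mathbb{P}^1,\qquad [X:Y:Z]\mapsto\beta(X,Y,Z).$$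
   Context: The plane curve $W$ has exactly four singular points $[\pm1:\pm1:1]$, all ordinary double points; $\widetilde W$ is its normalization (obtained by blowing up these four points), a smooth projective geometrically connected curve over $\mathbb{Q}$ of genus $6$. It is known that $\mathrm{Aut}_{\mathbb{Q}}(\widetilde W)=\mathrm{Aut}_{\overline{\mathbb{Q}}}(\widetilde W)\simeq \mathrm{Bir}_{\mathbb{Q}}(W)\simeq S_5$; it is generated by the sign changes of coordinates, the permutations of coordinates (together forming a subgroup isomorphic to $S_4$), and the birational automorphism of order five $[X:Y:Z]\mapsto[g_0:g_1:g_2]$ with $g_0=-X^2+XY-Y^2+XZ-YZ+Z^2$, $g_1=-X^2+XY+Y^2+XZ-YZ-Z^2$, $g_2=X^2+XY-Y^2+XZ-YZ-Z^2$. An algebraic Belyi map (function) over a field $K$ of characteristic $0$ on a smooth projective curve $C$ over $K$ is a non-constant morphism $C\to\mathbb{P}^1$ defined over $K$ whose branch locus is contained in $\{0,1,\infty\}$. -}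

module Defs where

open import Algebra.Bundles using (CommutativeRing; RawMagma)
open import Algebra.Morphism.Construct.Composition using (isRingIsomorphism)
open import Algebra.Morphism.Structures
  using (IsMagmaIsomorphism; IsRingHomomorphism; IsRingIsomorphism)
import Algebra.Properties.Semiring.Exp as Exp
open import Data.Bool.Base using (if_then_else_)
open import Data.Fin.Base using (Fin; suc)
open import Data.Fin.Patterns using (0F; 1F; 2F)
import Data.Fin.Permutation as Perm
open import Data.Fin.Permutation using (Permutation′; _⟨$⟩ʳ_; _∘ₚ_)
import Data.Fin.Properties as Fin
open import Data.Integer.Base as ℤ using (ℤ; +_; 0ℤ; 1ℤ)
open import Data.List.Base using (List; []; _∷_; [_]; _++_; map; concatMap)
open import Data.List.Relation.Unary.All using (All)
open import Data.Nat.Base as ℕ using (ℕ; zero; suc)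
import Data.Nat.Properties as ℕ
open import Data.Product.Base using (_×_; _,_; ∃; ∃-syntax; proj₁; proj₂)
open import Data.Rational.Base as ℚ using (ℚ; 0ℚ; 1ℚ)
open import Data.Sum.Base using (_⊎_)
open import Data.Vec.Base as Vec using (Vec; []; _∷_; replicate; zipWith; _[_]≔_)
open import Data.Vec.Properties using (≡-dec)
open import Function.Bundles using (_⇔_)
open import Level using (Level; _⊔_; 0ℓ) renaming (suc to lsuc)
open import Relation.Binary.Definitions using (Decidable)
open import Relation.Binary.PropositionalEquality.Core using (_≡_; _≢_)
open import Relation.Nullary.Decidable.Core using (does; yes; no)

------------------------------------------------------------------------
-- Polynomials over ℚ

-- A polynomial in n variables is a formal sum of terms (coefficient ,
-- exponent vector).  Repeated and zero terms are allowed, so equality of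
-- polynomials is _≋_ (equality of all coefficients), not _≡_.

Poly : ℕ → Set
Poly n = List (ℚ × Vec ℕ n)

coeff : ∀ {n} → Poly n → Vec ℕ n → ℚ
coeff []            e = 0ℚ
coeff ((c , m) ∷ p) e =
  if does (≡-dec ℕ._≟_ m e) then c ℚ.+ coeff p e else coeff p e

infix 4 _≋_ _∣ᴾ_

_≋_ : ∀ {n} → Poly n → Poly n → Set
p ≋ q = ∀ e → coeff p e ≡ coeff q e

constᴾ : ∀ {n} → ℚ → Poly n
constᴾ c = [ c , replicate _ 0 ]

var : ∀ {n} → Fin n → Poly n
var i = [ 1ℚ , replicate _ 0 [ i ]≔ 1 ]

infixl 6 _+ᴾ_ _-ᴾ_
infixl 7 _*ᴾ_
infixr 8 _^ᴾ_

_+ᴾ_ : ∀ {n} → Poly n → Poly n → Poly n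
p +ᴾ q = p ++ q

_*ᴾ_ : ∀ {n} → Poly n → Poly n → Poly n
p *ᴾ q = concatMap (λ (c , m) → map (λ (d , k) → c ℚ.* d , zipWith ℕ._+_ m k) q) p

_-ᴾ_ : ∀ {n} → Poly n → Poly n → Poly n
p -ᴾ q = p +ᴾ constᴾ (ℚ.- 1ℚ) *ᴾ q

_^ᴾ_ : ∀ {n} → Poly n → ℕ → Poly n
p ^ᴾ zero  = constᴾ 1ℚ
p ^ᴾ suc k = p *ᴾ p ^ᴾ k

_∣ᴾ_ : ∀ {n} → Poly n → Poly n → Set
p ∣ᴾ q = ∃[ r ] q ≋ r *ᴾ p

-- Every listed term has degree d.  Up to _≋_ this is the usual notion: terms
-- of another degree must cancel and can be dropped.

Homogeneous : ∀ {n} → ℕ → Poly n → Set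
Homogeneous d = All (λ (_ , m) → Vec.sum m ≡ d)

------------------------------------------------------------------------
-- Field extensions of ℚ

-- A discrete field K with a ring homomorphism ι : ℚ → K.

record FieldOverℚ c ℓ : Set (lsuc (c ⊔ ℓ)) where
  field
    commutativeRing : CommutativeRing c ℓ
  open CommutativeRing commutativeRing public
  open Exp semiring public using (_^_)
  field
    _≟_     : Decidable _≈_
    1≉0     : 1# ≉ 0#
    inverse : ∀ x → x ≉ 0# → ∃[ y ] x * y ≈ 1#
    ι       : ℚ → Carrier
    ι-hom   : IsRingHomomorphism ℚ.+-*-rawRing rawRing ι

  infix  8 _⁻¹
  infixl 7 _/_

  -- Total, with the value 0 at 0.
  _⁻¹ : Carrier → Carrier
  x ⁻¹ with x ≟ 0#
  ... | yes _   = 0#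
  ... | no  x≉0 = proj₁ (inverse x x≉0)

  _/_ : Carrier → Carrier → Carrier
  x / y = x * y ⁻¹

  # : ℕ → Carrier
  # n = ι (+ n ℚ./ 1)

  monomial : ∀ {n} → Vec ℕ n → (Fin n → Carrier) → Carrier
  monomial []      x = 1#
  monomial (k ∷ m) x = x 0F ^ k * monomial m (λ i → x (suc i))

  eval : ∀ {n} → Poly n → (Fin n → Carrier) → Carrier
  eval []            x = 0#
  eval ((c , m) ∷ p) x = ι c * monomial m x + eval p x

------------------------------------------------------------------------
-- Plane curves and their smooth projective models

-- The function field of the integral plane curve F = 0.  It is given up to
-- isomorphism as a field K with a generic point ξ of the curve: the
-- homogeneous polynomials vanishing at ξ are the multiples of F, and K
-- consists of the quotients P(ξ)/Q(ξ) of homogeneous polynomials of equal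
-- degree.
--
-- The smooth projective model of the curve is handled as the abstract
-- nonsingular curve of K: its rational functions are the elements of K, its
-- closed points are the discrete valuations of K over ℚ, its automorphisms
-- are the automorphisms of K over ℚ, and its non-constant morphisms to ℙ¹
-- are the non-constant elements of K.

record FunctionField (F : Poly 3) c ℓ : Set (lsuc (c ⊔ ℓ)) where
  field
    fieldOverℚ : FieldOverℚ c ℓ
  open FieldOverℚ fieldOverℚ public
  field
    ξ         : Fin 3 → Carrier
    vanishing : ∀ {d} P → Homogeneous d P → eval P ξ ≈ 0# ⇔ F ∣ᴾ P
    generated : ∀ f → ∃[ d ] ∃[ P ] ∃[ Q ]
                Homogeneous d P × Homogeneous d Q ×
                eval Q ξ ≉ 0# × f * eval Q ξ ≈ eval P ξ

module Curve {F : Poly 3} {c ℓ : Level} (C : FunctionField F c ℓ) where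
  open FunctionField C

  record Automorphism : Set (c ⊔ ℓ) where
    field
      ⟦_⟧                : Carrier → Carrier
      isRingAutomorphism : IsRingIsomorphism rawRing rawRing ⟦_⟧
      fixesℚ             : ∀ q → ⟦_⟧ (ι q) ≈ ι q

  open Automorphism public using (⟦_⟧)

  infix  4 _≈ₐ_
  infixr 9 _∘ₐ_

  _≈ₐ_ : Automorphism → Automorphism → Set (c ⊔ ℓ)
  σ ≈ₐ τ = ∀ f → ⟦ σ ⟧ f ≈ ⟦ τ ⟧ f

  _∘ₐ_ : Automorphism → Automorphism → Automorphism
  σ ∘ₐ τ = record
    { ⟦_⟧ = λ f → ⟦ σ ⟧ (⟦ τ ⟧ f)
    ; isRingAutomorphism =
        isRingIsomorphism trans (isRingAutomorphism τ) (isRingAutomorphism σ)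
    ; fixesℚ = λ q → trans (⟦⟧-cong σ (fixesℚ τ q)) (fixesℚ σ q)
    }
    where
    open Automorphism using (isRingAutomorphism; fixesℚ)
    ⟦⟧-cong : ∀ σ {f g} → f ≈ g → ⟦ σ ⟧ f ≈ ⟦ σ ⟧ g
    ⟦⟧-cong σ = IsRingIsomorphism.⟦⟧-cong (isRingAutomorphism σ)

  Aut : RawMagma (c ⊔ ℓ) (c ⊔ ℓ)
  Aut = record { Carrier = Automorphism ; _≈_ = _≈ₐ_ ; _∙_ = _∘ₐ_ }

  Invariant : Carrier → Set (c ⊔ ℓ)
  Invariant f = ∀ σ → ⟦ σ ⟧ f ≈ f

  -- The subfield ℚ(g) of K.

  infix 4 _∈ℚ⟨_⟩

  _∈ℚ⟨_⟩ : Carrier → Carrier → Set ℓ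
  f ∈ℚ⟨ g ⟩ = ∃[ p ] ∃[ q ]
    eval {1} q (λ _ → g) ≉ 0# × f * eval q (λ _ → g) ≈ eval {1} p (λ _ → g)

  GeneratesInvariantField : Carrier → Set (c ⊔ ℓ)
  GeneratesInvariantField g = ∀ f → Invariant f ⇔ f ∈ℚ⟨ g ⟩

  -- Substitution of g for the coordinate t of ℙ¹ is an isomorphism from ℚ(t)
  -- onto the function field of the quotient by all automorphisms: it is
  -- injective, and its image is the field of invariants.

  IsQuotientMapToℙ¹ : Carrier → Set (c ⊔ ℓ)
  IsQuotientMapToℙ¹ g =
    (∀ p → eval {1} p (λ _ → g) ≈ 0# → p ≋ []) × GeneratesInvariantField g

  -- A normalized discrete valuation of K, trivial on ℚ.  The value of v at 0
  -- carries no information (it stands for ∞).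

  record ClosedPoint : Set (c ⊔ ℓ) where
    field
      v           : Carrier → ℤ
      v-cong      : ∀ {f g} → f ≈ g → v f ≡ v g
      v-*         : ∀ {f g} → f ≉ 0# → g ≉ 0# → v (f * g) ≡ v f ℤ.+ v g
      v-+         : ∀ {f g} → f ≉ 0# → g ≉ 0# → f + g ≉ 0# →
                    v f ℤ.⊓ v g ℤ.≤ v (f + g)
      v-ι         : ∀ {q} → q ≢ 0ℚ → v (ι q) ≡ 0ℤ
      uniformizer : ∃[ u ] u ≉ 0# × v u ≡ 1ℤ

  module _ (x : ClosedPoint) (g : Carrier) where
    open ClosedPoint x

    HasValue : ℚ → Set ℓ
    HasValue a = (g - ι a ≈ 0#) ⊎ (0ℤ ℤ.< v (g - ι a))

    HasPole : Set ℓ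
    HasPole = g ≉ 0# × v g ℤ.< 0ℤ

    -- π is (the pullback along g of) a generator of the maximal ideal of the
    -- local ring of ℙ¹ at g(x); that local ring consists of the elements of
    -- ℚ(t) whose pullback is regular at x.

    LocalParameter : Carrier → Set (c ⊔ ℓ)
    LocalParameter π = π ∈ℚ⟨ g ⟩ × π ≉ 0# × 0ℤ ℤ.< v π ×
      (∀ h → h ∈ℚ⟨ g ⟩ → h ≉ 0# → 0ℤ ℤ.< v h → v π ℤ.≤ v h)

    -- The ramification index at x is the valuation of a local parameter at
    -- g(x).  Residue fields have characteristic 0, so there is no condition
    -- on the residue extension.

    Ramified : Set (c ⊔ ℓ)
    Ramified = ∃[ π ] LocalParameter π × 1ℤ ℤ.< v π

  IsBelyiMap : Carrier → Set (c ⊔ ℓ)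
  IsBelyiMap g =
    (∀ a → g ≉ ι a) ×
    (∀ x → Ramified x g → HasValue x g 0ℚ ⊎ HasValue x g 1ℚ ⊎ HasPole x g)

------------------------------------------------------------------------
-- The Wiman sextic

wiman : Poly 3
wiman = X ^ᴾ 6 +ᴾ Y ^ᴾ 6 +ᴾ Z ^ᴾ 6
     +ᴾ (X ^ᴾ 2 +ᴾ Y ^ᴾ 2 +ᴾ Z ^ᴾ 2) *ᴾ (X ^ᴾ 4 +ᴾ Y ^ᴾ 4 +ᴾ Z ^ᴾ 4)
     -ᴾ constᴾ (+ 12 ℚ./ 1) *ᴾ X ^ᴾ 2 *ᴾ Y ^ᴾ 2 *ᴾ Z ^ᴾ 2
  where
  X = var 0F
  Y = var 1F
  Z = var 2F

S₅ : RawMagma 0ℓ 0ℓ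
S₅ = record
  { Carrier = Permutation′ 5
  ; _≈_     = Perm._≈_
  ; _∙_     = λ π ρ → ρ ∘ₚ π   -- first ρ, then π
  }

module Wiman {c ℓ : Level} (W̃ : FunctionField wiman c ℓ) where
  open FunctionField W̃
  open Curve W̃

  data Generator : Set where
    sign        : Fin 3 → Generator
    permutation : Permutation′ 3 → Generator
    quintic     : Generator

  apply : Generator → (Fin 3 → Carrier) → (Fin 3 → Carrier)
  apply (sign i)        P j = if does (i Fin.≟ j) then - P j else P j
  apply (permutation π) P j = P (π ⟨$⟩ʳ j)
  apply quintic         P   = λ where
      0F → - (X ^ 2) + X * Y - Y ^ 2 + X * Z - Y * Z + Z ^ 2
      1F → - (X ^ 2) + X * Y + Y ^ 2 + X * Z - Y * Z - Z ^ 2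
      2F → X ^ 2 + X * Y - Y ^ 2 + X * Z - Y * Z - Z ^ 2
    where
    X = P 0F
    Y = P 1F
    Z = P 2F

  -- σ is the pullback of functions along P ↦ apply g P: it carries the
  -- generic point to apply g ξ, as points of ℙ²(K).

  InducedBy : Generator → Automorphism → Set (c ⊔ ℓ)
  InducedBy g σ = ∃[ k ] k ≉ 0# × (∀ i → ⟦ σ ⟧ (ξ i) ≈ k * apply g ξ i)

  data Generated : Automorphism → Set (c ⊔ ℓ) where
    generator : ∀ {σ} g → InducedBy g σ → Generated σ
    identity  : ∀ {σ} → (∀ f → ⟦ σ ⟧ f ≈ f) → Generated σ
    compose   : ∀ {σ τ ρ} → Generated τ → Generated ρ → σ ≈ₐ τ ∘ₐ ρ → Generated σ
    invert    : ∀ {σ τ} → Generated τ → (∀ f → ⟦ σ ⟧ (⟦ τ ⟧ f) ≈ f) → Generated σ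

  -- The known description of the full automorphism group.  A bijection
  -- compatible with composition is an isomorphism of groups.

  record AutomorphismGroupIsS₅ : Set (c ⊔ ℓ) where
    field
      to            : Permutation′ 5 → Automorphism
      isIsomorphism : IsMagmaIsomorphism S₅ Aut to
      isGenerated   : ∀ σ → Generated σ

  private
    X = ξ 0F
    Y = ξ 1F
    Z = ξ 2F
    e = X ^ 2 * Y ^ 2 + Y ^ 2 * Z ^ 2 + Z ^ 2 * X ^ 2
    r = X ^ 2 + Y ^ 2 + Z ^ 2

  numerator denominator β : Carrier
  numerator = # 3125 * (# 3 * e / r ^ 2 - 1#) ^ 2 * (e / r ^ 2 + # 5) ^ 3
  denominator =
    (# 5 * e / r ^ 2 - # 2)
    * (- (# 75 * e ^ 2 / r ^ 4) + # 1010 * e / r ^ 2 + # 13) ^ 2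
  β = numerator / denominator

  -- No division by zero occurs in β.

  βIsDefined : Set ℓ
  βIsDefined = r ≉ 0# × denominator ≉ 0#

-- Put w = (X²Y² + Y²Z² + Z²X²)/(X² + Y² + Z²)², so that β = N(w)/D(w) has
-- degree 5 in w, and τᵢ = Xᵢ²/(X² + Y² + Z²).  The equation of the sextic says
-- that the τᵢ are the roots of t³ − t² + w t − (2 − 5w)/9, which gives a tower
--   ℚ(β) ⊂ ℚ(β, w) ⊂ … (τ₀) ⊂ … (τ₁) ⊂ … (X/Z) ⊂ … (Y/Z) = K
-- of simple extensions of degrees at most 5, 3, 2, 2, 2.
--
-- Sign changes and permutations of the coordinates fix w.  Up to such
-- symmetries the birational map of order five is the quadratic Cremona
-- involution h with three base points among the four nodes; the identity
-- N(w) D(w∘h) = N(w∘h) D(w) on the curve makes β invariant.  Conversely the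
-- generator of each step has as many distinct conjugates as its degree bound,
-- so an invariant function descends through the tower to ℚ(β).
--
-- Where β, 1/β and 1/(β − 1) are regular, each generator satisfies a monic
-- integral equation whose derivative is a unit, because
--   N − D = 3 (25w − 19)⁴,
--   N′D − ND′ = 9375 (3w − 1)(w + 5)² Q (25w − 19)³   with D = (5w − 2) Q²,
-- and the cubic has discriminant −4 (3w − 1)² (w + 5)/9.  Hence the value
-- group of ℚ(β) does not grow along the tower and β is unramified there.

module Submission where

open import Defs
import Algebra.Morphism.Construct.Identity as Identity
open import Algebra.Morphism.Structures using (IsRingHomomorphism; IsRingIsomorphism)
open import Data.Bool.Base using (Bool; true; false; T; _∧_; if_then_else_)
open import Data.Bool.Properties using (T-∧)
open import Data.Empty using (⊥; ⊥-elim)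
open import Data.Fin.Base using (Fin; zero; suc)
open import Data.Fin.Patterns using (0F; 1F; 2F; 3F; 4F)
import Data.Fin.Properties as Fin
open import Data.Fin.Permutation using (_⟨$⟩ʳ_; _⟨$⟩ˡ_; inverseˡ)
open import Data.Integer.Base as ℤ using (ℤ; +_; -[1+_]; 0ℤ; 1ℤ)
import Data.Integer.Properties as ℤ
open import Data.Integer.Divisibility.Signed
  using (_∣_; divides; _∣?_; ∣m∣n⇒∣m+n; ∣m+n∣n⇒∣m; ∣-refl; ∣m⇒∣-m; ∣⇒∣ᵤ)
open import Algebra.Properties.AbelianGroup ℤ.+-0-abelianGroup using () renaming (inverseʳ-unique to ℤ+-inverseʳ-unique)
open import Data.List.Base as List using (List; []; _∷_; map; _++_)
open import Data.List.Properties using (++-identityʳ)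
open import Data.List.Relation.Unary.All as All using (All; []; _∷_)
import Data.List.Relation.Unary.All.Properties as All
open import Data.Nat.Base as ℕ using (ℕ; zero; suc)
import Data.Nat.Properties as ℕ
open import Algebra.Properties.CommutativeSemigroup ℕ.+-commutativeSemigroup using ()
  renaming (interchange to ℕ+-interchange)
open import Data.Nat.Divisibility using (∣1⇒≡1)
open import Data.Nat.Induction using (<-rec)
open import Data.Product using (_×_; _,_; ∃; ∃-syntax; Σ-syntax; proj₁; proj₂)
open import Data.Rational.Base as ℚ using (ℚ; 0ℚ; 1ℚ)
import Data.Rational.Properties as ℚ
open import Algebra.Properties.Group ℚ.+-0-group using () renaming (⁻¹-involutive to ℚ-neg-involutive)
import Data.Rational.Unnormalised.Base as ℚᵘ
import Data.Rational.Unnormalised.Properties as ℚᵘ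
open import Data.Sum.Base using (_⊎_; inj₁; inj₂)
open import Data.Unit.Base using (tt)
open import Data.Vec.Base as Vec using (Vec; []; _∷_; lookup)
open import Data.Vec.Properties using (≡-dec; lookup-map; zipWith-identityˡ)
open import Data.Vec.Relation.Unary.All as Allⱽ using ([]; _∷_) renaming (All to Allⱽ)
import Data.Vec.Relation.Unary.All.Properties as Allⱽ
open import Data.Vec.Relation.Unary.AllPairs using (AllPairs; []; _∷_)
open import Data.Vec.N-ary using (N-ary; _$ⁿ_)
open import Function.Base using (_∘_; id)
open import Function.Bundles using (Equivalence; mk⇔)
open import Level using (_⊔_)
open import Relation.Binary.PropositionalEquality as ≡ using (_≡_; _≢_)
open import Relation.Nullary using (¬_; Dec; yes; no)
open import Relation.Nullary.Decidable using (does; dec-true; dec-false; decidable-stable)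

-- The function field is an abstract `K` without normal forms, so nothing in it can be computed
-- directly. Polynomial identities are decided over ℤ by reflection. That a function is nonzero is
-- mostly seen by specialising to a rational point of the plane curve, for which its nodes serve.
-- Automorphisms are constructed from polynomial involutions of the plane; they are well defined on
-- quotients of forms because a form vanishing at `ξ` is a multiple of the sextic. Exact degrees of
-- extensions never enter. The descent compares a degree bound with a list of distinct conjugates,
-- and the ramification argument follows only divisibility of values through the tower. The latter
-- chooses a polynomial of least degree, which constructively exists only up to double negation;
-- this is harmless because divisibility in ℤ is decidable.

-- Identities between integral polynomials

infix  4 _⊜_
infixl 6 _⊕_ _⊖_
infixl 7 _⊗_
infixr 8 _⊛_
infix  9 ⊝_

-- Constants are integers, so that normalisation computes in ℤ and never reduces fractions;
-- denominators are cleared in the identities beforehand.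
data Expr (n : ℕ) : Set where
  con         : ℤ → Expr n
  slot        : Fin n → Expr n
  _⊕_ _⊗_ _⊖_ : Expr n → Expr n → Expr n
  ⊝_          : Expr n → Expr n
  _⊛_         : Expr n → ℕ → Expr n

_⊜_ : ∀ {n} → Expr n → Expr n → Expr n × Expr n
_⊜_ = _,_

κ : ∀ {n} → ℕ → Expr n
κ k = con (+ k)

-- Recursive Horner form, the first variable outermost.
Dense : ℕ → Set
Dense zero    = ℤ
Dense (suc n) = List (Dense n)

zeroᴰ : ∀ n → Dense n
zeroᴰ zero    = 0ℤ
zeroᴰ (suc n) = []

conᴰ : ∀ n → ℤ → Dense n
conᴰ zero    z = z
conᴰ (suc n) z = conᴰ n z ∷ []

varᴰ : ∀ {n} → Fin n → Dense n
varᴰ {suc n} zero    = zeroᴰ n ∷ conᴰ n 1ℤ ∷ []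
varᴰ {suc n} (suc i) = varᴰ i ∷ []

addᴰ : ∀ n → Dense n → Dense n → Dense n
addᴰ zero    y       z       = y ℤ.+ z
addᴰ (suc n) []      q       = q
addᴰ (suc n) (a ∷ p) []      = a ∷ p
addᴰ (suc n) (a ∷ p) (b ∷ q) = addᴰ n a b ∷ addᴰ (suc n) p q

isZero : ∀ n → Dense n → Bool
isZero zero    (+ 0) = true
isZero zero    _     = false
isZero (suc n) []      = true
isZero (suc n) (a ∷ p) = isZero n a ∧ isZero (suc n) p

-- The zero test skips absent powers, which keeps products of sparse polynomials of high degree
-- cheap.
mulᴰ : ∀ n → Dense n → Dense n → Dense n
mulᴰ zero    y       z = y ℤ.* z
mulᴰ (suc n) []      q = []
mulᴰ (suc n) (a ∷ p) q = if isZero n a then zeroᴰ n ∷ mulᴰ (suc n) p q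
  else addᴰ (suc n) (map (mulᴰ n a) q) (zeroᴰ n ∷ mulᴰ (suc n) p q)

negᴰ : ∀ n → Dense n → Dense n
negᴰ zero    z = ℤ.- z
negᴰ (suc n) p = map (negᴰ n) p

powᴰ : ∀ n → Dense n → ℕ → Dense n
powᴰ n p zero    = conᴰ n 1ℤ
powᴰ n p (suc k) = mulᴰ n p (powᴰ n p k)

normalise : ∀ {n} → Expr n → Dense n
normalise     (con z) = conᴰ _ z
normalise     (slot i) = varᴰ i
normalise {n} (a ⊕ b) = addᴰ n (normalise a) (normalise b)
normalise {n} (a ⊗ b) = mulᴰ n (normalise a) (normalise b)
normalise {n} (a ⊖ b) = addᴰ n (normalise a) (negᴰ n (normalise b))
normalise {n} (⊝ a)   = negᴰ n (normalise a)
normalise {n} (a ⊛ k) = powᴰ n (normalise a) k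

-- Remainder of a polynomial in the first variable x modulo x² + b x + a.
mod² : ∀ n → Dense n → Dense n → Dense (suc n) → Dense n × Dense n
mod² n a b []      = zeroᴰ n , zeroᴰ n
mod² n a b (d ∷ p) with mod² n a b p
... | r , s = addᴰ n d (negᴰ n (mulᴰ n a s)) , addᴰ n r (negᴰ n (mulᴰ n b s))

vars : ∀ n → Vec (Expr n) n
vars n = Vec.tabulate slot

module Identities {c ℓ} (K : FieldOverℚ c ℓ) where
  open FieldOverℚ K
  open import Algebra.Properties.Ring ring
    using (-0#≈0#; -‿distribʳ-*; -‿+-comm)
  open import Algebra.Properties.Group +-group using ()
    renaming (x∙y⁻¹≈ε⇒x≈y to x-y≈0⇒x≈y)
  open import Algebra.Properties.Semiring.Exp semiring using (^-congˡ)
  open import Algebra.Properties.CommutativeSemigroup +-commutativeSemigroup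
    using () renaming (interchange to +-interchange)
  open import Algebra.Properties.CommutativeSemigroup *-commutativeSemigroup
    using (x∙yz≈y∙xz)
  open import Relation.Binary.Reasoning.Setoid setoid
  open IsRingHomomorphism ι-hom public using ()
    renaming (+-homo to ι-+; *-homo to ι-*; -‿homo to ι-neg; 0#-homo to ι-0; 1#-homo to ι-1; ⟦⟧-cong to ι-cong)

  -- The cases 0 and 1 make constants agree definitionally with 0# and 1#.
  ⟦_⟧ᶻ : ℤ → Carrier
  ⟦ + 0 ⟧ᶻ = 0#
  ⟦ + 1 ⟧ᶻ = 1#
  ⟦ z   ⟧ᶻ = ι (z ℚ./ 1)

  ⟦_⟧ₑ : ∀ {n} → Expr n → Vec Carrier n → Carrier
  ⟦ con z ⟧ₑ ρ = ⟦ z ⟧ᶻ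
  ⟦ slot i ⟧ₑ ρ = lookup ρ i
  ⟦ a ⊕ b ⟧ₑ ρ = ⟦ a ⟧ₑ ρ + ⟦ b ⟧ₑ ρ
  ⟦ a ⊗ b ⟧ₑ ρ = ⟦ a ⟧ₑ ρ * ⟦ b ⟧ₑ ρ
  ⟦ a ⊖ b ⟧ₑ ρ = ⟦ a ⟧ₑ ρ - ⟦ b ⟧ₑ ρ
  ⟦ ⊝ a   ⟧ₑ ρ = - ⟦ a ⟧ₑ ρ
  ⟦ a ⊛ k ⟧ₑ ρ = ⟦ a ⟧ₑ ρ ^ k

  ι/1-+ : ∀ y z → ι ((y ℤ.+ z) ℚ./ 1) ≈ ι (y ℚ./ 1) + ι (z ℚ./ 1)
  ι/1-+ y z = trans (ι-cong eq) (ι-+ _ _)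
    where
    eq : (y ℤ.+ z) ℚ./ 1 ≡ y ℚ./ 1 ℚ.+ z ℚ./ 1
    eq = ≡.trans (≡.cong (ℚ._/ 1) (≡.cong₂ ℤ._+_ (≡.sym (ℤ.*-identityʳ y)) (≡.sym (ℤ.*-identityʳ z))))
      (ℚ.toℚᵘ-injective (ℚᵘ.≃-trans (ℚ.toℚᵘ-fromℚᵘ (ℚᵘ.mkℚᵘ y 0 ℚᵘ.+ ℚᵘ.mkℚᵘ z 0))
      (ℚᵘ.≃-sym (ℚᵘ.≃-trans (ℚ.toℚᵘ-homo-+ (y ℚ./ 1) (z ℚ./ 1))
        (ℚᵘ.+-cong (ℚ.toℚᵘ-fromℚᵘ (ℚᵘ.mkℚᵘ y 0)) (ℚ.toℚᵘ-fromℚᵘ (ℚᵘ.mkℚᵘ z 0)))))))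

  ι/1-* : ∀ y z → ι ((y ℤ.* z) ℚ./ 1) ≈ ι (y ℚ./ 1) * ι (z ℚ./ 1)
  ι/1-* y z = trans (ι-cong eq) (ι-* _ _)
    where
    eq : (y ℤ.* z) ℚ./ 1 ≡ (y ℚ./ 1) ℚ.* (z ℚ./ 1)
    eq = ℚ.toℚᵘ-injective (ℚᵘ.≃-trans (ℚ.toℚᵘ-fromℚᵘ (ℚᵘ.mkℚᵘ y 0 ℚᵘ.* ℚᵘ.mkℚᵘ z 0))
      (ℚᵘ.≃-sym (ℚᵘ.≃-trans (ℚ.toℚᵘ-homo-* (y ℚ./ 1) (z ℚ./ 1))
        (ℚᵘ.*-cong (ℚ.toℚᵘ-fromℚᵘ (ℚᵘ.mkℚᵘ y 0)) (ℚ.toℚᵘ-fromℚᵘ (ℚᵘ.mkℚᵘ z 0))))))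

  ⟦⟧ᶻ≈ι : ∀ z → ⟦ z ⟧ᶻ ≈ ι (z ℚ./ 1)
  ⟦⟧ᶻ≈ι (+ 0)           = sym ι-0
  ⟦⟧ᶻ≈ι (+ 1)           = sym ι-1
  ⟦⟧ᶻ≈ι (+ suc (suc n)) = refl
  ⟦⟧ᶻ≈ι -[1+ n ]        = refl

  evalᴰ : ∀ n → Dense n → Vec Carrier n → Carrier
  evalᴰ zero    z       []      = ι (z ℚ./ 1)
  evalᴰ (suc n) []      (x ∷ ρ) = 0#
  evalᴰ (suc n) (a ∷ p) (x ∷ ρ) = evalᴰ n a ρ + x * evalᴰ (suc n) p (x ∷ ρ)

  conᴰ-sound : ∀ n z ρ → evalᴰ n (conᴰ n z) ρ ≈ ι (z ℚ./ 1)
  conᴰ-sound zero    z []      = refl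
  conᴰ-sound (suc n) z (x ∷ ρ) =
    trans (+-cong (conᴰ-sound n z ρ) (zeroʳ x)) (+-identityʳ _)

  zeroᴰ-sound : ∀ n ρ → evalᴰ n (zeroᴰ n) ρ ≈ 0#
  zeroᴰ-sound zero    []      = ι-0
  zeroᴰ-sound (suc n) (x ∷ ρ) = refl

  varᴰ-sound : ∀ {n} i ρ → evalᴰ n (varᴰ i) ρ ≈ lookup ρ i
  varᴰ-sound {suc n} zero (x ∷ ρ) = begin
    evalᴰ n (zeroᴰ n) ρ + x * (evalᴰ n (conᴰ n 1ℤ) ρ + x * 0#)
      ≈⟨ +-cong (zeroᴰ-sound n ρ) (*-congˡ (+-cong (trans (conᴰ-sound n 1ℤ ρ) ι-1) (zeroʳ x))) ⟩
    0# + x * (1# + 0#) ≈⟨ +-identityˡ _ ⟩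
    x * (1# + 0#) ≈⟨ *-congˡ (+-identityʳ 1#) ⟩
    x * 1# ≈⟨ *-identityʳ x ⟩
    x ∎
  varᴰ-sound (suc i) (x ∷ ρ) =
    trans (+-cong (varᴰ-sound i ρ) (zeroʳ x)) (+-identityʳ _)

  addᴰ-sound : ∀ n p q ρ → evalᴰ n (addᴰ n p q) ρ ≈ evalᴰ n p ρ + evalᴰ n q ρ
  addᴰ-sound zero    y       z       []      = ι/1-+ y z
  addᴰ-sound (suc n) []      q       (x ∷ ρ) = sym (+-identityˡ _)
  addᴰ-sound (suc n) (a ∷ p) []      (x ∷ ρ) = sym (+-identityʳ _)
  addᴰ-sound (suc n) (a ∷ p) (b ∷ q) (x ∷ ρ) = begin
    evalᴰ n (addᴰ n a b) ρ + x * evalᴰ (suc n) (addᴰ (suc n) p q) (x ∷ ρ)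
      ≈⟨ +-cong (addᴰ-sound n a b ρ) (trans (*-congˡ (addᴰ-sound (suc n) p q (x ∷ ρ))) (distribˡ x _ _)) ⟩
    _ ≈⟨ +-interchange _ _ _ _ ⟩
    _ ∎

  isZero-sound : ∀ n p ρ → T (isZero n p) → evalᴰ n p ρ ≈ 0#
  isZero-sound zero    (+ 0)   []      _ = ι-0
  isZero-sound (suc n) []      (x ∷ ρ) _ = refl
  isZero-sound (suc n) (a ∷ p) (x ∷ ρ) t with isZero n a in eq
  ... | true = begin
    evalᴰ n a ρ + x * evalᴰ (suc n) p (x ∷ ρ)
      ≈⟨ +-cong (isZero-sound n a ρ (≡.subst T (≡.sym eq) tt)) (*-congˡ (isZero-sound (suc n) p (x ∷ ρ) t)) ⟩
    0# + x * 0# ≈⟨ trans (+-identityˡ _) (zeroʳ x) ⟩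
    0# ∎

  mulᴰ-sound : ∀ n p q ρ → evalᴰ n (mulᴰ n p q) ρ ≈ evalᴰ n p ρ * evalᴰ n q ρ
  scaleᴰ-sound : ∀ n a q x ρ →
    evalᴰ (suc n) (map (mulᴰ n a) q) (x ∷ ρ) ≈ evalᴰ n a ρ * evalᴰ (suc n) q (x ∷ ρ)

  mulᴰ-sound zero    y       z []      = ι/1-* y z
  mulᴰ-sound (suc n) []      q (x ∷ ρ) = sym (zeroˡ _)
  mulᴰ-sound (suc n) (a ∷ p) q (x ∷ ρ) with isZero n a in eq
  ... | true = begin
    evalᴰ n (zeroᴰ n) ρ + x * evalᴰ (suc n) (mulᴰ (suc n) p q) (x ∷ ρ)
      ≈⟨ +-cong (zeroᴰ-sound n ρ) (trans (*-congˡ (mulᴰ-sound (suc n) p q (x ∷ ρ))) (sym (*-assoc x P Q))) ⟩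
    0# + x * P * Q ≈⟨ trans (+-identityˡ _) (*-congʳ (sym (+-identityˡ (x * P)))) ⟩
    (0# + x * P) * Q ≈⟨ *-congʳ (+-congʳ (isZero-sound n a ρ (≡.subst T (≡.sym eq) tt))) ⟨
    (A + x * P) * Q ∎
    where
    A = evalᴰ n a ρ
    P = evalᴰ (suc n) p (x ∷ ρ)
    Q = evalᴰ (suc n) q (x ∷ ρ)
  ... | false = begin
    evalᴰ (suc n) (addᴰ (suc n) (map (mulᴰ n a) q) (zeroᴰ n ∷ mulᴰ (suc n) p q)) (x ∷ ρ)
      ≈⟨ addᴰ-sound (suc n) (map (mulᴰ n a) q) _ (x ∷ ρ) ⟩
    evalᴰ (suc n) (map (mulᴰ n a) q) (x ∷ ρ) +
      (evalᴰ n (zeroᴰ n) ρ + x * evalᴰ (suc n) (mulᴰ (suc n) p q) (x ∷ ρ))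
      ≈⟨ +-cong (scaleᴰ-sound n a q x ρ)
           (trans (+-cong (zeroᴰ-sound n ρ) (*-congˡ (mulᴰ-sound (suc n) p q (x ∷ ρ)))) (+-identityˡ _)) ⟩
    A * Q + x * (P * Q) ≈⟨ +-congˡ (*-assoc x P Q) ⟨
    A * Q + x * P * Q ≈⟨ distribʳ Q A (x * P) ⟨
    (A + x * P) * Q ∎
    where
    A = evalᴰ n a ρ
    P = evalᴰ (suc n) p (x ∷ ρ)
    Q = evalᴰ (suc n) q (x ∷ ρ)

  scaleᴰ-sound n a []      x ρ = sym (zeroʳ _)
  scaleᴰ-sound n a (b ∷ q) x ρ = begin
    evalᴰ n (mulᴰ n a b) ρ + x * evalᴰ (suc n) (map (mulᴰ n a) q) (x ∷ ρ)
      ≈⟨ +-cong (mulᴰ-sound n a b ρ) (*-congˡ (scaleᴰ-sound n a q x ρ)) ⟩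
    A * B + x * (A * Q) ≈⟨ +-congˡ (x∙yz≈y∙xz x A Q) ⟩
    A * B + A * (x * Q) ≈⟨ distribˡ A B (x * Q) ⟨
    A * (B + x * Q) ∎
    where
    A = evalᴰ n a ρ
    B = evalᴰ n b ρ
    Q = evalᴰ (suc n) q (x ∷ ρ)

  negᴰ-sound : ∀ n p ρ → evalᴰ n (negᴰ n p) ρ ≈ - evalᴰ n p ρ
  negᴰ-sound zero z [] = trans (ι-cong (neg-/1 z)) (ι-neg _)
    where
    neg-/1 : ∀ z → (ℤ.- z) ℚ./ 1 ≡ ℚ.- (z ℚ./ 1)
    neg-/1 (+ 0)     = ≡.refl
    neg-/1 (+ suc n) = ≡.refl
    neg-/1 -[1+ n ]  = ≡.sym (ℚ-neg-involutive _)
  negᴰ-sound (suc n) []      (x ∷ ρ) = sym -0#≈0#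
  negᴰ-sound (suc n) (a ∷ p) (x ∷ ρ) = begin
    evalᴰ n (negᴰ n a) ρ + x * evalᴰ (suc n) (negᴰ (suc n) p) (x ∷ ρ)
      ≈⟨ +-cong (negᴰ-sound n a ρ) (trans (*-congˡ (negᴰ-sound (suc n) p (x ∷ ρ))) (sym (-‿distribʳ-* x _))) ⟩
    _ ≈⟨ -‿+-comm _ _ ⟩
    _ ∎

  powᴰ-sound : ∀ n p k ρ → evalᴰ n (powᴰ n p k) ρ ≈ evalᴰ n p ρ ^ k
  powᴰ-sound n p zero    ρ = trans (conᴰ-sound n 1ℤ ρ) ι-1
  powᴰ-sound n p (suc k) ρ =
    trans (mulᴰ-sound n p (powᴰ n p k) ρ) (*-congˡ (powᴰ-sound n p k ρ))

  normalise-sound : ∀ {n} e ρ → evalᴰ n (normalise e) ρ ≈ ⟦ e ⟧ₑ ρ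
  normalise-sound {n} (con z) ρ = trans (conᴰ-sound n z ρ) (sym (⟦⟧ᶻ≈ι z))
  normalise-sound     (slot i) ρ = varᴰ-sound i ρ
  normalise-sound {n} (a ⊕ b) ρ =
    trans (addᴰ-sound n (normalise a) (normalise b) ρ) (+-cong (normalise-sound a ρ) (normalise-sound b ρ))
  normalise-sound {n} (a ⊗ b) ρ =
    trans (mulᴰ-sound n (normalise a) (normalise b) ρ) (*-cong (normalise-sound a ρ) (normalise-sound b ρ))
  normalise-sound {n} (a ⊖ b) ρ =
    trans (addᴰ-sound n (normalise a) (negᴰ n (normalise b)) ρ)
      (+-cong (normalise-sound a ρ) (trans (negᴰ-sound n (normalise b) ρ) (-‿cong (normalise-sound b ρ))))
  normalise-sound {n} (⊝ a)   ρ = trans (negᴰ-sound n (normalise a) ρ) (-‿cong (normalise-sound a ρ))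
  normalise-sound {n} (a ⊛ k) ρ =
    trans (powᴰ-sound n (normalise a) k ρ) (^-congˡ k (normalise-sound a ρ))

  -- When the difference of the two sides normalises to zero, the type of the implicit argument
  -- computes to the unit type, and the argument is found by η.
  solve : ∀ n (f : N-ary n (Expr n) (Expr n × Expr n)) →
          let e = f $ⁿ vars n in
          {_ : T (isZero n (normalise (proj₁ e ⊖ proj₂ e)))} →
          ∀ ρ → ⟦ proj₁ e ⟧ₑ ρ ≈ ⟦ proj₂ e ⟧ₑ ρ
  solve n f {t} ρ = x-y≈0⇒x≈y _ _
    (trans (sym (normalise-sound (proj₁ e ⊖ proj₂ e) ρ)) (isZero-sound n _ ρ t))
    where e = f $ⁿ vars n

  -- If the tail of the Horner form is `R + x S`, multiplication by `x` produces `x² S`, which the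
  -- equation turns into `−(B x + A) S`.
  mod²-sound : ∀ n a b p x ρ → x * x + (evalᴰ n b ρ * x + evalᴰ n a ρ) ≈ 0# →
    evalᴰ (suc n) p (x ∷ ρ) ≈
    evalᴰ n (proj₁ (mod² n a b p)) ρ + x * evalᴰ n (proj₂ (mod² n a b p)) ρ
  mod²-sound n a b []      x ρ eq = sym (begin
    evalᴰ n (zeroᴰ n) ρ + x * evalᴰ n (zeroᴰ n) ρ
      ≈⟨ +-cong (zeroᴰ-sound n ρ) (trans (*-congˡ (zeroᴰ-sound n ρ)) (zeroʳ x)) ⟩
    0# + 0# ≈⟨ +-identityˡ 0# ⟩
    0# ∎)
  mod²-sound n a b (d ∷ p) x ρ eq = begin
    D + x * evalᴰ (suc n) p (x ∷ ρ) ≈⟨ +-congˡ (*-congˡ (mod²-sound n a b p x ρ eq)) ⟩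
    D + x * (R + x * S) ≈⟨ rearrange ⟩
    (D + - (A * S)) + x * (R + - (B * S)) + (x * x + (B * x + A)) * S
      ≈⟨ +-congˡ (trans (*-congʳ eq) (zeroˡ S)) ⟩
    (D + - (A * S)) + x * (R + - (B * S)) + 0# ≈⟨ +-identityʳ _ ⟩
    (D + - (A * S)) + x * (R + - (B * S))
      ≈⟨ +-cong (sub-sound d a) (*-congˡ (sub-sound r b)) ⟨
    _ ∎
    where
    r = proj₁ (mod² n a b p)
    s = proj₂ (mod² n a b p)
    D = evalᴰ n d ρ
    A = evalᴰ n a ρ
    B = evalᴰ n b ρ
    R = evalᴰ n r ρ
    S = evalᴰ n s ρ
    sub-sound : ∀ u v → evalᴰ n (addᴰ n u (negᴰ n (mulᴰ n v s))) ρ ≈ evalᴰ n u ρ + - (evalᴰ n v ρ * S)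
    sub-sound u v = trans (addᴰ-sound n u _ ρ)
      (+-congˡ (trans (negᴰ-sound n _ ρ) (-‿cong (mulᴰ-sound n v s ρ))))
    rearrange : D + x * (R + x * S) ≈
      (D + - (A * S)) + x * (R + - (B * S)) + (x * x + (B * x + A)) * S
    rearrange = solve 6 (λ D A B R S x →
      D ⊕ x ⊗ (R ⊕ x ⊗ S) ⊜ (D ⊕ ⊝ (A ⊗ S)) ⊕ x ⊗ (R ⊕ ⊝ (B ⊗ S)) ⊕ (x ⊗ x ⊕ (B ⊗ x ⊕ A)) ⊗ S)
      (D ∷ A ∷ B ∷ R ∷ S ∷ x ∷ [])

  -- Decides identities that hold only modulo the quadratic equation of `x`; the remainder is
  -- computed and no cofactor has to be written down.
  solve-mod² : ∀ n (b a : Expr n) (e : Expr (suc n)) →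
    let m = mod² n (normalise a) (normalise b) (normalise e) in
    {_ : T (isZero n (proj₁ m) ∧ isZero n (proj₂ m))} →
    ∀ x ρ → x * x + (⟦ b ⟧ₑ ρ * x + ⟦ a ⟧ₑ ρ) ≈ 0# → ⟦ e ⟧ₑ (x ∷ ρ) ≈ 0#
  solve-mod² n b a e {t} x ρ eq = begin
    ⟦ e ⟧ₑ (x ∷ ρ) ≈⟨ normalise-sound e (x ∷ ρ) ⟨
    evalᴰ (suc n) (normalise e) (x ∷ ρ)
      ≈⟨ mod²-sound n (normalise a) (normalise b) (normalise e) x ρ
           (trans (+-congˡ (+-cong (*-congʳ (normalise-sound b ρ)) (normalise-sound a ρ))) eq) ⟩
    evalᴰ n (proj₁ m) ρ + x * evalᴰ n (proj₂ m) ρ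
      ≈⟨ +-cong (isZero-sound n _ ρ (proj₁ ts)) (trans (*-congˡ (isZero-sound n _ ρ (proj₂ ts))) (zeroʳ x)) ⟩
    0# + 0# ≈⟨ +-identityˡ 0# ⟩
    0# ∎
    where
    m = mod² n (normalise a) (normalise b) (normalise e)
    ts = Equivalence.to T-∧ t

-- Polynomials over ℚ

-- The relation `_≋_` speaks of total coefficients, while terms may be repeated. Collecting the
-- terms of one exponent vector at a time connects it with `eval`.
remove : ∀ {n} → Vec ℕ n → Poly n → Poly n
remove m []            = []
remove m ((a , k) ∷ p) = if does (≡-dec ℕ._≟_ k m) then remove m p else (a , k) ∷ remove m p

coeff-remove-same : ∀ {n} (m : Vec ℕ n) p → coeff (remove m p) m ≡ 0ℚ
coeff-remove-same m []            = ≡.refl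
coeff-remove-same m ((a , k) ∷ p) with ≡-dec ℕ._≟_ k m in eq
... | yes _ = coeff-remove-same m p
... | no  _ rewrite eq = coeff-remove-same m p

coeff-remove-other : ∀ {n} {m e : Vec ℕ n} p → m ≢ e → coeff (remove m p) e ≡ coeff p e
coeff-remove-other                 []            m≢e = ≡.refl
coeff-remove-other {m = m} {e = e} ((a , k) ∷ p) m≢e with ≡-dec ℕ._≟_ k m
... | yes ≡.refl rewrite dec-false (≡-dec ℕ._≟_ m e) m≢e = coeff-remove-other p m≢e
... | no  _ with does (≡-dec ℕ._≟_ k e)
...   | true  = ≡.cong (a ℚ.+_) (coeff-remove-other p m≢e)
...   | false = coeff-remove-other p m≢e

remove-≋[] : ∀ {n} (m : Vec ℕ n) p → p ≋ [] → remove m p ≋ []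
remove-≋[] m p p≋0 e with ≡-dec ℕ._≟_ m e
... | yes ≡.refl = coeff-remove-same m p
... | no  m≢e    = ≡.trans (coeff-remove-other p m≢e) (p≋0 e)

length-remove : ∀ {n} (m : Vec ℕ n) p → List.length (remove m p) ℕ.≤ List.length p
length-remove m []            = ℕ.z≤n
length-remove m ((a , k) ∷ p) with does (≡-dec ℕ._≟_ k m)
... | true  = ℕ.m≤n⇒m≤1+n (length-remove m p)
... | false = ℕ.s≤s (length-remove m p)

length-remove-head : ∀ {n} a (m : Vec ℕ n) p →
  List.length (remove m ((a , m) ∷ p)) ℕ.≤ List.length p
length-remove-head a m p rewrite dec-true (≡-dec ℕ._≟_ m m) ≡.refl = length-remove m p

constᴾ-1-* : ∀ {n} (p : Poly n) → constᴾ 1ℚ *ᴾ p ≡ p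
constᴾ-1-* p = ≡.trans (++-identityʳ _) (unit p)
  where
  unit : ∀ {n} (p : Poly n) → map (λ (d , k) → 1ℚ ℚ.* d , Vec.zipWith ℕ._+_ (Vec.replicate n 0) k) p ≡ p
  unit []            = ≡.refl
  unit ((a , m) ∷ p) =
    ≡.cong₂ _∷_ (≡.cong₂ _,_ (ℚ.*-identityˡ a) (zipWith-identityˡ ℕ.+-identityˡ m)) (unit p)

negate : ∀ {n} → Poly n → Poly n
negate = map λ (a , m) → ℚ.- a , m

coeff-difference : ∀ {n} (p q : Poly n) e → coeff (p ++ negate q) e ≡ coeff p e ℚ.- coeff q e
coeff-difference ((a , m) ∷ p) q e with does (≡-dec ℕ._≟_ m e)
... | true  = ≡.trans (≡.cong (a ℚ.+_) (coeff-difference p q e)) (≡.sym (ℚ.+-assoc a _ _))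
... | false = coeff-difference p q e
coeff-difference [] q e = ≡.trans (coeff-negate q) (≡.sym (ℚ.+-identityˡ _))
  where
  coeff-negate : ∀ q → coeff (negate q) e ≡ ℚ.- coeff q e
  coeff-negate []            = ≡.refl
  coeff-negate ((a , m) ∷ q) with does (≡-dec ℕ._≟_ m e)
  ... | true  = ≡.trans (≡.cong (ℚ.- a ℚ.+_) (coeff-negate q)) (≡.sym (ℚ.neg-distrib-+ a _))
  ... | false = coeff-negate q

-- This is (p(t) - p(0))/t.
shift : Poly 1 → Poly 1
shift []                     = []
shift ((a , zero ∷ [])  ∷ p) = shift p
shift ((a , suc k ∷ []) ∷ p) = (a , k ∷ []) ∷ shift p

coeff-shift : ∀ p k → coeff (shift p) (k ∷ []) ≡ coeff p (suc k ∷ [])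
coeff-shift []                     k = ≡.refl
coeff-shift ((a , zero ∷ [])  ∷ p) k = coeff-shift p k
coeff-shift ((a , suc j ∷ []) ∷ p) k =
  ≡.cong₂ (λ b c → if b then a ℚ.+ c else c) (same (j ℕ.≟ k)) (coeff-shift p k)
  where
  same : Dec (j ≡ k) →
    does (≡-dec ℕ._≟_ (j ∷ []) (k ∷ [])) ≡ does (≡-dec ℕ._≟_ (suc j ∷ []) (suc k ∷ []))
  same (yes ≡.refl) = ≡.trans (dec-true (≡-dec ℕ._≟_ (j ∷ []) (j ∷ [])) ≡.refl)
    (≡.sym (dec-true (≡-dec ℕ._≟_ (suc j ∷ []) (suc j ∷ [])) ≡.refl))
  same (no j≢k) = ≡.trans (dec-false (≡-dec ℕ._≟_ (j ∷ []) (k ∷ [])) λ { ≡.refl → j≢k ≡.refl })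
    (≡.sym (dec-false (≡-dec ℕ._≟_ (suc j ∷ []) (suc k ∷ [])) λ { ≡.refl → j≢k ≡.refl }))

power : ∀ {n k} → Vec ℕ n → (Fin n → Poly k) → Poly k
power []      g = constᴾ 1ℚ
power (a ∷ m) g = g 0F ^ᴾ a *ᴾ power m (g ∘ suc)

substitute : ∀ {n k} → Poly n → (Fin n → Poly k) → Poly k
substitute []            g = []
substitute ((a , m) ∷ p) g = constᴾ a *ᴾ power m g +ᴾ substitute p g

homogeneous-+ : ∀ {n d} {p q : Poly n} → Homogeneous d p → Homogeneous d q → Homogeneous d (p +ᴾ q)
homogeneous-+ = All.++⁺

homogeneous-* : ∀ {n d k} (p q : Poly n) →
  Homogeneous d p → Homogeneous k q → Homogeneous (d ℕ.+ k) (p *ᴾ q)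
homogeneous-* []            q []              hq = []
homogeneous-* ((a , m) ∷ p) q (≡.refl ∷ hp) hq = All.++⁺ (scaled hq) (homogeneous-* p q hp hq)
  where
  sum-+ : ∀ {n} (m k : Vec ℕ n) → Vec.sum (Vec.zipWith ℕ._+_ m k) ≡ Vec.sum m ℕ.+ Vec.sum k
  sum-+ []      []      = ≡.refl
  sum-+ (x ∷ m) (y ∷ k) = ≡.trans (≡.cong ((x ℕ.+ y) ℕ.+_) (sum-+ m k)) (ℕ+-interchange x y _ _)
  scaled : ∀ {k q} → Homogeneous k q →
    Homogeneous (Vec.sum m ℕ.+ k) (map (λ (d , k) → a ℚ.* d , Vec.zipWith ℕ._+_ m k) q)
  scaled []                               = []
  scaled (_∷_ {x = d , k} ≡.refl hq) = sum-+ m k ∷ scaled hq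

homogeneous-const : ∀ {n} a → Homogeneous {n} 0 (constᴾ a)
homogeneous-const {n} a = sum-0 n ∷ []
  where
  sum-0 : ∀ n → Vec.sum (Vec.replicate n 0) ≡ 0
  sum-0 zero    = ≡.refl
  sum-0 (suc n) = sum-0 n

homogeneous-- : ∀ {n d} (p q : Poly n) → Homogeneous d p → Homogeneous d q → Homogeneous d (p -ᴾ q)
homogeneous-- p q hp hq =
  homogeneous-+ hp (homogeneous-* (constᴾ (ℚ.- 1ℚ)) q (homogeneous-const (ℚ.- 1ℚ)) hq)

-- Fractions of forms of equal degree are added and compared through these two products; their
-- common degree keeps the sum and the difference homogeneous.
homogeneous-cross : ∀ {n d k} (P Q P′ Q′ : Poly n) → Homogeneous d P → Homogeneous d Q →
  Homogeneous k P′ → Homogeneous k Q′ → Homogeneous (d ℕ.+ k) (P *ᴾ Q′) × Homogeneous (d ℕ.+ k) (P′ *ᴾ Q)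
homogeneous-cross {d = d} {k} P Q P′ Q′ hP hQ hP′ hQ′ = homogeneous-* P Q′ hP hQ′ ,
  ≡.subst (λ s → Homogeneous s (P′ *ᴾ Q)) (ℕ.+-comm k d) (homogeneous-* P′ Q hP′ hQ)

homogeneous-^ : ∀ {n d} (p : Poly n) k → Homogeneous d p → Homogeneous (k ℕ.* d) (p ^ᴾ k)
homogeneous-^ p zero    hp = homogeneous-const 1ℚ
homogeneous-^ p (suc k) hp = homogeneous-* p (p ^ᴾ k) hp (homogeneous-^ p k hp)

homogeneous-power : ∀ {n k d} (m : Vec ℕ n) (g : Fin n → Poly k) → (∀ i → Homogeneous d (g i)) →
  Homogeneous (Vec.sum m ℕ.* d) (power m g)
homogeneous-power         []      g hg = homogeneous-const 1ℚ
homogeneous-power {d = d} (a ∷ m) g hg =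
  ≡.subst (λ s → Homogeneous s (power (a ∷ m) g)) (≡.sym (ℕ.*-distribʳ-+ d a (Vec.sum m)))
    (homogeneous-* (g 0F ^ᴾ a) (power m (g ∘ suc))
      (homogeneous-^ (g 0F) a (hg 0F)) (homogeneous-power m (g ∘ suc) (hg ∘ suc)))

homogeneous-substitute : ∀ {n k d r} (p : Poly n) (g : Fin n → Poly k) →
  Homogeneous r p → (∀ i → Homogeneous d (g i)) → Homogeneous (r ℕ.* d) (substitute p g)
homogeneous-substitute []            g []              hg = []
homogeneous-substitute ((a , m) ∷ p) g (≡.refl ∷ hp) hg = homogeneous-+
  (homogeneous-* (constᴾ a) (power m g) (homogeneous-const a) (homogeneous-power m g hg))
  (homogeneous-substitute p g hp hg)

-- Arithmetic in an extension of ℚ and evaluation of polynomials.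

module FieldLemmas {c ℓ} (K : FieldOverℚ c ℓ) where
  open FieldOverℚ K
  open Identities K
  open import Algebra.Properties.Group +-group public using ()
    renaming (x∙y⁻¹≈ε⇒x≈y to x-y≈0⇒x≈y; x≈y⇒x∙y⁻¹≈ε to x≈y⇒x-y≈0)
  open import Algebra.Properties.Semiring.Exp semiring public using (^-congˡ; ^-homo-*)
  open import Relation.Binary.Reasoning.Setoid setoid

  ⁻¹-inverseʳ : ∀ {x} → x ≉ 0# → x * x ⁻¹ ≈ 1#
  ⁻¹-inverseʳ {x} x≉0 with x ≟ 0#
  ... | yes x≈0 = ⊥-elim (x≉0 x≈0)
  ... | no  x≉0 = proj₂ (inverse x x≉0)

  *-zero-product : ∀ {x y} → x * y ≈ 0# → x ≉ 0# → y ≈ 0#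
  *-zero-product {x} {y} xy≈0 x≉0 = begin
    y ≈⟨ *-identityˡ y ⟨
    1# * y ≈⟨ *-congʳ (⁻¹-inverseʳ x≉0) ⟨
    x * x ⁻¹ * y ≈⟨ solve 3 (λ x z y → x ⊗ z ⊗ y ⊜ z ⊗ (x ⊗ y)) (x ∷ x ⁻¹ ∷ y ∷ []) ⟩
    x ⁻¹ * (x * y) ≈⟨ *-congˡ xy≈0 ⟩
    x ⁻¹ * 0# ≈⟨ zeroʳ _ ⟩
    0# ∎

  *-nonzero : ∀ {x y} → x ≉ 0# → y ≉ 0# → x * y ≉ 0#
  *-nonzero x≉0 y≉0 xy≈0 = y≉0 (*-zero-product xy≈0 x≉0)

  nonzero-*ˡ : ∀ {x y} → x * y ≉ 0# → x ≉ 0#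
  nonzero-*ˡ xy≉0 x≈0 = xy≉0 (trans (*-congʳ x≈0) (zeroˡ _))

  nonzero-*ʳ : ∀ {x y} → x * y ≉ 0# → y ≉ 0#
  nonzero-*ʳ xy≉0 y≈0 = xy≉0 (trans (*-congˡ y≈0) (zeroʳ _))

  nonzero-cong : ∀ {x y} → x ≈ y → x ≉ 0# → y ≉ 0#
  nonzero-cong x≈y x≉0 y≈0 = x≉0 (trans x≈y y≈0)

  ^-nonzero : ∀ {x} n → x ≉ 0# → x ^ n ≉ 0#
  ^-nonzero zero    x≉0 = 1≉0
  ^-nonzero (suc n) x≉0 = *-nonzero x≉0 (^-nonzero n x≉0)

  *-cancelˡ-nonzero : ∀ {x y z} → x ≉ 0# → x * y ≈ x * z → y ≈ z
  *-cancelˡ-nonzero {x} {y} {z} x≉0 eq = x-y≈0⇒x≈y y z (*-zero-product (begin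
    x * (y - z) ≈⟨ solve 3 (λ x y z → x ⊗ (y ⊖ z) ⊜ x ⊗ y ⊖ x ⊗ z) (x ∷ y ∷ z ∷ []) ⟩
    x * y - x * z ≈⟨ x≈y⇒x-y≈0 eq ⟩
    0# ∎) x≉0)

  ⁻¹-nonzero : ∀ {x} → x ≉ 0# → x ⁻¹ ≉ 0#
  ⁻¹-nonzero x≉0 = nonzero-*ʳ (nonzero-cong (sym (⁻¹-inverseʳ x≉0)) 1≉0)

  ⁻¹-unique : ∀ {x y} → x * y ≈ 1# → y ≈ x ⁻¹
  ⁻¹-unique {x} xy≈1 = *-cancelˡ-nonzero x≉0 (trans xy≈1 (sym (⁻¹-inverseʳ x≉0)))
    where
    x≉0 : x ≉ 0#
    x≉0 = nonzero-*ˡ (nonzero-cong (sym xy≈1) 1≉0)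

  /-*-cancel : ∀ {x y} → y ≉ 0# → x / y * y ≈ x
  /-*-cancel {x} {y} y≉0 = begin
    x * y ⁻¹ * y ≈⟨ solve 3 (λ x z y → x ⊗ z ⊗ y ⊜ x ⊗ (y ⊗ z)) (x ∷ y ⁻¹ ∷ y ∷ []) ⟩
    x * (y * y ⁻¹) ≈⟨ *-congˡ (⁻¹-inverseʳ y≉0) ⟩
    x * 1# ≈⟨ *-identityʳ x ⟩
    x ∎

  fraction-+ : ∀ {f g p q p′ q′} → f * q ≈ p → g * q′ ≈ p′ → (f + g) * (q * q′) ≈ p * q′ + p′ * q
  fraction-+ {f} {g} {p} {q} {p′} {q′} eq eq′ = begin
    (f + g) * (q * q′)
      ≈⟨ solve 4 (λ f g q r → (f ⊕ g) ⊗ (q ⊗ r) ⊜ f ⊗ q ⊗ r ⊕ g ⊗ r ⊗ q) (f ∷ g ∷ q ∷ q′ ∷ []) ⟩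
    f * q * q′ + g * q′ * q ≈⟨ +-cong (*-congʳ eq) (*-congʳ eq′) ⟩
    p * q′ + p′ * q ∎

  fraction-* : ∀ {f g p q p′ q′} → f * q ≈ p → g * q′ ≈ p′ → f * g * (q * q′) ≈ p * p′
  fraction-* {f} {g} {p} {q} {p′} {q′} eq eq′ = trans
    (solve 4 (λ f g q r → f ⊗ g ⊗ (q ⊗ r) ⊜ f ⊗ q ⊗ (g ⊗ r)) (f ∷ g ∷ q ∷ q′ ∷ [])) (*-cong eq eq′)

  fraction-⁻¹ : ∀ {f p q} → f ≉ 0# → f * q ≈ p → f ⁻¹ * p ≈ q
  fraction-⁻¹ {f} {p} {q} f≉0 eq = begin
    f ⁻¹ * p ≈⟨ *-congˡ eq ⟨
    f ⁻¹ * (f * q) ≈⟨ solve 3 (λ f i q → i ⊗ (f ⊗ q) ⊜ f ⊗ i ⊗ q) (f ∷ f ⁻¹ ∷ q ∷ []) ⟩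
    f * f ⁻¹ * q ≈⟨ *-congʳ (⁻¹-inverseʳ f≉0) ⟩
    1# * q ≈⟨ *-identityˡ q ⟩
    q ∎

  ι-nonzero : ∀ {q} → q ≢ 0ℚ → ι q ≉ 0#
  ι-nonzero {q} q≢0 = nonzero-*ˡ (nonzero-cong (trans (sym (trans (ι-cong (ℚ.*-inverseʳ q)) ι-1)) (ι-* q _)) 1≉0)
    where instance _ = ℚ.≢-nonZero q≢0

  #-nonzero : ∀ n → # (suc n) ≉ 0#
  #-nonzero n = ι-nonzero λ eq → absurd (ℚ./-injective-≃ (ℚᵘ.mkℚᵘ (+ suc n) 0) (ℚᵘ.mkℚᵘ 0ℤ 0) eq)
    where
    absurd : ¬ ℚᵘ.mkℚᵘ (+ suc n) 0 ℚᵘ.≃ ℚᵘ.mkℚᵘ 0ℤ 0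
    absurd (ℚᵘ.*≡* ())

  monomial-cong : ∀ {n} (m : Vec ℕ n) {x y : Fin n → Carrier} → (∀ i → x i ≈ y i) →
    monomial m x ≈ monomial m y
  monomial-cong []      x≈y = refl
  monomial-cong (k ∷ m) x≈y = *-cong (^-congˡ k (x≈y 0F)) (monomial-cong m (x≈y ∘ suc))

  eval-cong : ∀ {n} (p : Poly n) {x y : Fin n → Carrier} → (∀ i → x i ≈ y i) → eval p x ≈ eval p y
  eval-cong []            x≈y = refl
  eval-cong ((a , m) ∷ p) x≈y = +-cong (*-congˡ (monomial-cong m x≈y)) (eval-cong p x≈y)

  monomial-1 : ∀ n (x : Fin n → Carrier) → monomial (Vec.replicate n 0) x ≈ 1#
  monomial-1 zero    x = refl
  monomial-1 (suc n) x = trans (*-identityˡ _) (monomial-1 n (x ∘ suc))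

  monomial-var : ∀ {n} i (x : Fin n → Carrier) →
    monomial (Vec.replicate n 0 Vec.[ i ]≔ 1) x ≈ x i
  monomial-var {suc n} zero    x =
    trans (*-congˡ (monomial-1 n (x ∘ suc))) (trans (*-identityʳ _) (*-identityʳ _))
  monomial-var         (suc i) x = trans (*-identityˡ _) (monomial-var i (x ∘ suc))

  monomial-* : ∀ {n} (m k : Vec ℕ n) (x : Fin n → Carrier) →
    monomial (Vec.zipWith ℕ._+_ m k) x ≈ monomial m x * monomial k x
  monomial-* []      []      x = sym (*-identityˡ 1#)
  monomial-* (a ∷ m) (b ∷ k) x = begin
    x 0F ^ (a ℕ.+ b) * monomial (Vec.zipWith ℕ._+_ m k) (x ∘ suc)
      ≈⟨ *-cong (^-homo-* (x 0F) a b) (monomial-* m k (x ∘ suc)) ⟩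
    (x 0F ^ a * x 0F ^ b) * (monomial m (x ∘ suc) * monomial k (x ∘ suc))
      ≈⟨ solve 4 (λ a b c d → (a ⊗ b) ⊗ (c ⊗ d) ⊜ (a ⊗ c) ⊗ (b ⊗ d))
           (x 0F ^ a ∷ x 0F ^ b ∷ monomial m (x ∘ suc) ∷ monomial k (x ∘ suc) ∷ []) ⟩
    _ ∎

  eval-+ : ∀ {n} (p q : Poly n) x → eval (p +ᴾ q) x ≈ eval p x + eval q x
  eval-+ []            q x = sym (+-identityˡ _)
  eval-+ ((a , m) ∷ p) q x = trans (+-congˡ (eval-+ p q x)) (sym (+-assoc _ _ _))

  eval-const : ∀ {n} a (x : Fin n → Carrier) → eval (constᴾ a) x ≈ ι a
  eval-const {n} a x = trans (+-identityʳ _) (trans (*-congˡ (monomial-1 n x)) (*-identityʳ _))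

  eval-var : ∀ {n} (i : Fin n) x → eval (var i) x ≈ x i
  eval-var i x = trans (+-identityʳ _)
    (trans (*-cong ι-1 (monomial-var i x)) (*-identityˡ _))

  eval-* : ∀ {n} (p q : Poly n) x → eval (p *ᴾ q) x ≈ eval p x * eval q x
  eval-* []            q x = sym (zeroˡ _)
  eval-* ((a , m) ∷ p) q x = begin
    eval (map (λ (d , k) → a ℚ.* d , Vec.zipWith ℕ._+_ m k) q ++ p *ᴾ q) x
      ≈⟨ eval-+ (map _ q) (p *ᴾ q) x ⟩
    eval (map (λ (d , k) → a ℚ.* d , Vec.zipWith ℕ._+_ m k) q) x + eval (p *ᴾ q) x
      ≈⟨ +-cong (eval-scale q) (eval-* p q x) ⟩
    ι a * monomial m x * eval q x + eval p x * eval q x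
      ≈⟨ distribʳ _ _ _ ⟨
    _ ∎
    where
    eval-scale : ∀ q → eval (map (λ (d , k) → a ℚ.* d , Vec.zipWith ℕ._+_ m k) q) x ≈
                 ι a * monomial m x * eval q x
    eval-scale []            = sym (zeroʳ _)
    eval-scale ((d , k) ∷ q) = begin
      ι (a ℚ.* d) * monomial (Vec.zipWith ℕ._+_ m k) x + _
        ≈⟨ +-cong (*-cong (ι-* a d) (monomial-* m k x)) (eval-scale q) ⟩
      ι a * ι d * (monomial m x * monomial k x) + ι a * monomial m x * eval q x
        ≈⟨ solve 5 (λ a d m k q → a ⊗ d ⊗ (m ⊗ k) ⊕ a ⊗ m ⊗ q ⊜ a ⊗ m ⊗ (d ⊗ k ⊕ q))
             (ι a ∷ ι d ∷ monomial m x ∷ monomial k x ∷ eval q x ∷ []) ⟩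
      _ ∎

  eval-fraction-+ : ∀ {n f g} (P Q P′ Q′ : Poly n) x → f * eval Q x ≈ eval P x → g * eval Q′ x ≈ eval P′ x →
    (f + g) * eval (Q *ᴾ Q′) x ≈ eval (P *ᴾ Q′ +ᴾ P′ *ᴾ Q) x
  eval-fraction-+ P Q P′ Q′ x eq eq′ = trans (*-congˡ (eval-* Q Q′ x)) (trans (fraction-+ eq eq′)
    (sym (trans (eval-+ (P *ᴾ Q′) (P′ *ᴾ Q) x) (+-cong (eval-* P Q′ x) (eval-* P′ Q x)))))

  eval-fraction-* : ∀ {n f g} (P Q P′ Q′ : Poly n) x → f * eval Q x ≈ eval P x → g * eval Q′ x ≈ eval P′ x →
    f * g * eval (Q *ᴾ Q′) x ≈ eval (P *ᴾ P′) x
  eval-fraction-* P Q P′ Q′ x eq eq′ =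
    trans (*-congˡ (eval-* Q Q′ x)) (trans (fraction-* eq eq′) (sym (eval-* P P′ x)))

  eval-- : ∀ {n} (p q : Poly n) x → eval (p -ᴾ q) x ≈ eval p x - eval q x
  eval-- p q x = begin
    eval (p -ᴾ q) x ≈⟨ eval-+ p _ x ⟩
    eval p x + eval (constᴾ (ℚ.- 1ℚ) *ᴾ q) x ≈⟨ +-congˡ (eval-* (constᴾ (ℚ.- 1ℚ)) q x) ⟩
    eval p x + eval (constᴾ (ℚ.- 1ℚ)) x * eval q x
      ≈⟨ +-congˡ (*-congʳ (trans (eval-const (ℚ.- 1ℚ) x) (trans (ι-neg 1ℚ) (-‿cong ι-1)))) ⟩
    eval p x + - 1# * eval q x
      ≈⟨ solve 2 (λ p q → p ⊕ ⊝ κ 1 ⊗ q ⊜ p ⊖ q) (eval p x ∷ eval q x ∷ []) ⟩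
    eval p x - eval q x ∎

  eval-^ : ∀ {n} (p : Poly n) k x → eval (p ^ᴾ k) x ≈ eval p x ^ k
  eval-^ p zero    x = trans (eval-const 1ℚ x) ι-1
  eval-^ p (suc k) x = trans (eval-* p (p ^ᴾ k) x) (*-congˡ (eval-^ p k x))

  monomial-scale : ∀ {n} (m : Vec ℕ n) (x : Fin n → Carrier) k →
    monomial m (λ i → k * x i) ≈ k ^ Vec.sum m * monomial m x
  monomial-scale []      x k = sym (*-identityʳ 1#)
  monomial-scale (a ∷ m) x k = begin
    (k * x 0F) ^ a * monomial m (λ i → k * x (suc i))
      ≈⟨ *-cong (^-distrib-* (k) (x 0F) a) (monomial-scale m (x ∘ suc) k) ⟩
    k ^ a * x 0F ^ a * (k ^ Vec.sum m * monomial m (x ∘ suc))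
      ≈⟨ solve 4 (λ a b c d → a ⊗ b ⊗ (c ⊗ d) ⊜ a ⊗ c ⊗ (b ⊗ d))
           (k ^ a ∷ x 0F ^ a ∷ k ^ Vec.sum m ∷ monomial m (x ∘ suc) ∷ []) ⟩
    k ^ a * k ^ Vec.sum m * (x 0F ^ a * monomial m (x ∘ suc))
      ≈⟨ *-congʳ (^-homo-* k a (Vec.sum m)) ⟨
    _ ∎
    where open import Algebra.Properties.CommutativeSemiring.Exp commutativeSemiring using (^-distrib-*)

  eval-scale : ∀ {n d} (p : Poly n) → Homogeneous d p → ∀ x k →
    eval p (λ i → k * x i) ≈ k ^ d * eval p x
  eval-scale         []            []               x k = sym (zeroʳ _)
  eval-scale {d = d} ((a , m) ∷ p) (≡.refl ∷ hom) x k = begin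
    ι a * monomial m (λ i → k * x i) + eval p (λ i → k * x i)
      ≈⟨ +-cong (*-congˡ (monomial-scale m x k)) (eval-scale p hom x k) ⟩
    ι a * (k ^ d * monomial m x) + k ^ d * eval p x
      ≈⟨ solve 4 (λ a k m p → a ⊗ (k ⊗ m) ⊕ k ⊗ p ⊜ k ⊗ (a ⊗ m ⊕ p))
           (ι a ∷ k ^ d ∷ monomial m x ∷ eval p x ∷ []) ⟩
    k ^ d * (ι a * monomial m x + eval p x) ∎

  eval-removal : ∀ {n} (m : Vec ℕ n) p x →
    eval p x ≈ ι (coeff p m) * monomial m x + eval (remove m p) x
  eval-removal m []            x = sym (trans (+-identityʳ _) (trans (*-congʳ ι-0) (zeroˡ _)))
  eval-removal m ((a , k) ∷ p) x with ≡-dec ℕ._≟_ k m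
  ... | yes ≡.refl = begin
    ι a * monomial m x + eval p x
      ≈⟨ +-congˡ (eval-removal m p x) ⟩
    ι a * monomial m x + (ι (coeff p m) * monomial m x + eval (remove m p) x)
      ≈⟨ solve 4 (λ a c m p → a ⊗ m ⊕ (c ⊗ m ⊕ p) ⊜ (a ⊕ c) ⊗ m ⊕ p)
           (ι a ∷ ι (coeff p m) ∷ monomial m x ∷ eval (remove m p) x ∷ []) ⟩
    (ι a + ι (coeff p m)) * monomial m x + eval (remove m p) x
      ≈⟨ +-congʳ (*-congʳ (ι-+ a (coeff p m))) ⟨
    _ ∎
  ... | no _ = begin
    ι a * monomial k x + eval p x
      ≈⟨ +-congˡ (eval-removal m p x) ⟩
    ι a * monomial k x + (ι (coeff p m) * monomial m x + eval (remove m p) x)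
      ≈⟨ solve 3 (λ a b c → a ⊕ (b ⊕ c) ⊜ b ⊕ (a ⊕ c))
           (ι a * monomial k x ∷ ι (coeff p m) * monomial m x ∷ eval (remove m p) x ∷ []) ⟩
    _ ∎

  -- The terms sharing the exponent vector of the first term cancel, and `remove` deletes them all.
  -- What is left is not a sublist known to the termination checker, hence the induction on a bound
  -- for the length.
  eval-≋[] : ∀ {n} (p : Poly n) → p ≋ [] → ∀ x → eval p x ≈ 0#
  eval-≋[] p = go (List.length p) p ℕ.≤-refl
    where
    go : ∀ k p → List.length p ℕ.≤ k → p ≋ [] → ∀ x → eval p x ≈ 0#
    go k       []                _           p≋0 x = refl
    go (suc k) q@((a , m) ∷ p) (ℕ.s≤s len) p≋0 x = begin
      eval q x ≈⟨ eval-removal m q x ⟩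
      ι (coeff q m) * monomial m x + eval (remove m q) x
        ≈⟨ +-cong (trans (*-congʳ (trans (ι-cong (p≋0 m)) ι-0)) (zeroˡ _))
             (go k (remove m q) (ℕ.≤-trans (length-remove-head a m p) len) (remove-≋[] m q p≋0) x) ⟩
      0# + 0# ≈⟨ +-identityˡ 0# ⟩
      0# ∎

  eval-≋ : ∀ {n} (p q : Poly n) → p ≋ q → ∀ x → eval p x ≈ eval q x
  eval-≋ p q p≋q x = x-y≈0⇒x≈y _ _ (begin
    eval p x - eval q x ≈⟨ +-congˡ (eval-negate q) ⟨
    eval p x + eval (negate q) x ≈⟨ eval-+ p (negate q) x ⟨
    eval (p ++ negate q) x ≈⟨ eval-≋[] (p ++ negate q) (λ e → ≡.trans (coeff-difference p q e)
                                           (≡.trans (≡.cong (ℚ._- coeff q e) (p≋q e)) (ℚ.+-inverseʳ (coeff q e)))) x ⟩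
    0# ∎)
    where
    eval-negate : ∀ q → eval (negate q) x ≈ - eval q x
    eval-negate []            = solve 0 (κ 0 ⊜ ⊝ κ 0) []
    eval-negate ((a , m) ∷ q) = begin
      ι (ℚ.- a) * monomial m x + eval (negate q) x
        ≈⟨ +-cong (*-congʳ (ι-neg a)) (eval-negate q) ⟩
      - ι a * monomial m x + - eval q x
        ≈⟨ solve 3 (λ a m q → ⊝ a ⊗ m ⊕ ⊝ q ⊜ ⊝ (a ⊗ m ⊕ q)) (ι a ∷ monomial m x ∷ eval q x ∷ []) ⟩
      - (ι a * monomial m x + eval q x) ∎

  eval-substitute : ∀ {n k} (p : Poly n) (g : Fin n → Poly k) x →
    eval (substitute p g) x ≈ eval p (λ i → eval (g i) x)
  eval-substitute []            g x = refl
  eval-substitute ((a , m) ∷ p) g x = begin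
    eval (constᴾ a *ᴾ power m g +ᴾ substitute p g) x
      ≈⟨ eval-+ (constᴾ a *ᴾ power m g) _ x ⟩
    eval (constᴾ a *ᴾ power m g) x + eval (substitute p g) x
      ≈⟨ +-cong (trans (eval-* (constᴾ a) (power m g) x) (*-cong (eval-const a x) (eval-power m g))) (eval-substitute p g x) ⟩
    _ ∎
    where
    eval-power : ∀ {n} (m : Vec ℕ n) g → eval (power m g) x ≈ monomial m (λ i → eval (g i) x)
    eval-power []      g = trans (eval-const 1ℚ x) ι-1
    eval-power (a ∷ m) g = trans (eval-* (g 0F ^ᴾ a) (power m (g ∘ suc)) x)
      (*-cong (eval-^ (g 0F) a x) (eval-power m (g ∘ suc)))

-- Subfields and descent

module Subfields {c ℓ} (K : FieldOverℚ c ℓ) where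
  open FieldOverℚ K
  open Identities K
  open FieldLemmas K
  open import Relation.Binary.Reasoning.Setoid setoid

  evalᵁ derivᵁ : List Carrier → Carrier → Carrier
  evalᵁ []      x = 0#
  evalᵁ (a ∷ p) x = a + x * evalᵁ p x
  derivᵁ []      x = 0#
  derivᵁ (a ∷ p) x = evalᵁ p x + x * derivᵁ p x

  evalⱽ derivⱽ : ∀ {n} → Vec Carrier n → Carrier → Carrier
  evalⱽ  p = evalᵁ (Vec.toList p)
  derivⱽ p = derivᵁ (Vec.toList p)

  -- The leading coefficient 1 is implicit.
  monic monic′ : ∀ {n} → Vec Carrier n → Carrier → Carrier
  monic []      x = 1#
  monic (a ∷ g) x = a + x * monic g x
  monic′ []      x = 0#
  monic′ (a ∷ g) x = monic g x + x * monic′ g x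

  infixl 6 _+ᵁ_
  infixl 7 _*ᵁ_

  _+ᵁ_ _*ᵁ_ : List Carrier → List Carrier → List Carrier
  []      +ᵁ q       = q
  (a ∷ p) +ᵁ []      = a ∷ p
  (a ∷ p) +ᵁ (b ∷ q) = a + b ∷ p +ᵁ q

  []      *ᵁ q = []
  (a ∷ p) *ᵁ q = map (a *_) q +ᵁ (0# ∷ p *ᵁ q)

  evalᵁ-cong : ∀ p {x y} → x ≈ y → evalᵁ p x ≈ evalᵁ p y
  evalᵁ-cong []      x≈y = refl
  evalᵁ-cong (a ∷ p) x≈y = +-congˡ (*-cong x≈y (evalᵁ-cong p x≈y))

  evalᵁ-+ : ∀ p q x → evalᵁ (p +ᵁ q) x ≈ evalᵁ p x + evalᵁ q x
  evalᵁ-+ []      q       x = sym (+-identityˡ _)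
  evalᵁ-+ (a ∷ p) []      x = sym (+-identityʳ _)
  evalᵁ-+ (a ∷ p) (b ∷ q) x = trans (+-congˡ (*-congˡ (evalᵁ-+ p q x)))
    (solve 5 (λ a b x p q → a ⊕ b ⊕ x ⊗ (p ⊕ q) ⊜ a ⊕ x ⊗ p ⊕ (b ⊕ x ⊗ q))
      (a ∷ b ∷ x ∷ evalᵁ p x ∷ evalᵁ q x ∷ []))

  evalᵁ-scale : ∀ a q x → evalᵁ (map (a *_) q) x ≈ a * evalᵁ q x
  evalᵁ-scale a []      x = sym (zeroʳ a)
  evalᵁ-scale a (b ∷ q) x = trans (+-congˡ (*-congˡ (evalᵁ-scale a q x)))
    (solve 4 (λ a b x q → a ⊗ b ⊕ x ⊗ (a ⊗ q) ⊜ a ⊗ (b ⊕ x ⊗ q)) (a ∷ b ∷ x ∷ evalᵁ q x ∷ []))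

  evalᵁ-* : ∀ p q x → evalᵁ (p *ᵁ q) x ≈ evalᵁ p x * evalᵁ q x
  evalᵁ-* []      q x = sym (zeroˡ _)
  evalᵁ-* (a ∷ p) q x = begin
    evalᵁ (map (a *_) q +ᵁ (0# ∷ p *ᵁ q)) x ≈⟨ evalᵁ-+ (map (a *_) q) _ x ⟩
    evalᵁ (map (a *_) q) x + (0# + x * evalᵁ (p *ᵁ q) x)
      ≈⟨ +-cong (evalᵁ-scale a q x) (+-congˡ (*-congˡ (evalᵁ-* p q x))) ⟩
    a * evalᵁ q x + (0# + x * (evalᵁ p x * evalᵁ q x))
      ≈⟨ solve 4 (λ a x p q → a ⊗ q ⊕ (κ 0 ⊕ x ⊗ (p ⊗ q)) ⊜ (a ⊕ x ⊗ p) ⊗ q)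
           (a ∷ x ∷ evalᵁ p x ∷ evalᵁ q x ∷ []) ⟩
    (a + x * evalᵁ p x) * evalᵁ q x ∎

  -- One Horner step of division by a monic `g` of degree n. The dividend `a + x r` has degree at
  -- most n, so the quotient is a constant `t`, the coefficient of degree n.
  stepMonic : ∀ {n} → Vec Carrier n → Carrier → Vec Carrier n → Carrier × Vec Carrier n
  stepMonic []      a []      = a , []
  stepMonic (b ∷ g) a (d ∷ r) with stepMonic g d r
  ... | t , r′ = t , a - t * b ∷ r′

  stepMonic-eval : ∀ {n} (g : Vec Carrier n) a r x →
    let t , r′ = stepMonic g a r in
    a + x * evalⱽ r x ≈ t * monic g x + evalⱽ r′ x ×
    evalⱽ r x + x * derivⱽ r x ≈ t * monic′ g x + derivⱽ r′ x
  stepMonic-eval []      a []      x =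
    solve 2 (λ a x → a ⊕ x ⊗ κ 0 ⊜ a ⊗ κ 1 ⊕ κ 0) (a ∷ x ∷ []) ,
    solve 2 (λ a x → κ 0 ⊕ x ⊗ κ 0 ⊜ a ⊗ κ 0 ⊕ κ 0) (a ∷ x ∷ [])
  stepMonic-eval (b ∷ g) a (d ∷ r) x with stepMonic g d r | stepMonic-eval g d r x
  ... | t , r′ | eq , eq′ =
    (begin
      a + x * (d + x * evalⱽ r x) ≈⟨ +-congˡ (*-congˡ eq) ⟩
      a + x * (t * monic g x + evalⱽ r′ x)
        ≈⟨ solve 6 (λ a x t m r b → a ⊕ x ⊗ (t ⊗ m ⊕ r) ⊜ t ⊗ (b ⊕ x ⊗ m) ⊕ (a ⊖ t ⊗ b ⊕ x ⊗ r))
             (a ∷ x ∷ t ∷ monic g x ∷ evalⱽ r′ x ∷ b ∷ []) ⟩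
      _ ∎) ,
    (begin
      d + x * evalⱽ r x + x * (evalⱽ r x + x * derivⱽ r x) ≈⟨ +-cong eq (*-congˡ eq′) ⟩
      t * monic g x + evalⱽ r′ x + x * (t * monic′ g x + derivⱽ r′ x)
        ≈⟨ solve 6 (λ x t m m′ r r′ → t ⊗ m ⊕ r ⊕ x ⊗ (t ⊗ m′ ⊕ r′) ⊜ t ⊗ (m ⊕ x ⊗ m′) ⊕ (r ⊕ x ⊗ r′))
             (x ∷ t ∷ monic g x ∷ monic′ g x ∷ evalⱽ r′ x ∷ derivⱽ r′ x ∷ []) ⟩
      _ ∎)

  divMonic : ∀ {n} → Vec Carrier n → List Carrier → List Carrier × Vec Carrier n
  divMonic g []      = [] , Vec.replicate _ 0#
  divMonic g (a ∷ p) with divMonic g p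
  ... | q , r with stepMonic g a r
  ...   | t , r′ = t ∷ q , r′

  evalⱽ-0 : ∀ n x → evalⱽ (Vec.replicate n 0#) x ≈ 0# × derivⱽ (Vec.replicate n 0#) x ≈ 0#
  evalⱽ-0 zero    x = refl , refl
  evalⱽ-0 (suc n) x with evalⱽ-0 n x
  ... | eq , eq′ = trans (+-identityˡ _) (trans (*-congˡ eq) (zeroʳ x)) ,
    trans (+-cong eq (trans (*-congˡ eq′) (zeroʳ x))) (+-identityˡ 0#)

  -- The second identity is the formal derivative of the first. It is what later relates the
  -- derivative of an equation at `α` to the value of the quotient there.
  divMonic-eval : ∀ {n} (g : Vec Carrier n) p x →
    let q , r = divMonic g p in
    evalᵁ p x ≈ evalᵁ q x * monic g x + evalⱽ r x ×
    derivᵁ p x ≈ derivᵁ q x * monic g x + evalᵁ q x * monic′ g x + derivⱽ r x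
  divMonic-eval {n} g [] x =
    sym (trans (+-cong (zeroˡ _) (proj₁ (evalⱽ-0 n x))) (+-identityˡ 0#)) ,
    sym (trans (+-cong (trans (+-cong (zeroˡ _) (zeroˡ _)) (+-identityˡ 0#)) (proj₂ (evalⱽ-0 n x))) (+-identityˡ 0#))
  divMonic-eval g (a ∷ p) x with divMonic g p | divMonic-eval g p x
  ... | q , r | eq , eq′ with stepMonic g a r | stepMonic-eval g a r x
  ...   | t , r′ | st , st′ =
    (begin
      a + x * evalᵁ p x ≈⟨ +-congˡ (*-congˡ eq) ⟩
      a + x * (evalᵁ q x * monic g x + evalⱽ r x)
        ≈⟨ solve 5 (λ a x q m r → a ⊕ x ⊗ (q ⊗ m ⊕ r) ⊜ x ⊗ q ⊗ m ⊕ (a ⊕ x ⊗ r))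
             (a ∷ x ∷ evalᵁ q x ∷ monic g x ∷ evalⱽ r x ∷ []) ⟩
      x * evalᵁ q x * monic g x + (a + x * evalⱽ r x) ≈⟨ +-congˡ st ⟩
      x * evalᵁ q x * monic g x + (t * monic g x + evalⱽ r′ x)
        ≈⟨ solve 5 (λ x q m t r → x ⊗ q ⊗ m ⊕ (t ⊗ m ⊕ r) ⊜ (t ⊕ x ⊗ q) ⊗ m ⊕ r)
             (x ∷ evalᵁ q x ∷ monic g x ∷ t ∷ evalⱽ r′ x ∷ []) ⟩
      _ ∎) ,
    (begin
      evalᵁ p x + x * derivᵁ p x ≈⟨ +-cong eq (*-congˡ eq′) ⟩
      evalᵁ q x * monic g x + evalⱽ r x +
        x * (derivᵁ q x * monic g x + evalᵁ q x * monic′ g x + derivⱽ r x)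
        ≈⟨ solve 7 (λ x q q′ m m′ r r′ →
             q ⊗ m ⊕ r ⊕ x ⊗ (q′ ⊗ m ⊕ q ⊗ m′ ⊕ r′) ⊜
             (q ⊕ x ⊗ q′) ⊗ m ⊕ x ⊗ q ⊗ m′ ⊕ (r ⊕ x ⊗ r′))
             (x ∷ evalᵁ q x ∷ derivᵁ q x ∷ monic g x ∷ monic′ g x ∷ evalⱽ r x ∷ derivⱽ r x ∷ []) ⟩
      (evalᵁ q x + x * derivᵁ q x) * monic g x + x * evalᵁ q x * monic′ g x + (evalⱽ r x + x * derivⱽ r x)
        ≈⟨ +-congˡ st′ ⟩
      _ ≈⟨ solve 7 (λ x t m m′ r′ q q′ →
             (q ⊕ x ⊗ q′) ⊗ m ⊕ x ⊗ q ⊗ m′ ⊕ (t ⊗ m′ ⊕ r′) ⊜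
             (q ⊕ x ⊗ q′) ⊗ m ⊕ (t ⊕ x ⊗ q) ⊗ m′ ⊕ r′)
             (x ∷ t ∷ monic g x ∷ monic′ g x ∷ derivⱽ r′ x ∷ evalᵁ q x ∷ derivᵁ q x ∷ []) ⟩
      _ ∎)

  record IsSubring {s} (S : Carrier → Set s) : Set (c ⊔ ℓ ⊔ s) where
    field
      resp     : ∀ {x y} → x ≈ y → S x → S y
      0-closed : S 0#
      1-closed : S 1#
      +-closed : ∀ {x y} → S x → S y → S (x + y)
      *-closed : ∀ {x y} → S x → S y → S (x * y)
      neg-closed : ∀ {x} → S x → S (- x)

    minus-closed : ∀ {x y} → S x → S y → S (x - y)
    minus-closed sx sy = +-closed sx (neg-closed sy)

    evalᵁ-closed : ∀ {p x} → All S p → S x → S (evalᵁ p x)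
    evalᵁ-closed []       sx = 0-closed
    evalᵁ-closed (sa ∷ sp) sx = +-closed sa (*-closed sx (evalᵁ-closed sp sx))

    derivᵁ-closed : ∀ {p x} → All S p → S x → S (derivᵁ p x)
    derivᵁ-closed []       sx = 0-closed
    derivᵁ-closed (sa ∷ sp) sx = +-closed (evalᵁ-closed sp sx) (*-closed sx (derivᵁ-closed sp sx))

    ^-closed : ∀ {x} n → S x → S (x ^ n)
    ^-closed zero    sx = 1-closed
    ^-closed (suc n) sx = *-closed sx (^-closed n sx)

    expr-closed : (∀ q → S (ι q)) → ∀ {n} (a : Expr n) {ρ} → (∀ i → S (lookup ρ i)) → S (⟦ a ⟧ₑ ρ)
    expr-closed ∋ι (con z)  sρ = resp (sym (⟦⟧ᶻ≈ι z)) (∋ι (z ℚ./ 1))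
    expr-closed ∋ι (slot i) sρ = sρ i
    expr-closed ∋ι (a ⊕ b)  sρ = +-closed (expr-closed ∋ι a sρ) (expr-closed ∋ι b sρ)
    expr-closed ∋ι (a ⊗ b)  sρ = *-closed (expr-closed ∋ι a sρ) (expr-closed ∋ι b sρ)
    expr-closed ∋ι (a ⊖ b)  sρ = minus-closed (expr-closed ∋ι a sρ) (expr-closed ∋ι b sρ)
    expr-closed ∋ι (⊝ a)    sρ = neg-closed (expr-closed ∋ι a sρ)
    expr-closed ∋ι (a ⊛ k)  sρ = ^-closed k (expr-closed ∋ι a sρ)

    stepMonic-closed : ∀ {n} (g : Vec Carrier n) a r → Allⱽ S g → S a → Allⱽ S r →
      S (proj₁ (stepMonic g a r)) × Allⱽ S (proj₂ (stepMonic g a r))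
    stepMonic-closed []      a []      []        sa []        = sa , []
    stepMonic-closed (b ∷ g) a (d ∷ r) (sb ∷ sg) sa (sd ∷ sr) with stepMonic-closed g d r sg sd sr
    ... | st , sr′ = st , minus-closed sa (*-closed st sb) ∷ sr′

    divMonic-closed : ∀ {n} (g : Vec Carrier n) p → Allⱽ S g → All S p →
      All S (proj₁ (divMonic g p)) × Allⱽ S (proj₂ (divMonic g p))
    divMonic-closed g []      sg []        = [] , zeros _
      where
      zeros : ∀ n → Allⱽ S (Vec.replicate n 0#)
      zeros zero    = []
      zeros (suc n) = 0-closed ∷ zeros n
    divMonic-closed g (a ∷ p) sg (sa ∷ sp) with divMonic-closed g p sg sp
    ... | sq , sr with stepMonic-closed g a (proj₂ (divMonic g p)) sg sa sr
    ...   | st , sr′ = st ∷ sq , sr′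

  -- `I` plays the part of an ideal over `S`. This covers both a subfield, with `S` and `I` equal,
  -- and the maximal ideal of a valuation ring.
  module _ {s i} {S : Carrier → Set s} {I : Carrier → Set i}
    (I-0 : I 0#) (I-+ : ∀ {x y} → I x → I y → I (x + y)) where

    +ᵁ-closed : ∀ {p q} → All I p → All I q → All I (p +ᵁ q)
    +ᵁ-closed []        iq        = iq
    +ᵁ-closed (ia ∷ ip) []        = ia ∷ ip
    +ᵁ-closed (ia ∷ ip) (ib ∷ iq) = I-+ ia ib ∷ +ᵁ-closed ip iq

    *ᵁ-closed : (∀ {x y} → S x → I y → I (x * y)) → ∀ {p q} → All S p → All I q → All I (p *ᵁ q)
    *ᵁ-closed I-* []        iq = []
    *ᵁ-closed I-* (sa ∷ sp) iq =
      +ᵁ-closed (All.map⁺ (All.map (I-* sa) iq)) (I-0 ∷ *ᵁ-closed I-* sp iq)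

  record IsSubfield {s} (k : Carrier → Set s) : Set (c ⊔ ℓ ⊔ s) where
    field
      isSubring  : IsSubring k
      ⁻¹-closed : ∀ {x} → x ≉ 0# → k x → k (x ⁻¹)
    open IsSubring isSubring public

    +ᵁ-closedᵏ : ∀ {p q} → All k p → All k q → All k (p +ᵁ q)
    +ᵁ-closedᵏ = +ᵁ-closed {S = k} 0-closed +-closed

    *ᵁ-closedᵏ : ∀ {p q} → All k p → All k q → All k (p *ᵁ q)
    *ᵁ-closedᵏ = *ᵁ-closed 0-closed +-closed *-closed

  -- The field k(α). With fractions rather than polynomials in `α`, inversion just exchanges `p` and
  -- `q`.
  Adjoin : ∀ {s} → (Carrier → Set s) → Carrier → Carrier → Set (c ⊔ ℓ ⊔ s)
  Adjoin k α x = ∃[ p ] ∃[ q ] All k p × All k q × evalᵁ q α ≉ 0# × x * evalᵁ q α ≈ evalᵁ p α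

  module _ {s} {k : Carrier → Set s} (isSubfield : IsSubfield k) (α : Carrier) where
    open IsSubfield isSubfield

    private
      one : evalᵁ (1# ∷ []) α ≈ 1#
      one = trans (+-congˡ (zeroʳ α)) (+-identityʳ 1#)

    adjoin-polynomial : ∀ {p} → All k p → Adjoin k α (evalᵁ p α)
    adjoin-polynomial {p} kp =
      p , 1# ∷ [] , kp , 1-closed ∷ [] , nonzero-cong (sym one) 1≉0 , trans (*-congˡ one) (*-identityʳ _)

    adjoin-⊇ : ∀ {x} → k x → Adjoin k α x
    adjoin-⊇ {x} kx with adjoin-polynomial (kx ∷ [])
    ... | p , q , kp , kq , q≉0 , eq =
      p , q , kp , kq , q≉0 , trans (*-congʳ (sym (trans (+-congˡ (zeroʳ α)) (+-identityʳ x)))) eq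

    adjoin-∋ : Adjoin k α α
    adjoin-∋ = 0# ∷ 1# ∷ [] , 1# ∷ [] , 0-closed ∷ 1-closed ∷ [] , 1-closed ∷ [] , nonzero-cong (sym one) 1≉0 ,
      solve 1 (λ x → x ⊗ (κ 1 ⊕ x ⊗ κ 0) ⊜ κ 0 ⊕ x ⊗ (κ 1 ⊕ x ⊗ κ 0)) (α ∷ [])

    adjoin-isSubfield : IsSubfield (Adjoin k α)
    adjoin-isSubfield = record
      { isSubring = record
        { resp = λ x≈y (p , q , kp , kq , q≉0 , eq) → p , q , kp , kq , q≉0 , trans (*-congʳ (sym x≈y)) eq
        ; 0-closed = adjoin-⊇ 0-closed
        ; 1-closed = adjoin-⊇ 1-closed
        ; +-closed = λ {x} {y} (p , q , kp , kq , q≉0 , eq) (p′ , q′ , kp′ , kq′ , q′≉0 , eq′) →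
            p *ᵁ q′ +ᵁ p′ *ᵁ q , q *ᵁ q′ ,
            +ᵁ-closedᵏ (*ᵁ-closedᵏ kp kq′) (*ᵁ-closedᵏ kp′ kq) , *ᵁ-closedᵏ kq kq′ ,
            nonzero-cong (sym (evalᵁ-* q q′ α)) (*-nonzero q≉0 q′≉0) , trans (*-congˡ (evalᵁ-* q q′ α))
              (trans (fraction-+ eq eq′) (sym (trans (evalᵁ-+ (p *ᵁ q′) (p′ *ᵁ q) α) (+-cong (evalᵁ-* p q′ α) (evalᵁ-* p′ q α)))))
        ; *-closed = λ {x} {y} (p , q , kp , kq , q≉0 , eq) (p′ , q′ , kp′ , kq′ , q′≉0 , eq′) →
            p *ᵁ p′ , q *ᵁ q′ , *ᵁ-closedᵏ kp kp′ , *ᵁ-closedᵏ kq kq′ ,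
            nonzero-cong (sym (evalᵁ-* q q′ α)) (*-nonzero q≉0 q′≉0) ,
            trans (*-congˡ (evalᵁ-* q q′ α)) (trans (fraction-* eq eq′) (sym (evalᵁ-* p p′ α)))
        ; neg-closed = λ {x} (p , q , kp , kq , q≉0 , eq) →
            map (- 1# *_) p , q , All.map⁺ (All.map (*-closed (neg-closed 1-closed)) kp) , kq , q≉0 , (begin
              - x * evalᵁ q α
                ≈⟨ solve 2 (λ x q → ⊝ x ⊗ q ⊜ ⊝ κ 1 ⊗ (x ⊗ q)) (x ∷ evalᵁ q α ∷ []) ⟩
              - 1# * (x * evalᵁ q α) ≈⟨ *-congˡ eq ⟩
              - 1# * evalᵁ p α ≈⟨ evalᵁ-scale (- 1#) p α ⟨
              _ ∎)
        }
      ; ⁻¹-closed = λ {x} x≉0 (p , q , kp , kq , q≉0 , eq) →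
          q , p , kq , kp , nonzero-cong eq (*-nonzero x≉0 q≉0) , fraction-⁻¹ x≉0 eq
      }

  divLinear : ∀ {n} → Carrier → Vec Carrier (suc n) → Vec Carrier n × Carrier
  divLinear α (a ∷ [])    = [] , a
  divLinear α (a ∷ b ∷ p) with divLinear α (b ∷ p)
  ... | q , r = r ∷ q , a + α * r

  divLinear-eval : ∀ {n} α (p : Vec Carrier (suc n)) x →
    evalⱽ p x ≈ (x - α) * evalⱽ (proj₁ (divLinear α p)) x + proj₂ (divLinear α p)
  divLinear-eval α (a ∷ [])    x = solve 3 (λ a x α → a ⊕ x ⊗ κ 0 ⊜ (x ⊖ α) ⊗ κ 0 ⊕ a) (a ∷ x ∷ α ∷ [])
  divLinear-eval α (a ∷ b ∷ p) x with divLinear α (b ∷ p) | divLinear-eval α (b ∷ p) x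
  ... | q , r | eq = trans (+-congˡ (*-congˡ eq))
    (solve 5 (λ a x α q r → a ⊕ x ⊗ ((x ⊖ α) ⊗ q ⊕ r) ⊜ (x ⊖ α) ⊗ (r ⊕ x ⊗ q) ⊕ (a ⊕ α ⊗ r))
      (a ∷ x ∷ α ∷ evalⱽ q x ∷ r ∷ []))

  divLinear-zero : ∀ {n} α (p : Vec Carrier (suc n)) →
    Allⱽ (_≈ 0#) (proj₁ (divLinear α p)) → proj₂ (divLinear α p) ≈ 0# → Allⱽ (_≈ 0#) p
  divLinear-zero α (a ∷ [])    []          a≈0 = a≈0 ∷ []
  divLinear-zero α (a ∷ b ∷ p) (r≈0 ∷ q≈0) eq  =
    trans (sym (trans (+-congˡ (trans (*-congˡ r≈0) (zeroʳ α))) (+-identityʳ a))) eq ∷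
    divLinear-zero α (b ∷ p) q≈0 r≈0

  -- A root splits off a linear factor. The other roots differ from it, so they are roots of the
  -- quotient, which has one coefficient less.
  enough-roots : ∀ {n} (p roots : Vec Carrier n) → AllPairs _≉_ roots →
    Allⱽ (λ a → evalⱽ p a ≈ 0#) roots → Allⱽ (_≈ 0#) p
  enough-roots []          []      []             []          = []
  enough-roots p@(_ ∷ _) (α ∷ αs) (α≉ ∷ distinct) (pα≈0 ∷ pαs≈0) =
    divLinear-zero α p (enough-roots q αs distinct (Allⱽ.map other (Allⱽ.zip (α≉ , pαs≈0)))) r≈0
    where
    q = proj₁ (divLinear α p)
    r = proj₂ (divLinear α p)
    r≈0 : r ≈ 0#
    r≈0 = begin
      r ≈⟨ solve 3 (λ α q r → (α ⊖ α) ⊗ q ⊕ r ⊜ r) (α ∷ evalⱽ q α ∷ r ∷ []) ⟨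
      (α - α) * evalⱽ q α + r ≈⟨ divLinear-eval α p α ⟨
      evalⱽ p α ≈⟨ pα≈0 ⟩
      0# ∎
    other : ∀ {a} → α ≉ a × evalⱽ p a ≈ 0# → evalⱽ q a ≈ 0#
    other {a} (α≉a , pa≈0) = *-zero-product (begin
      (a - α) * evalⱽ q a ≈⟨ +-identityʳ _ ⟨
      (a - α) * evalⱽ q a + 0# ≈⟨ +-congˡ r≈0 ⟨
      (a - α) * evalⱽ q a + r ≈⟨ divLinear-eval α p a ⟨
      evalⱽ p a ≈⟨ pa≈0 ⟩
      0# ∎) (λ eq → α≉a (sym (x-y≈0⇒x≈y a α eq)))

  -- This is what an automorphism fixing `k` and `y` and sending `α` to `a` provides: expressions of
  -- `y` as a fraction in `α` stay valid at `a`.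
  Conjugate : ∀ {s} → (Carrier → Set s) → Carrier → Carrier → Carrier → Set (c ⊔ ℓ ⊔ s)
  Conjugate k y α a = ∀ p q → All k p → All k q →
    y * evalᵁ q α ≈ evalᵁ p α → y * evalᵁ q a ≈ evalᵁ p a

  -- Writing y = p(α)/q(α) with p and q reduced modulo the equation of α, the
  -- polynomial p − y q has more roots than its degree allows, hence is zero.
  descent : ∀ {s} {k : Carrier → Set s} → IsSubfield k → ∀ {n} {g : Vec Carrier n} {α} →
    Allⱽ k g → monic g α ≈ 0# → ∀ {y} (roots : Vec Carrier n) → AllPairs _≉_ roots →
    Allⱽ (Conjugate k y α) roots → Adjoin k α y → k y
  descent {k = k} isSubfield {n} {g} {α} kg gα≈0 {y} roots distinct conjugate (p , q , kp , kq , q≉0 , eq) =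
    nonzero-coefficient pᵣ qᵣ kpᵣ kqᵣ coefficients≈0 (nonzero-cong (reduced q) q≉0)
    where
    open IsSubfield isSubfield
    pᵣ = proj₂ (divMonic g p)
    qᵣ = proj₂ (divMonic g q)
    kpᵣ = proj₂ (divMonic-closed g p kg kp)
    kqᵣ = proj₂ (divMonic-closed g q kg kq)

    reduced : ∀ p → evalᵁ p α ≈ evalⱽ (proj₂ (divMonic g p)) α
    reduced p = begin
      evalᵁ p α ≈⟨ proj₁ (divMonic-eval g p α) ⟩
      evalᵁ (proj₁ (divMonic g p)) α * monic g α + evalⱽ (proj₂ (divMonic g p)) α
        ≈⟨ +-congʳ (trans (*-congˡ gα≈0) (zeroʳ _)) ⟩
      0# + evalⱽ (proj₂ (divMonic g p)) α ≈⟨ +-identityˡ _ ⟩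
      evalⱽ (proj₂ (divMonic g p)) α ∎

    difference : ∀ {n} → Vec Carrier n → Vec Carrier n → Vec Carrier n
    difference = Vec.zipWith (λ a b → a - y * b)

    difference-eval : ∀ {n} (p q : Vec Carrier n) x → evalⱽ (difference p q) x ≈ evalⱽ p x - y * evalⱽ q x
    difference-eval []      []      x = solve 1 (λ y → κ 0 ⊜ κ 0 ⊖ y ⊗ κ 0) (y ∷ [])
    difference-eval (a ∷ p) (b ∷ q) x = trans (+-congˡ (*-congˡ (difference-eval p q x)))
      (solve 6 (λ a b x y p q → a ⊖ y ⊗ b ⊕ x ⊗ (p ⊖ y ⊗ q) ⊜ a ⊕ x ⊗ p ⊖ y ⊗ (b ⊕ x ⊗ q))
        (a ∷ b ∷ x ∷ y ∷ evalⱽ p x ∷ evalⱽ q x ∷ []))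

    coefficients≈0 : Allⱽ (_≈ 0#) (difference pᵣ qᵣ)
    coefficients≈0 = enough-roots (difference pᵣ qᵣ) roots distinct (Allⱽ.map root conjugate)
      where
      root : ∀ {a} → Conjugate k y α a → evalⱽ (difference pᵣ qᵣ) a ≈ 0#
      root {a} conj = trans (difference-eval pᵣ qᵣ a) (x≈y⇒x-y≈0 (sym
        (conj (Vec.toList pᵣ) (Vec.toList qᵣ) (Allⱽ.toList⁺ kpᵣ) (Allⱽ.toList⁺ kqᵣ)
          (trans (*-congˡ (sym (reduced q))) (trans eq (reduced p))))))

    -- Corresponding coefficients satisfy `a = y b`. Since `q(α)` is nonzero, some `b` is nonzero,
    -- and `y = a/b` lies in `k`.
    nonzero-coefficient : ∀ {n} (p q : Vec Carrier n) → Allⱽ k p → Allⱽ k q →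
      Allⱽ (_≈ 0#) (difference p q) → evalⱽ q α ≉ 0# → k y
    nonzero-coefficient []      []      _         _         _          q≉0 = ⊥-elim (q≉0 refl)
    nonzero-coefficient (a ∷ p) (b ∷ q) (ka ∷ kp) (kb ∷ kq) (d≈0 ∷ ds) q≉0 with b ≟ 0#
    ... | yes b≈0 = nonzero-coefficient p q kp kq ds
      (nonzero-*ʳ (nonzero-cong (trans (+-congʳ b≈0) (+-identityˡ _)) q≉0))
    ... | no  b≉0 = resp (begin
      a * b ⁻¹ ≈⟨ *-congʳ (x-y≈0⇒x≈y a (y * b) d≈0) ⟩
      y * b * b ⁻¹ ≈⟨ *-assoc y b _ ⟩
      y * (b * b ⁻¹) ≈⟨ *-congˡ (⁻¹-inverseʳ b≉0) ⟩
      y * 1# ≈⟨ *-identityʳ y ⟩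
      y ∎) (*-closed ka (⁻¹-closed b≉0 kb))

-- Valuations and unramified extensions

-- The double negation stands in for deciding `Q`. Without a least witness, strong induction refutes
-- `Q` everywhere.
¬¬-least : ∀ {q} (Q : ℕ → Set q) → ∃ Q → ¬ ¬ (∃[ m ] Q m × (∀ {j} → j ℕ.< m → ¬ Q j))
¬¬-least Q (m , Qm) none = <-rec (λ m → ¬ Q m) (λ m below Qm → none (m , Qm , below)) m Qm

module Valuations {F : Poly 3} {c ℓ} (C : FunctionField F c ℓ) (x : Curve.ClosedPoint C) where
  open FunctionField C
  open Curve.ClosedPoint x
  open Identities fieldOverℚ
  open FieldLemmas fieldOverℚ
  open Subfields fieldOverℚ
  open import Relation.Binary.Reasoning.Setoid setoid

  -- The premise encodes v(0) = ∞, since the integer `v 0#` is arbitrary.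
  AtLeast : ℤ → Carrier → Set ℓ
  AtLeast t a = a ≉ 0# → t ℤ.≤ v a

  Int Pos Unit : Carrier → Set ℓ
  Int  = AtLeast 0ℤ
  Pos  = AtLeast 1ℤ
  Unit a = a ≉ 0# × v a ≡ 0ℤ

  atLeast-cong : ∀ {t a b} → a ≈ b → AtLeast t a → AtLeast t b
  atLeast-cong {t} a≈b ta b≉0 = ≡.subst (t ℤ.≤_) (v-cong a≈b) (ta (nonzero-cong (sym a≈b) b≉0))

  atLeast-0 : ∀ {t} → AtLeast t 0#
  atLeast-0 0≉0 = ⊥-elim (0≉0 refl)

  atLeast-+ : ∀ {t a b} → AtLeast t a → AtLeast t b → AtLeast t (a + b)
  atLeast-+ {t} {a} {b} ta tb with a ≟ 0# | b ≟ 0#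
  ... | yes a≈0 | _       = atLeast-cong (trans (sym (+-identityˡ b)) (+-congʳ (sym a≈0))) tb
  ... | no _    | yes b≈0 = atLeast-cong (trans (sym (+-identityʳ a)) (+-congˡ (sym b≈0))) ta
  ... | no a≉0  | no b≉0  = λ a+b≉0 → ℤ.≤-trans (ℤ.⊓-glb (ta a≉0) (tb b≉0)) (v-+ a≉0 b≉0 a+b≉0)

  atLeast-* : ∀ {s t a b} → AtLeast s a → AtLeast t b → AtLeast (s ℤ.+ t) (a * b)
  atLeast-* {s} {t} sa tb ab≉0 = ≡.subst (s ℤ.+ t ℤ.≤_) (≡.sym (v-* a≉0 b≉0)) (ℤ.+-mono-≤ (sa a≉0) (tb b≉0))
    where
    a≉0 = nonzero-*ˡ ab≉0
    b≉0 = nonzero-*ʳ ab≉0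

  atLeast-ι : ∀ q → Int (ι q)
  atLeast-ι q ιq≉0 = ℤ.≤-reflexive (≡.sym (v-ι λ q≡0 → ιq≉0 (trans (ι-cong q≡0) ι-0)))

  ι-unit : ∀ {q} → q ≢ 0ℚ → Unit (ι q)
  ι-unit q≢0 = ι-nonzero q≢0 , v-ι q≢0

  unit-cong : ∀ {a b} → a ≈ b → Unit a → Unit b
  unit-cong a≈b (a≉0 , va) = nonzero-cong a≈b a≉0 , ≡.trans (v-cong (sym a≈b)) va

  unit-1 : Unit 1#
  unit-1 = unit-cong ι-1 (ι-unit λ ())

  int-neg : ∀ {t a} → AtLeast t a → AtLeast t (- a)
  int-neg {t} {a} ta = atLeast-cong
    (trans (*-congʳ (trans (ι-neg 1ℚ) (-‿cong ι-1))) (solve 1 (λ a → ⊝ κ 1 ⊗ a ⊜ ⊝ a) (a ∷ [])))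
    (≡.subst (λ t → AtLeast t (ι (ℚ.- 1ℚ) * a)) (ℤ.+-identityˡ t) (atLeast-* (atLeast-ι (ℚ.- 1ℚ)) ta))

  int-isSubring : IsSubring Int
  int-isSubring = record
    { resp = atLeast-cong ; 0-closed = atLeast-0 ; 1-closed = atLeast-cong ι-1 (atLeast-ι 1ℚ)
    ; +-closed = atLeast-+ ; *-closed = atLeast-* ; neg-closed = int-neg }

  pos⇒int : ∀ {a} → Pos a → Int a
  pos⇒int pa a≉0 = ℤ.≤-trans (ℤ.+≤+ ℕ.z≤n) (pa a≉0)

  unit⇒int : ∀ {a} → Unit a → Int a
  unit⇒int (_ , va) _ = ℤ.≤-reflexive (≡.sym va)

  unit⇒¬pos : ∀ {a} → Unit a → ¬ Pos a
  unit⇒¬pos (a≉0 , va) pa with ≡.subst (1ℤ ℤ.≤_) va (pa a≉0)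
  ... | ℤ.+≤+ ()

  pos⊎unit : ∀ {a} → Int a → Pos a ⊎ Unit a
  pos⊎unit {a} ia with a ≟ 0#
  ... | yes a≈0 = inj₁ λ a≉0 → ⊥-elim (a≉0 a≈0)
  ... | no  a≉0 with 1ℤ ℤ.≤? v a
  ...   | yes 1≤v = inj₁ λ _ → 1≤v
  ...   | no  1≰v = inj₂ (a≉0 , ℤ.≤-antisym (ℤ.i<j⇒i≤pred[j] (ℤ.≰⇒> 1≰v)) (ia a≉0))

  ¬pos⇒unit : ∀ {a} → Int a → ¬ Pos a → Unit a
  ¬pos⇒unit ia ¬pa with pos⊎unit ia
  ... | inj₁ pa = ⊥-elim (¬pa pa)
  ... | inj₂ ua = ua

  unit-* : ∀ {a b} → Unit a → Unit b → Unit (a * b)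
  unit-* (a≉0 , va) (b≉0 , vb) = *-nonzero a≉0 b≉0 , ≡.trans (v-* a≉0 b≉0) (≡.cong₂ ℤ._+_ va vb)

  unit-factorˡ : ∀ {a b} → Int a → Int b → Unit (a * b) → Unit a
  unit-factorˡ ia ib uab = ¬pos⇒unit ia λ pa → unit⇒¬pos uab (atLeast-* pa ib)

  unit-factorʳ : ∀ {a b} → Int a → Int b → Unit (a * b) → Unit b
  unit-factorʳ ia ib uab = ¬pos⇒unit ib λ pb → unit⇒¬pos uab (atLeast-* ia pb)

  v-⁻¹ : ∀ {a} → a ≉ 0# → v (a ⁻¹) ≡ ℤ.- v a
  v-⁻¹ {a} a≉0 = ℤ+-inverseʳ-unique (v a) (v (a ⁻¹)) (≡.trans (≡.sym (v-* a≉0 (⁻¹-nonzero a≉0)))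
    (≡.trans (v-cong (⁻¹-inverseʳ a≉0)) (proj₂ unit-1)))

  unit-⁻¹ : ∀ {a} → Unit a → Unit (a ⁻¹)
  unit-⁻¹ (a≉0 , va) = ⁻¹-nonzero a≉0 , ≡.trans (v-⁻¹ a≉0) (≡.cong ℤ.-_ va)

  unit-cancelˡ : ∀ {t a b} → Unit a → AtLeast t (a * b) → AtLeast t b
  unit-cancelˡ {t} {a} {b} (a≉0 , va) tab b≉0 = ≡.subst (t ℤ.≤_)
    (≡.trans (v-* a≉0 b≉0) (≡.trans (≡.cong (ℤ._+ v b) va) (ℤ.+-identityˡ _))) (tab (*-nonzero a≉0 b≉0))

  -- A pole of a would make its inverse z vanish, but aⁿ zⁿ = 1 and the lower
  -- terms of the equation become divisible by z after multiplication by zⁿ.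
  integrally-closed : ∀ {n} {g : Vec Carrier n} {a} → Allⱽ Int g → monic g a ≈ 0# → Int a
  integrally-closed {n} {g} {a} ig ga≈0 a≉0 with 0ℤ ℤ.≤? v a
  ... | yes 0≤v = 0≤v
  ... | no  0≰v = ⊥-elim (unit⇒¬pos unit-1 (atLeast-cong (begin
    - (monic g a * z ^ n - 1#) ≈⟨ -‿cong (+-congʳ (trans (*-congʳ ga≈0) (zeroˡ _))) ⟩
    - (0# - 1#) ≈⟨ solve 0 (⊝ (κ 0 ⊖ κ 1) ⊜ κ 1) [] ⟩
    1# ∎) (int-neg (lower g ig))))
    where
    z = a ⁻¹
    pos-z : Pos z
    pos-z _ = ≡.subst (1ℤ ℤ.≤_) (≡.sym (v-⁻¹ a≉0)) (ℤ.i<j⇒suc[i]≤j (ℤ.neg-mono-< (ℤ.≰⇒> 0≰v)))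
    z^-int : ∀ n → Int (z ^ n)
    z^-int zero    = unit⇒int unit-1
    z^-int (suc n) = atLeast-* (pos⇒int pos-z) (z^-int n)
    lower : ∀ {n} (g : Vec Carrier n) → Allⱽ Int g → Pos (monic g a * z ^ n - 1#)
    lower []      []        = atLeast-cong (solve 0 (κ 0 ⊜ κ 1 ⊗ κ 1 ⊖ κ 1) []) atLeast-0
    lower {suc n} (b ∷ g) (ib ∷ ig) = atLeast-cong (begin
      b * (z * z ^ n) + (monic g a * z ^ n - 1#)
        ≈⟨ +-congˡ (+-congʳ (trans (sym (*-identityˡ _)) (*-congʳ (sym (⁻¹-inverseʳ a≉0))))) ⟩
      b * (z * z ^ n) + (a * z * (monic g a * z ^ n) - 1#)
        ≈⟨ solve 5 (λ a b z m w → b ⊗ (z ⊗ w) ⊕ (a ⊗ z ⊗ (m ⊗ w) ⊖ κ 1) ⊜ (b ⊕ a ⊗ m) ⊗ (z ⊗ w) ⊖ κ 1)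
             (a ∷ b ∷ z ∷ monic g a ∷ z ^ n ∷ []) ⟩
      (b + a * monic g a) * (z * z ^ n) - 1# ∎)
      (atLeast-+ (atLeast-* ib (atLeast-* pos-z (z^-int n))) (lower g ig))

  evalᵁ-pos : ∀ {p a} → All Pos p → Int a → Pos (evalᵁ p a)
  evalᵁ-pos []        ia = atLeast-0
  evalᵁ-pos (pb ∷ pp) ia = atLeast-+ pb (atLeast-* ia (evalᵁ-pos pp ia))

  derivᵁ-pos : ∀ {p a} → All Pos p → Int a → Pos (derivᵁ p a)
  derivᵁ-pos []        ia = atLeast-0
  derivᵁ-pos (pb ∷ pp) ia = atLeast-+ (evalᵁ-pos pp ia) (atLeast-* ia (derivᵁ-pos pp ia))

  module _ {s} {k : Carrier → Set s} (isSubfield : IsSubfield k) where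
    open IsSubfield isSubfield

    ValuationRing MaximalIdeal : Carrier → Set (s ⊔ ℓ)
    ValuationRing a = k a × Int a
    MaximalIdeal  a = k a × Pos a

    private
      module Intᴿ = IsSubring int-isSubring

      S I : Carrier → Set (s ⊔ ℓ)
      S = ValuationRing
      I = MaximalIdeal

      S-isSubring : IsSubring S
      S-isSubring = record
        { resp = λ a≈b (ka , ia) → resp a≈b ka , atLeast-cong a≈b ia
        ; 0-closed = 0-closed , atLeast-0
        ; 1-closed = 1-closed , Intᴿ.1-closed
        ; +-closed = λ (ka , ia) (kb , ib) → +-closed ka kb , atLeast-+ ia ib
        ; *-closed = λ (ka , ia) (kb , ib) → *-closed ka kb , atLeast-* ia ib
        ; neg-closed = λ (ka , ia) → neg-closed ka , int-neg ia
        }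
      module S = IsSubring S-isSubring

      I-0 : I 0#
      I-0 = 0-closed , atLeast-0
      I-+ : ∀ {a b} → I a → I b → I (a + b)
      I-+ (ka , pa) (kb , pb) = +-closed ka kb , atLeast-+ pa pb
      S-I-* : ∀ {a b} → S a → I b → I (a * b)
      S-I-* (ka , ia) (kb , pb) = *-closed ka kb , atLeast-* ia pb

      evalᵁ-int : ∀ {p a} → All S p → Int a → Int (evalᵁ p a)
      evalᵁ-int sp ia = Intᴿ.evalᵁ-closed (All.map proj₂ sp) ia

    -- A coefficient `b` of least valuation is divided out, which leaves integral coefficients. The
    -- predicate `J` lets `b` keep what is known of every coefficient, such as membership in the
    -- maximal ideal.
    content : ∀ {j} {J : Carrier → Set j} {α} p → All k p → All J p → evalᵁ p α ≉ 0# →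
      ∃[ b ] ∃[ q ] J b × k b × b ≉ 0# × All S q × (∀ x → evalᵁ p x ≈ b * evalᵁ q x)
    content {J = J} {α} p kp jp pα≉0 with least p kp jp
      where
      least : ∀ p → All k p → All J p → All (_≈ 0#) p ⊎
        (∃[ b ] J b × k b × b ≉ 0# × All (AtLeast (v b)) p)
      least []      []        []        = inj₁ []
      least (a ∷ p) (ka ∷ kp) (ja ∷ jp) with a ≟ 0# | least p kp jp
      ... | yes a≈0 | inj₁ zeros = inj₁ (a≈0 ∷ zeros)
      ... | yes a≈0 | inj₂ (b , jb , kb , b≉0 , bound) =
        inj₂ (b , jb , kb , b≉0 , (λ a≉0 → ⊥-elim (a≉0 a≈0)) ∷ bound)
      ... | no a≉0 | inj₁ zeros =
        inj₂ (a , ja , ka , a≉0 , (λ _ → ℤ.≤-refl) ∷ All.map (λ b≈0 b≉0 → ⊥-elim (b≉0 b≈0)) zeros)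
      ... | no a≉0 | inj₂ (b , jb , kb , b≉0 , bound) with ℤ.≤-total (v a) (v b)
      ...   | inj₁ va≤vb = inj₂ (a , ja , ka , a≉0 , (λ _ → ℤ.≤-refl) ∷
                All.map (λ bd c≉0 → ℤ.≤-trans va≤vb (bd c≉0)) bound)
      ...   | inj₂ vb≤va = inj₂ (b , jb , kb , b≉0 , (λ _ → vb≤va) ∷ bound)
    ... | inj₁ zeros = ⊥-elim (pα≉0 (vanish p zeros))
      where
      vanish : ∀ p → All (_≈ 0#) p → evalᵁ p α ≈ 0#
      vanish []      []            = refl
      vanish (a ∷ p) (a≈0 ∷ zeros) =
        trans (+-cong a≈0 (trans (*-congˡ (vanish p zeros)) (zeroʳ α))) (+-identityˡ 0#)
    ... | inj₂ (b , jb , kb , b≉0 , bound) =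
      b , map (b ⁻¹ *_) p , jb , kb , b≉0 , All.map⁺ (All.map scaled (All.zip (kp , bound))) , λ x → begin
        evalᵁ p x ≈⟨ *-identityˡ _ ⟨
        1# * evalᵁ p x ≈⟨ *-congʳ (⁻¹-inverseʳ b≉0) ⟨
        b * b ⁻¹ * evalᵁ p x ≈⟨ *-assoc b (b ⁻¹) _ ⟩
        b * (b ⁻¹ * evalᵁ p x) ≈⟨ *-congˡ (evalᵁ-scale (b ⁻¹) p x) ⟨
        b * evalᵁ (map (b ⁻¹ *_) p) x ∎
      where
      scaled : ∀ {a} → k a × AtLeast (v b) a → S (b ⁻¹ * a)
      scaled {a} (ka , bound) = *-closed (⁻¹-closed b≉0 kb) ka ,
        ≡.subst (λ t → AtLeast t (b ⁻¹ * a)) (≡.trans (≡.cong (ℤ._+ v b) (v-⁻¹ b≉0)) (ℤ.+-inverseˡ (v b)))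
          (atLeast-* (λ _ → ℤ.≤-refl) bound)

    -- If α satisfies an equation whose derivative at α is a unit, adjoining α
    -- creates no ramification.  Let g be monic of least degree with g(α) in the
    -- maximal ideal, i.e. a lift of the minimal polynomial of the residue of α.
    -- The equation of α reads s g(α) = −r(α) with r in the maximal ideal, and
    -- the derivative condition makes s a unit.  So every p(α) in the maximal
    -- ideal is, up to s, a combination of elements of the maximal ideal of k.
    module _ {n} {f : Vec Carrier n} {α} (sf : Allⱽ S f) (fα≈0 : monic f α ≈ 0#)
      (unit-f′ : Unit (monic′ f α)) {e : ℤ} (e∣k : ∀ {a} → k a → a ≉ 0# → e ∣ v a) where

      private
        int-α : Int α
        int-α = integrally-closed (Allⱽ.map proj₂ sf) fα≈0

        SmallMonic : ℕ → Set _
        SmallMonic m = Σ[ g ∈ Vec Carrier m ] Allⱽ S g × Pos (monic g α)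

        module _ {m} (g : Vec Carrier m) (sg : Allⱽ S g) (pg : Pos (monic g α))
          (minimal : ∀ {j} → j ℕ.< m → ¬ SmallMonic j) where

          -- Dropping the top coefficients that lie in the maximal ideal, `r` becomes, modulo that
          -- ideal, either zero or a unit times a monic polynomial of degree less than `j`.
          leading : ∀ {j} (r : Vec Carrier j) → Allⱽ S r → Allⱽ I r ⊎
            (∃[ t ] Σ[ h ∈ Vec Carrier t ] ∃[ u ]
              t ℕ.< j × Allⱽ S h × k u × Unit u × Pos (evalⱽ r α - u * monic h α))
          leading []      []               = inj₁ []
          leading (a ∷ r) ((ka , ia) ∷ sr) with leading r sr
          ... | inj₂ (t , h , u , t<j , sh , ku , uu@(u≉0 , _) , pd) =
            inj₂ (suc t , u ⁻¹ * a ∷ h , u , ℕ.s≤s t<j ,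
              (*-closed (⁻¹-closed u≉0 ku) ka , atLeast-* (unit⇒int (unit-⁻¹ uu)) ia) ∷ sh , ku , uu ,
              atLeast-cong (begin
                α * (evalⱽ r α - u * monic h α)
                  ≈⟨ solve 5 (λ x r u m a → x ⊗ (r ⊖ u ⊗ m) ⊜ a ⊕ x ⊗ r ⊖ (κ 1 ⊗ a ⊕ u ⊗ (x ⊗ m)))
                       (α ∷ evalⱽ r α ∷ u ∷ monic h α ∷ a ∷ []) ⟩
                a + α * evalⱽ r α - (1# * a + u * (α * monic h α))
                  ≈⟨ +-congˡ (-‿cong (+-congʳ (*-congʳ (⁻¹-inverseʳ u≉0)))) ⟨
                a + α * evalⱽ r α - (u * u ⁻¹ * a + u * (α * monic h α))
                  ≈⟨ solve 6 (λ x r u i m a → a ⊕ x ⊗ r ⊖ (u ⊗ i ⊗ a ⊕ u ⊗ (x ⊗ m)) ⊜ a ⊕ x ⊗ r ⊖ u ⊗ (i ⊗ a ⊕ x ⊗ m))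
                       (α ∷ evalⱽ r α ∷ u ∷ u ⁻¹ ∷ monic h α ∷ a ∷ []) ⟩
                a + α * evalⱽ r α - u * (u ⁻¹ * a + α * monic h α) ∎)
                (atLeast-* int-α pd))
          ... | inj₁ ir with pos⊎unit ia
          ...   | inj₁ pa = inj₁ ((ka , pa) ∷ ir)
          ...   | inj₂ ua = inj₂ (0 , [] , a , ℕ.s≤s ℕ.z≤n , [] , ka , ua , atLeast-cong
                  (solve 3 (λ a x r → x ⊗ r ⊜ a ⊕ x ⊗ r ⊖ a ⊗ κ 1) (a ∷ α ∷ evalⱽ r α ∷ []))
                  (atLeast-* int-α (evalᵁ-pos (Allⱽ.toList⁺ (Allⱽ.map proj₂ ir)) int-α)))

          -- Otherwise the monic polynomial found by `leading` would take a value in the maximal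
          -- ideal at `α`, contrary to the minimal degree of `g`.
          small-remainder : (r : Vec Carrier m) → Allⱽ S r → Pos (evalⱽ r α) → Allⱽ I r
          small-remainder r sr pr with leading r sr
          ... | inj₁ ir = ir
          ... | inj₂ (t , h , u , t<m , sh , ku , uu , pd) =
            ⊥-elim (minimal t<m (h , sh , unit-cancelˡ uu (atLeast-cong
              (solve 2 (λ r w → r ⊕ ⊝ (r ⊖ w) ⊜ w) (evalⱽ r α ∷ u * monic h α ∷ []))
              (atLeast-+ pr (int-neg pd)))))

          F-list : List Carrier
          F-list = Vec.toList f ++ 1# ∷ []

          F-eval : ∀ {n} (f : Vec Carrier n) → evalᵁ (Vec.toList f ++ 1# ∷ []) α ≈ monic f α ×
            derivᵁ (Vec.toList f ++ 1# ∷ []) α ≈ monic′ f α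
          F-eval []      = solve 1 (λ x → κ 1 ⊕ x ⊗ κ 0 ⊜ κ 1) (α ∷ []) , solve 1 (λ x → κ 0 ⊕ x ⊗ κ 0 ⊜ κ 0) (α ∷ [])
          F-eval (a ∷ f) with F-eval f
          ... | eq , eq′ = +-congˡ (*-congˡ eq) , +-cong eq (*-congˡ eq′)

          q₀ = proj₁ (divMonic g F-list)
          r₀ = proj₂ (divMonic g F-list)
          F-closed : All S F-list
          F-closed = All.++⁺ (Allⱽ.toList⁺ sf) (S.1-closed ∷ [])
          sq₀ : All S q₀
          sq₀ = proj₁ (S.divMonic-closed g F-list sg F-closed)
          sr₀ : Allⱽ S r₀
          sr₀ = proj₂ (S.divMonic-closed g F-list sg F-closed)
          s₀ G : Carrier
          s₀ = evalᵁ q₀ α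
          G = monic g α

          int-s₀ : Int s₀
          int-s₀ = evalᵁ-int sq₀ int-α

          relation : s₀ * G + evalⱽ r₀ α ≈ 0#
          relation = trans (sym (proj₁ (divMonic-eval g F-list α))) (trans (proj₁ (F-eval f)) fα≈0)

          pos-r₀ : Pos (evalⱽ r₀ α)
          pos-r₀ = atLeast-cong (begin
            - (s₀ * G) ≈⟨ +-identityʳ _ ⟨
            - (s₀ * G) + 0# ≈⟨ +-congˡ relation ⟨
            - (s₀ * G) + (s₀ * G + evalⱽ r₀ α)
              ≈⟨ solve 2 (λ a b → ⊝ a ⊕ (a ⊕ b) ⊜ b) (s₀ * G ∷ evalⱽ r₀ α ∷ []) ⟩
            evalⱽ r₀ α ∎) (int-neg (atLeast-* int-s₀ pg))

          ir₀ : Allⱽ I r₀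
          ir₀ = small-remainder r₀ sr₀ pos-r₀

          -- Differentiating f = q₀ g + r₀ at `α` gives f′(α) = q₀′(α) G + s₀ g′(α) + r₀′(α). The
          -- outer terms are in the maximal ideal, so a non-unit `s₀` would put f′(α) there as well.
          unit-s₀ : Unit s₀
          unit-s₀ = ¬pos⇒unit int-s₀ λ ps₀ → unit⇒¬pos unit-f′ (atLeast-cong
            (trans (sym (proj₂ (divMonic-eval g F-list α))) (proj₂ (F-eval f)))
            (atLeast-+ (atLeast-+
              (atLeast-* (Intᴿ.derivᵁ-closed (All.map proj₂ sq₀) int-α) pg)
              (atLeast-* ps₀ (int-monic′ g sg)))
              (derivᵁ-pos (Allⱽ.toList⁺ (Allⱽ.map proj₂ ir₀)) int-α)))
            where
            int-monic : ∀ {n} (g : Vec Carrier n) → Allⱽ S g → Int (monic g α)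
            int-monic []      []        = Intᴿ.1-closed
            int-monic (a ∷ g) (sa ∷ sg) = atLeast-+ (proj₂ sa) (atLeast-* int-α (int-monic g sg))
            int-monic′ : ∀ {n} (g : Vec Carrier n) → Allⱽ S g → Int (monic′ g α)
            int-monic′ []      []        = atLeast-0
            int-monic′ (a ∷ g) (sa ∷ sg) = atLeast-+ (int-monic g sg) (atLeast-* int-α (int-monic′ g sg))

          -- Write p = q g + r; minimality puts the coefficients of `r` into the maximal ideal. In
          -- s₀ p(α) = q(α) s₀ G + s₀ r(α) the product `s₀ G` may be replaced by -r₀(α), and then
          -- all coefficients lie there.
          absorb : ∀ p → All S p → Pos (evalᵁ p α) → ∃[ r ] All I r × evalᵁ r α ≈ s₀ * evalᵁ p α
          absorb p sp pp = a *ᵁ Vec.toList r₀ +ᵁ q₀ *ᵁ Vec.toList r ,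
            +ᵁ-closed {S = S} I-0 I-+ (*ᵁ-closed I-0 I-+ S-I-* sa (Allⱽ.toList⁺ ir₀))
              (*ᵁ-closed I-0 I-+ S-I-* sq₀ (Allⱽ.toList⁺ ir)) , (begin
            evalᵁ (a *ᵁ Vec.toList r₀ +ᵁ q₀ *ᵁ Vec.toList r) α
              ≈⟨ evalᵁ-+ (a *ᵁ Vec.toList r₀) _ α ⟩
            evalᵁ (a *ᵁ Vec.toList r₀) α + evalᵁ (q₀ *ᵁ Vec.toList r) α
              ≈⟨ +-cong (trans (evalᵁ-* a _ α) (*-congʳ (evalᵁ-scale (- 1#) q α))) (evalᵁ-* q₀ _ α) ⟩
            - 1# * evalᵁ q α * evalⱽ r₀ α + s₀ * evalⱽ r α
              ≈⟨ solve 5 (λ q r₀ s r G → ⊝ κ 1 ⊗ q ⊗ r₀ ⊕ s ⊗ r ⊜ s ⊗ (q ⊗ G ⊕ r) ⊖ q ⊗ (s ⊗ G ⊕ r₀))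
                   (evalᵁ q α ∷ evalⱽ r₀ α ∷ s₀ ∷ evalⱽ r α ∷ G ∷ []) ⟩
            s₀ * (evalᵁ q α * G + evalⱽ r α) - evalᵁ q α * (s₀ * G + evalⱽ r₀ α)
              ≈⟨ +-cong (*-congˡ (sym eq)) (-‿cong (trans (*-congˡ relation) (zeroʳ _))) ⟩
            s₀ * evalᵁ p α - 0#
              ≈⟨ solve 1 (λ p → p ⊖ κ 0 ⊜ p) (s₀ * evalᵁ p α ∷ []) ⟩
            s₀ * evalᵁ p α ∎)
            where
            q = proj₁ (divMonic g p)
            r = proj₂ (divMonic g p)
            eq = proj₁ (divMonic-eval g p α)
            closed = S.divMonic-closed g p sg sp
            a = map (- 1# *_) q
            sa : All S a
            sa = All.map⁺ (All.map (S.*-closed (S.neg-closed S.1-closed)) (proj₁ closed))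
            ir : Allⱽ I r
            ir = small-remainder r (proj₂ closed) (atLeast-cong (begin
              evalᵁ p α - evalᵁ q α * G ≈⟨ +-congʳ eq ⟩
              evalᵁ q α * G + evalⱽ r α - evalᵁ q α * G
                ≈⟨ solve 2 (λ a b → a ⊕ b ⊖ a ⊜ b) (evalᵁ q α * G ∷ evalⱽ r α ∷ []) ⟩
              evalⱽ r α ∎)
              (atLeast-+ pp (int-neg (atLeast-* (evalᵁ-int (proj₁ closed) int-α) pg))))

          Reduction : Carrier → Set _
          Reduction y = ∃[ d ] ∃[ q ] I d × k d × d ≉ 0# × All S q × s₀ * y ≈ d * evalᵁ q α

          reduction : ∀ p → All S p → evalᵁ p α ≉ 0# → Pos (evalᵁ p α) → Reduction (evalᵁ p α)
          reduction p sp p≉0 pp = extract (absorb p sp pp)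
            where
            extract : ∃[ r ] All I r × evalᵁ r α ≈ s₀ * evalᵁ p α → Reduction (evalᵁ p α)
            extract (r , ir , eq) = rescale
              (content r (All.map proj₁ ir) ir (nonzero-cong (sym eq) (*-nonzero (proj₁ unit-s₀) p≉0)))
              where
              rescale : ∃[ d ] ∃[ q ] I d × k d × d ≉ 0# × All S q × (∀ x → evalᵁ r x ≈ d * evalᵁ q x) →
                Reduction (evalᵁ p α)
              rescale (d , q , id , kd , d≉0 , sq , factor) = d , q , id , kd , d≉0 , sq , trans (sym eq) (factor α)

          -- Mutual induction on a bound `b` for the value. A non-unit y = p(α) satisfies s₀ y = d
          -- q(α) with `d` in the maximal ideal of `k`, so v(y) = v(d) + v(q(α)). Here `e` divides
          -- v(d), and v(q(α)) is strictly smaller than v(y).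
          e∣polynomial : ∀ b p → All S p → evalᵁ p α ≉ 0# → v (evalᵁ p α) ℤ.≤ + b → e ∣ v (evalᵁ p α)
          e∣reduced : ∀ b {y} → y ≉ 0# → Reduction y → v y ℤ.≤ + b → e ∣ v y

          e∣polynomial b p sp p≉0 v≤b = decide (pos⊎unit (evalᵁ-int sp int-α))
            where
            decide : Pos (evalᵁ p α) ⊎ Unit (evalᵁ p α) → e ∣ v (evalᵁ p α)
            decide (inj₁ pp)       = e∣reduced b p≉0 (reduction p sp p≉0 pp) v≤b
            decide (inj₂ (_ , vp)) = ≡.subst (e ∣_) (≡.sym vp) (divides 0ℤ ≡.refl)

          e∣reduced b {y} y≉0 (d , q , (_ , pd) , kd , d≉0 , sq , eq) v≤b =
            ≡.subst (e ∣_) (≡.sym v-split) (∣m∣n⇒∣m+n (e∣k kd d≉0) (recurse b (ℤ.≤-trans 1+vq≤ v≤b)))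
            where
            q≉0 : evalᵁ q α ≉ 0#
            q≉0 = nonzero-*ʳ (nonzero-cong eq (*-nonzero (proj₁ unit-s₀) y≉0))
            v-split : v y ≡ v d ℤ.+ v (evalᵁ q α)
            v-split = ≡.trans (≡.sym (ℤ.+-identityˡ (v y))) (≡.trans (≡.cong (ℤ._+ v y) (≡.sym (proj₂ unit-s₀)))
              (≡.trans (≡.sym (v-* (proj₁ unit-s₀) y≉0)) (≡.trans (v-cong eq) (v-* d≉0 q≉0))))
            1+vq≤ : 1ℤ ℤ.+ v (evalᵁ q α) ℤ.≤ v y
            1+vq≤ = ℤ.≤-trans (ℤ.+-monoˡ-≤ (v (evalᵁ q α)) (pd d≉0)) (ℤ.≤-reflexive (≡.sym v-split))
            recurse : ∀ b → 1ℤ ℤ.+ v (evalᵁ q α) ℤ.≤ + b → e ∣ v (evalᵁ q α)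
            recurse zero    1+vq≤0 = ⊥-elim (absurd (ℤ.≤-trans (ℤ.+-monoʳ-≤ 1ℤ (evalᵁ-int sq int-α q≉0)) 1+vq≤0))
              where
              absurd : ¬ 1ℤ ℤ.≤ 0ℤ
              absurd (ℤ.+≤+ ())
            recurse (suc b) 1+vq≤b =
              e∣polynomial b q sq q≉0 (ℤ.i<j⇒i≤pred[j] {v (evalᵁ q α)} {+ suc b} (ℤ.suc[i]≤j⇒i<j 1+vq≤b))

          -- Numerator and denominator are each made integral by extracting their content, whose
          -- value is divisible by `e` because it lies in `k`.
          e∣adjoin : ∀ {y} → Adjoin k α y → y ≉ 0# → e ∣ v y
          e∣adjoin {y} (p , q , kp , kq , q≉0 , eq) y≉0 = ∣m+n∣n⇒∣m {m = v y}
            (≡.subst (e ∣_) (≡.trans (v-cong (sym eq)) (v-* y≉0 q≉0)) (divisible p kp p≉0)) (divisible q kq q≉0)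
            where
            p≉0 : evalᵁ p α ≉ 0#
            p≉0 = nonzero-cong eq (*-nonzero y≉0 q≉0)
            divisible : ∀ p → All k p → evalᵁ p α ≉ 0# → e ∣ v (evalᵁ p α)
            divisible p kp p≉0 with content p kp kp p≉0
            ... | d , r , kd , _ , d≉0 , sr , factor = ≡.subst (e ∣_)
              (≡.trans (≡.sym (v-* d≉0 r≉0)) (v-cong (sym (factor α))))
              (∣m∣n⇒∣m+n (e∣k kd d≉0) (e∣polynomial ℤ.∣ v (evalᵁ r α) ∣ r sr r≉0
                (ℤ.≤-reflexive (≡.sym (ℤ.0≤i⇒+∣i∣≡i (evalᵁ-int sr int-α r≉0))))))
              where
              r≉0 : evalᵁ r α ≉ 0#
              r≉0 = nonzero-*ʳ (nonzero-cong (factor α) p≉0)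

      étale-step : ∀ {y} → Adjoin k α y → y ≉ 0# → e ∣ v y
      -- The search for the least degree starts from `f`, whose value at `α` is zero and so lies in
      -- the maximal ideal.
      étale-step {y} ky y≉0 = decidable-stable (e ∣? v y) λ e∤ → ¬¬-least SmallMonic
        (n , f , sf , λ fα≉0 → ⊥-elim (fα≉0 fα≈0))
        λ (m , (g , sg , pg) , minimal) → e∤ (e∣adjoin g sg pg minimal ky y≉0)

-- Generic points and automorphisms of plane curves

-- ℚ as an extension of itself, so that the lemmas on `eval` also apply to values at rational
-- points.
rational : FieldOverℚ _ _
rational = record
  { commutativeRing = ℚ.+-*-commutativeRing
  ; _≟_     = ℚ._≟_
  ; 1≉0     = λ ()
  ; inverse = λ x x≢0 → (ℚ.1/ x) {{ℚ.≢-nonZero x≢0}} , ℚ.*-inverseʳ x {{ℚ.≢-nonZero x≢0}}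
  ; ι       = id
  ; ι-hom   = Identity.isRingHomomorphism ℚ.+-*-rawRing ≡.refl
  }

module Atℚ = FieldLemmas rational

evalℚ : ∀ {n} → Poly n → (Fin n → ℚ) → ℚ
evalℚ = FieldOverℚ.eval rational

module GenericPoint {F : Poly 3} {c ℓ} (C : FunctionField F c ℓ) where
  open FunctionField C
  open Curve C using (Automorphism; module Automorphism; ⟦_⟧)
  open Identities fieldOverℚ
  open FieldLemmas fieldOverℚ
  open Subfields fieldOverℚ
  open import Relation.Binary.Reasoning.Setoid setoid

  -- A form vanishing at the generic point is a multiple of `F`. The field `L` is ℚ when a function
  -- is specialised to a rational point, and `K` when `ξ` is replaced by its image under a symmetry.
  vanishes-on-curve : ∀ {c′ ℓ′} (L : FieldOverℚ c′ ℓ′) {d} (P : Poly 3) → Homogeneous d P → eval P ξ ≈ 0# →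
    let open FieldOverℚ L using () renaming (eval to evalᴸ; _≈_ to _≈ᴸ_; 0# to 0ᴸ) in
    ∀ η → evalᴸ F η ≈ᴸ 0ᴸ → evalᴸ P η ≈ᴸ 0ᴸ
  vanishes-on-curve L P hP Pξ≈0 η Fη≈0 = multiple (Equivalence.to (vanishing P hP) Pξ≈0)
    where
    module L = FieldOverℚ L
    module Lᴸ = FieldLemmas L
    multiple : F ∣ᴾ P → L.eval P η L.≈ L.0#
    multiple (R , P≋RF) = L.trans (Lᴸ.eval-≋ P (R *ᴾ F) P≋RF η)
      (L.trans (Lᴸ.eval-* R F η) (L.trans (L.*-congˡ Fη≈0) (L.zeroʳ _)))

  module RationalPoint (pt : Fin 3 → ℚ) (F-pt : evalℚ F pt ≡ 0ℚ) where

    nonvanishing : ∀ {d} (P : Poly 3) → Homogeneous d P → evalℚ P pt ≢ 0ℚ → eval P ξ ≉ 0#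
    nonvanishing P hP P-pt≢0 Pξ≈0 = P-pt≢0 (vanishes-on-curve rational P hP Pξ≈0 pt F-pt)

    infix 4 _↦_

    -- The local ring of the plane curve at `pt`, with its residue map. At a node a function outside
    -- this ring may take different values on the two branches; a denominator that is nonzero at
    -- `pt` excludes this.
    record _↦_ (f : Carrier) (a : ℚ) : Set ℓ where
      constructor regular
      field
        fraction : ∃[ d ] ∃[ P ] ∃[ Q ] Homogeneous d P × Homogeneous d Q × evalℚ Q pt ≢ 0ℚ ×
          a ℚ.* evalℚ Q pt ≡ evalℚ P pt × f * eval Q ξ ≈ eval P ξ

    private
      ℚ-nonzero-* : ∀ {p q : ℚ} → p ≢ 0ℚ → q ≢ 0ℚ → p ℚ.* q ≢ 0ℚ
      ℚ-nonzero-* = Atℚ.*-nonzero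

    ↦-cong : ∀ {f g a} → f ≈ g → f ↦ a → g ↦ a
    ↦-cong f≈g (regular (d , P , Q , hP , hQ , Q≢0 , val , eq)) =
      regular (d , P , Q , hP , hQ , Q≢0 , val , trans (*-congʳ (sym f≈g)) eq)

    ↦-ι : ∀ q → ι q ↦ q
    ↦-ι q = regular (0 , constᴾ q , constᴾ 1ℚ , homogeneous-const q , homogeneous-const 1ℚ ,
      (λ eq → FieldOverℚ.1≉0 rational (≡.trans (≡.sym (Atℚ.eval-const 1ℚ pt)) eq)) ,
      ≡.trans (≡.cong (q ℚ.*_) (Atℚ.eval-const 1ℚ pt)) (≡.trans (ℚ.*-identityʳ q) (≡.sym (Atℚ.eval-const q pt))) ,
      trans (*-congˡ (trans (eval-const 1ℚ ξ) ι-1)) (trans (*-identityʳ _) (sym (eval-const q ξ))))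

    ↦-+ : ∀ {f g a b} → f ↦ a → g ↦ b → f + g ↦ a ℚ.+ b
    ↦-+ {a = a} {b} (regular (d , P , Q , hP , hQ , Q≢0 , val , eq)) (regular (d′ , P′ , Q′ , hP′ , hQ′ , Q′≢0 , val′ , eq′)) =
      regular (d ℕ.+ d′ , P *ᴾ Q′ +ᴾ P′ *ᴾ Q , Q *ᴾ Q′ ,
      homogeneous-+ (proj₁ cross) (proj₂ cross) , homogeneous-* Q Q′ hQ hQ′ ,
      (λ eq → ℚ-nonzero-* Q≢0 Q′≢0 (≡.trans (≡.sym (Atℚ.eval-* Q Q′ pt)) eq)) ,
      Atℚ.eval-fraction-+ {f = a} {g = b} P Q P′ Q′ pt val val′ , eval-fraction-+ P Q P′ Q′ ξ eq eq′)
      where cross = homogeneous-cross P Q P′ Q′ hP hQ hP′ hQ′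

    ↦-* : ∀ {f g a b} → f ↦ a → g ↦ b → f * g ↦ a ℚ.* b
    ↦-* {a = a} {b} (regular (d , P , Q , hP , hQ , Q≢0 , val , eq)) (regular (d′ , P′ , Q′ , hP′ , hQ′ , Q′≢0 , val′ , eq′)) =
      regular (d ℕ.+ d′ , P *ᴾ P′ , Q *ᴾ Q′ , homogeneous-* P P′ hP hP′ , homogeneous-* Q Q′ hQ hQ′ ,
      (λ eq → ℚ-nonzero-* Q≢0 Q′≢0 (≡.trans (≡.sym (Atℚ.eval-* Q Q′ pt)) eq)) ,
      Atℚ.eval-fraction-* {f = a} {g = b} P Q P′ Q′ pt val val′ , eval-fraction-* P Q P′ Q′ ξ eq eq′)

    ↦-- : ∀ {f g a b} → f ↦ a → g ↦ b → f - g ↦ a ℚ.- b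
    ↦-- {f} {g} {a} {b} f↦a g↦b = ≡.subst (f - g ↦_) (≡.cong (a ℚ.+_) (ℚ-neg-one b))
      (↦-cong (+-congˡ neg) (↦-+ f↦a (↦-* (↦-ι (ℚ.- 1ℚ)) g↦b)))
      where
      ℚ-neg-one : ∀ b → ℚ.- 1ℚ ℚ.* b ≡ ℚ.- b
      ℚ-neg-one b = Identities.solve rational 1 (λ b → ⊝ κ 1 ⊗ b ⊜ ⊝ b) (b ∷ [])
      neg : ι (ℚ.- 1ℚ) * g ≈ - g
      neg = trans (*-congʳ (trans (ι-neg 1ℚ) (-‿cong ι-1))) (solve 1 (λ g → ⊝ κ 1 ⊗ g ⊜ ⊝ g) (g ∷ []))

    ↦-nonzero : ∀ {f a} → f ↦ a → a ≢ 0ℚ → f ≉ 0#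
    ↦-nonzero {f} {a} (regular (d , P , Q , hP , hQ , Q≢0 , val , eq)) a≢0 f≈0 =
      nonvanishing P hP (λ P≡0 → ℚ-nonzero-* a≢0 Q≢0 (≡.trans val P≡0))
        (trans (sym eq) (trans (*-congʳ f≈0) (zeroˡ _)))

    ↦-⁻¹ : ∀ {f a} → f ↦ a → a ≢ 0ℚ → ∃[ b ] f ⁻¹ ↦ b
    ↦-⁻¹ {f} {a} f↦a@(regular (d , P , Q , hP , hQ , Q≢0 , val , eq)) a≢0 =
      FieldOverℚ._⁻¹ rational a , regular (d , Q , P , hQ , hP , (λ P≡0 → ℚ-nonzero-* a≢0 Q≢0 (≡.trans val P≡0)) ,
      Atℚ.fraction-⁻¹ {f = a} a≢0 val , fraction-⁻¹ (↦-nonzero f↦a a≢0) eq)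

    ↦-zero-/ : ∀ {f g b} → f ↦ 0ℚ → g ↦ b → b ≢ 0ℚ → f / g ↦ 0ℚ
    ↦-zero-/ {f} {g} f↦0 g↦b b≢0 =
      ≡.subst (f / g ↦_) (ℚ.*-zeroˡ (proj₁ (↦-⁻¹ g↦b b≢0))) (↦-* f↦0 (proj₂ (↦-⁻¹ g↦b b≢0)))

  module AutomorphismLemmas (σ : Automorphism) where
    open IsRingIsomorphism (Automorphism.isRingAutomorphism σ) public
      using (⟦⟧-cong; injective)
      renaming (+-homo to σ-+; *-homo to σ-*; -‿homo to σ-neg; 0#-homo to σ-0; 1#-homo to σ-1)

    σ-nonzero : ∀ {f} → f ≉ 0# → ⟦ σ ⟧ f ≉ 0#
    σ-nonzero f≉0 eq = f≉0 (injective (trans eq (sym σ-0)))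

    σ-^ : ∀ f n → ⟦ σ ⟧ (f ^ n) ≈ ⟦ σ ⟧ f ^ n
    σ-^ f zero    = σ-1
    σ-^ f (suc n) = trans (σ-* f (f ^ n)) (*-congˡ (σ-^ f n))

    σ-expr : ∀ {n} (e : Expr n) ρ → ⟦ σ ⟧ (⟦ e ⟧ₑ ρ) ≈ ⟦ e ⟧ₑ (Vec.map ⟦ σ ⟧ ρ)
    σ-expr (con z) ρ =
      trans (⟦⟧-cong (⟦⟧ᶻ≈ι z)) (trans (Automorphism.fixesℚ σ (z ℚ./ 1)) (sym (⟦⟧ᶻ≈ι z)))
    σ-expr (slot i) ρ = reflexive (≡.sym (lookup-map i ⟦ σ ⟧ ρ))
    σ-expr (a ⊕ b) ρ = trans (σ-+ _ _) (+-cong (σ-expr a ρ) (σ-expr b ρ))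
    σ-expr (a ⊗ b) ρ = trans (σ-* _ _) (*-cong (σ-expr a ρ) (σ-expr b ρ))
    σ-expr (a ⊖ b) ρ = trans (σ-+ _ _) (+-cong (σ-expr a ρ) (trans (σ-neg _) (-‿cong (σ-expr b ρ))))
    σ-expr (⊝ a)   ρ = trans (σ-neg _) (-‿cong (σ-expr a ρ))
    σ-expr (a ⊛ k) ρ = trans (σ-^ _ k) (^-congˡ k (σ-expr a ρ))

    σ-evalᵁ : ∀ {p} → All (λ a → ⟦ σ ⟧ a ≈ a) p → ∀ α → ⟦ σ ⟧ (evalᵁ p α) ≈ evalᵁ p (⟦ σ ⟧ α)
    σ-evalᵁ []         α = σ-0
    σ-evalᵁ (fix ∷ fp) α = trans (σ-+ _ _) (+-cong fix (trans (σ-* _ _) (*-congˡ (σ-evalᵁ fp α))))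

    conjugate : ∀ {s} {k : Carrier → Set s} → (∀ {a} → k a → ⟦ σ ⟧ a ≈ a) → ∀ {y α β} →
      ⟦ σ ⟧ y ≈ y → ⟦ σ ⟧ α ≈ β → Conjugate k y α β
    conjugate fixes {y} {α} {β} σy≈y σα≈β p q kp kq eq = begin
      y * evalᵁ q β ≈⟨ *-cong σy≈y (trans (σ-evalᵁ (All.map fixes kq) α) (evalᵁ-cong q σα≈β)) ⟨
      ⟦ σ ⟧ y * ⟦ σ ⟧ (evalᵁ q α) ≈⟨ σ-* y (evalᵁ q α) ⟨
      ⟦ σ ⟧ (y * evalᵁ q α) ≈⟨ ⟦⟧-cong eq ⟩
      ⟦ σ ⟧ (evalᵁ p α) ≈⟨ σ-evalᵁ (All.map fixes kp) α ⟩
      evalᵁ p (⟦ σ ⟧ α) ≈⟨ evalᵁ-cong p σα≈β ⟩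
      evalᵁ p β ∎

  -- A homogeneous polynomial map g with g(ξ) on the curve and g(g(ξ)) = k ξ
  -- in ℙ² induces the involution P(ξ)/Q(ξ) ↦ P(g(ξ))/Q(g(ξ)) of the function field.
  module Involution {d} (g : Fin 3 → Poly 3) (hg : ∀ i → Homogeneous d (g i))
    (on-curve : eval F (λ i → eval (g i) ξ) ≈ 0#)
    {k} (k≉0 : k ≉ 0#) (involutive : ∀ i → eval (g i) (λ j → eval (g j) ξ) ≈ k * ξ i) where

    η : Fin 3 → Carrier
    η i = eval (g i) ξ

    twice : ∀ {r} (P : Poly 3) → Homogeneous r P → eval (substitute P g) η ≈ k ^ r * eval P ξ
    twice P hP = trans (eval-substitute P g η) (trans (eval-cong P involutive) (eval-scale P hP ξ k))

    vanishes⇒ : ∀ {r} (P : Poly 3) → Homogeneous r P → eval P ξ ≈ 0# → eval P η ≈ 0#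
    vanishes⇒ P hP Pξ≈0 = vanishes-on-curve fieldOverℚ P hP Pξ≈0 η on-curve

    -- Apply `vanishes⇒` to the composite of `P` with `g`: its value at `η` is a nonzero multiple of
    -- the value of `P` at `ξ`. Hence denominators stay nonzero under the pullback.
    vanishes⇐ : ∀ {r} (P : Poly 3) → Homogeneous r P → eval P η ≈ 0# → eval P ξ ≈ 0#
    vanishes⇐ {r} P hP Pη≈0 = *-zero-product (trans (sym (twice P hP))
      (vanishes⇒ (substitute P g) (homogeneous-substitute P g hP hg) (trans (eval-substitute P g ξ) Pη≈0)))
      (^-nonzero r k≉0)

    -- The graph of the pullback. By `image-unique` the choice of the fraction is immaterial, so
    -- each law of `map-σ` follows from exhibiting one suitable fraction.
    Image : Carrier → Carrier → Set ℓ
    Image f y = ∃[ r ] ∃[ P ] ∃[ Q ] Homogeneous r P × Homogeneous r Q ×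
      eval Q ξ ≉ 0# × f * eval Q ξ ≈ eval P ξ × y * eval Q η ≈ eval P η

    image : ∀ f → ∃ (Image f)
    image f with generated f
    ... | r , P , Q , hP , hQ , Q≉0 , eq =
      eval P η / eval Q η , r , P , Q , hP , hQ , Q≉0 , eq , /-*-cancel (λ Qη≈0 → Q≉0 (vanishes⇐ Q hQ Qη≈0))

    image-unique : ∀ {f f′ y y′} → Image f y → Image f′ y′ → f ≈ f′ → y ≈ y′
    image-unique {f} {f′} {y} {y′} (r , P , Q , hP , hQ , Q≉0 , eq , yeq) (r′ , P′ , Q′ , hP′ , hQ′ , Q′≉0 , eq′ , yeq′) f≈f′ =
      *-cancelˡ-nonzero (*-nonzero (λ Qη≈0 → Q≉0 (vanishes⇐ Q hQ Qη≈0)) (λ Q′η≈0 → Q′≉0 (vanishes⇐ Q′ hQ′ Q′η≈0)))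
      (begin
        eval Q η * eval Q′ η * y
          ≈⟨ solve 3 (λ q r y → q ⊗ r ⊗ y ⊜ y ⊗ q ⊗ r) (eval Q η ∷ eval Q′ η ∷ y ∷ []) ⟩
        y * eval Q η * eval Q′ η ≈⟨ *-congʳ yeq ⟩
        eval P η * eval Q′ η ≈⟨ x-y≈0⇒x≈y _ _ (trans (sym (cross η)) (vanishes⇒ D hD (trans (cross ξ) zero-ξ))) ⟩
        eval P′ η * eval Q η ≈⟨ *-congʳ yeq′ ⟨
        y′ * eval Q′ η * eval Q η
          ≈⟨ solve 3 (λ q r y → q ⊗ r ⊗ y ⊜ y ⊗ r ⊗ q) (eval Q η ∷ eval Q′ η ∷ y′ ∷ []) ⟨
        eval Q η * eval Q′ η * y′ ∎)
      where
      -- Equality of the two fractions at `ξ` is the vanishing of a single form, and this carries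
      -- over to `η`.
      D : Poly 3
      D = P *ᴾ Q′ -ᴾ P′ *ᴾ Q
      hD : Homogeneous (r ℕ.+ r′) D
      hD = homogeneous-- (P *ᴾ Q′) (P′ *ᴾ Q) (proj₁ crosses) (proj₂ crosses)
        where crosses = homogeneous-cross P Q P′ Q′ hP hQ hP′ hQ′
      cross : ∀ x → eval D x ≈ eval P x * eval Q′ x - eval P′ x * eval Q x
      cross x = trans (eval-- (P *ᴾ Q′) (P′ *ᴾ Q) x) (+-cong (eval-* P Q′ x) (-‿cong (eval-* P′ Q x)))
      zero-ξ : eval P ξ * eval Q′ ξ - eval P′ ξ * eval Q ξ ≈ 0#
      zero-ξ = x≈y⇒x-y≈0 (begin
        eval P ξ * eval Q′ ξ ≈⟨ *-congʳ eq ⟨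
        f * eval Q ξ * eval Q′ ξ ≈⟨ *-congʳ (*-congʳ f≈f′) ⟩
        f′ * eval Q ξ * eval Q′ ξ
          ≈⟨ solve 3 (λ f q r → f ⊗ q ⊗ r ⊜ f ⊗ r ⊗ q) (f′ ∷ eval Q ξ ∷ eval Q′ ξ ∷ []) ⟩
        f′ * eval Q′ ξ * eval Q ξ ≈⟨ *-congʳ eq′ ⟩
        eval P′ ξ * eval Q ξ ∎)

    image-+ : ∀ {f f′ y y′} → Image f y → Image f′ y′ → Image (f + f′) (y + y′)
    image-+ (r , P , Q , hP , hQ , Q≉0 , eq , yeq) (r′ , P′ , Q′ , hP′ , hQ′ , Q′≉0 , eq′ , yeq′) =
      r ℕ.+ r′ , P *ᴾ Q′ +ᴾ P′ *ᴾ Q , Q *ᴾ Q′ , homogeneous-+ (proj₁ cross) (proj₂ cross) ,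
      homogeneous-* Q Q′ hQ hQ′ , nonzero-cong (sym (eval-* Q Q′ ξ)) (*-nonzero Q≉0 Q′≉0) ,
      eval-fraction-+ P Q P′ Q′ ξ eq eq′ , eval-fraction-+ P Q P′ Q′ η yeq yeq′
      where cross = homogeneous-cross P Q P′ Q′ hP hQ hP′ hQ′

    image-* : ∀ {f f′ y y′} → Image f y → Image f′ y′ → Image (f * f′) (y * y′)
    image-* (r , P , Q , hP , hQ , Q≉0 , eq , yeq) (r′ , P′ , Q′ , hP′ , hQ′ , Q′≉0 , eq′ , yeq′) =
      r ℕ.+ r′ , P *ᴾ P′ , Q *ᴾ Q′ , homogeneous-* P P′ hP hP′ , homogeneous-* Q Q′ hQ hQ′ ,
      nonzero-cong (sym (eval-* Q Q′ ξ)) (*-nonzero Q≉0 Q′≉0) ,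
      eval-fraction-* P Q P′ Q′ ξ eq eq′ , eval-fraction-* P Q P′ Q′ η yeq yeq′

    image-ι : ∀ q → Image (ι q) (ι q)
    image-ι q = 0 , constᴾ q , constᴾ 1ℚ , homogeneous-const q , homogeneous-const 1ℚ ,
      nonzero-cong (sym (one ξ)) 1≉0 , fraction ξ , fraction η
      where
      one : ∀ x → eval {3} (constᴾ 1ℚ) x ≈ 1#
      one x = trans (eval-const 1ℚ x) ι-1
      fraction : ∀ x → ι q * eval {3} (constᴾ 1ℚ) x ≈ eval {3} (constᴾ q) x
      fraction x = trans (*-congˡ (one x)) (trans (*-identityʳ _) (sym (eval-const q x)))

    -- Composing both forms with `g` moves the pair of points from (ξ, η) to (η, k ξ), and the
    -- factor `k ^ r` cancels in the fraction. This makes the pullback an involution, and thus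
    -- bijective.
    image-sym : ∀ {f y} → Image f y → Image y f
    image-sym {f} {y} (r , P , Q , hP , hQ , Q≉0 , eq , yeq) =
      r ℕ.* d , substitute P g , substitute Q g , homogeneous-substitute P g hP hg , homogeneous-substitute Q g hQ hg ,
      (λ eq → Q≉0 (vanishes⇐ Q hQ (trans (sym (eval-substitute Q g ξ)) eq))) ,
      trans (*-congˡ (eval-substitute Q g ξ)) (trans yeq (sym (eval-substitute P g ξ))) ,
      (begin
        f * eval (substitute Q g) η ≈⟨ *-congˡ (twice Q hQ) ⟩
        f * (k ^ r * eval Q ξ)
          ≈⟨ solve 3 (λ f k q → f ⊗ (k ⊗ q) ⊜ k ⊗ (f ⊗ q)) (f ∷ k ^ r ∷ eval Q ξ ∷ []) ⟩
        k ^ r * (f * eval Q ξ) ≈⟨ *-congˡ eq ⟩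
        k ^ r * eval P ξ ≈⟨ twice P hP ⟨
        eval (substitute P g) η ∎)

    map-σ : Carrier → Carrier
    map-σ f = proj₁ (image f)

    map-≈ : ∀ {f y} → Image f y → map-σ f ≈ y
    map-≈ {f} img = image-unique (proj₂ (image f)) img refl

    map-cong : ∀ {f g} → f ≈ g → map-σ f ≈ map-σ g
    map-cong {f} {g} = image-unique (proj₂ (image f)) (proj₂ (image g))

    map-involutive : ∀ f → map-σ (map-σ f) ≈ f
    map-involutive f = map-≈ (image-sym (proj₂ (image f)))

    map-+ : ∀ f g → map-σ (f + g) ≈ map-σ f + map-σ g
    map-+ f g = map-≈ (image-+ (proj₂ (image f)) (proj₂ (image g)))

    map-* : ∀ f g → map-σ (f * g) ≈ map-σ f * map-σ g
    map-* f g = map-≈ (image-* (proj₂ (image f)) (proj₂ (image g)))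

    map-ι : ∀ q → map-σ (ι q) ≈ ι q
    map-ι q = map-≈ (image-ι q)

    map-neg : ∀ f → map-σ (- f) ≈ - map-σ f
    map-neg f = begin
      map-σ (- f) ≈⟨ map-cong (negation f) ⟩
      map-σ (ι (ℚ.- 1ℚ) * f) ≈⟨ map-* (ι (ℚ.- 1ℚ)) f ⟩
      map-σ (ι (ℚ.- 1ℚ)) * map-σ f ≈⟨ *-congʳ (map-ι (ℚ.- 1ℚ)) ⟩
      ι (ℚ.- 1ℚ) * map-σ f ≈⟨ negation (map-σ f) ⟨
      - map-σ f ∎
      where
      negation : ∀ x → - x ≈ ι (ℚ.- 1ℚ) * x
      negation x = sym (trans (*-congʳ (trans (ι-neg 1ℚ) (-‿cong ι-1))) (solve 1 (λ x → ⊝ κ 1 ⊗ x ⊜ ⊝ x) (x ∷ [])))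

    automorphism : Automorphism
    automorphism = record
      { ⟦_⟧ = map-σ
      ; isRingAutomorphism = record
        { isRingMonomorphism = record
          { isRingHomomorphism = record
            { isSemiringHomomorphism = record
              { isNearSemiringHomomorphism = record
                { +-isMonoidHomomorphism = record
                  { isMagmaHomomorphism = record
                    { isRelHomomorphism = record { cong = map-cong }
                    ; homo = map-+ }
                  ; ε-homo = trans (map-cong (sym ι-0)) (trans (map-ι 0ℚ) ι-0) }
                ; *-homo = map-* }
              ; 1#-homo = trans (map-cong (sym ι-1)) (trans (map-ι 1ℚ) ι-1) }
            ; -‿homo = map-neg }
          ; injective = λ {f} {g} eq → trans (sym (map-involutive f)) (trans (map-cong eq) (map-involutive g)) }
        ; surjective = λ y → map-σ y , λ eq → trans (map-cong eq) (map-involutive y) }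
      ; fixesℚ = map-ι
      }

    -- The pullback of forms determines only the ratios of coordinates: `ξ i / ξ 0F` goes to
    -- `η i / η 0F`. The factor μ accounts for the arbitrary scaling of `ξ` in `K`.
    automorphism-ξ : ξ 0F ≉ 0# → ∃[ μ ] μ ≉ 0# × (∀ i → map-σ (ξ i) ≈ μ * η i)
    automorphism-ξ ξ₀≉0 = map-σ (ξ 0F) / η 0F , *-nonzero σξ₀≉0 (⁻¹-nonzero η₀≉0) , λ i → *-cancelˡ-nonzero η₀≉0 (begin
      η 0F * map-σ (ξ i) ≈⟨ *-congˡ (map-cong (/-*-cancel ξ₀≉0)) ⟨
      η 0F * map-σ (ξ i / ξ 0F * ξ 0F) ≈⟨ *-congˡ (map-* (ξ i / ξ 0F) (ξ 0F)) ⟩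
      η 0F * (map-σ (ξ i / ξ 0F) * map-σ (ξ 0F))
        ≈⟨ solve 3 (λ a b c → a ⊗ (b ⊗ c) ⊜ b ⊗ a ⊗ c) (η 0F ∷ map-σ (ξ i / ξ 0F) ∷ map-σ (ξ 0F) ∷ []) ⟩
      map-σ (ξ i / ξ 0F) * η 0F * map-σ (ξ 0F) ≈⟨ *-congʳ (ratio i) ⟩
      η i * map-σ (ξ 0F) ≈⟨ *-congˡ (/-*-cancel η₀≉0) ⟨
      η i * (map-σ (ξ 0F) / η 0F * η 0F)
        ≈⟨ solve 3 (λ a b c → a ⊗ (b ⊗ c) ⊜ c ⊗ (b ⊗ a)) (η i ∷ map-σ (ξ 0F) / η 0F ∷ η 0F ∷ []) ⟩
      η 0F * (map-σ (ξ 0F) / η 0F * η i) ∎)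
      where
      h-var : ∀ i → Homogeneous {3} 1 (var i)
      h-var 0F = ≡.refl ∷ []
      h-var 1F = ≡.refl ∷ []
      h-var 2F = ≡.refl ∷ []
      η≈ : ∀ i → eval (var i) η ≈ η i
      η≈ i = eval-var i η
      η₀≉0 : η 0F ≉ 0#
      η₀≉0 η₀≈0 = ξ₀≉0 (trans (sym (eval-var 0F ξ)) (vanishes⇐ (var 0F) (h-var 0F) (trans (η≈ 0F) η₀≈0)))
      σξ₀≉0 : map-σ (ξ 0F) ≉ 0#
      σξ₀≉0 eq = ξ₀≉0 (trans (sym (map-involutive (ξ 0F)))
        (trans (map-cong eq) (trans (map-cong (sym ι-0)) (trans (map-ι 0ℚ) ι-0))))
      ratio : ∀ i → map-σ (ξ i / ξ 0F) * η 0F ≈ η i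
      ratio i = trans (*-congʳ (map-≈ {y = η i / η 0F} (1 , var i , var 0F , h-var i , h-var 0F ,
        nonzero-cong (sym (eval-var 0F ξ)) ξ₀≉0 ,
        trans (*-congˡ (eval-var 0F ξ)) (trans (/-*-cancel ξ₀≉0) (sym (eval-var i ξ))) ,
        trans (*-congˡ (η≈ 0F)) (trans (/-*-cancel η₀≉0) (sym (η≈ i)))))) (/-*-cancel η₀≉0)

-- Expressions as polynomials and homogeneous forms.

toPoly : ∀ {n} → Expr n → Poly n
toPoly (con z)  = constᴾ (z ℚ./ 1)
toPoly (slot i) = var i
toPoly (a ⊕ b)  = toPoly a +ᴾ toPoly b
toPoly (a ⊗ b)  = toPoly a *ᴾ toPoly b
toPoly (a ⊖ b)  = toPoly a -ᴾ toPoly b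
toPoly (⊝ a)    = constᴾ (ℚ.- 1ℚ) *ᴾ toPoly a
toPoly (a ⊛ k)  = toPoly a ^ᴾ k

-- The degree of a sum is read off its left summand; `isForm` checks that the right one agrees.
degree : ∀ {n} → Expr n → ℕ
degree (con z)  = 0
degree (slot i) = 1
degree (a ⊕ b)  = degree a
degree (a ⊗ b)  = degree a ℕ.+ degree b
degree (a ⊖ b)  = degree a
degree (⊝ a)    = degree a
degree (a ⊛ k)  = k ℕ.* degree a

isForm : ∀ {n} → Expr n → Bool
isForm (con z)  = true
isForm (slot i) = true
isForm (a ⊕ b)  = isForm a ∧ (isForm b ∧ (degree b ℕ.≡ᵇ degree a))
isForm (a ⊗ b)  = isForm a ∧ isForm b
isForm (a ⊖ b)  = isForm a ∧ (isForm b ∧ (degree b ℕ.≡ᵇ degree a))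
isForm (⊝ a)    = isForm a
isForm (a ⊛ k)  = isForm a

∧-elim : ∀ {x y} → T (x ∧ y) → T x × T y
∧-elim = Equivalence.to T-∧

homogeneous-toPoly : ∀ {n} (a : Expr n) → T (isForm a) → Homogeneous (degree a) (toPoly a)
homogeneous-toPoly (con z) _ = homogeneous-const (z ℚ./ 1)
homogeneous-toPoly (slot i) _ = homogeneous-var i ∷ []
  where
  sum-0 : ∀ n → Vec.sum (Vec.replicate n 0) ≡ 0
  sum-0 zero    = ≡.refl
  sum-0 (suc n) = sum-0 n
  homogeneous-var : ∀ {n} (i : Fin n) → Vec.sum (Vec.replicate n 0 Vec.[ i ]≔ 1) ≡ 1
  homogeneous-var {suc n} zero    = ≡.cong suc (sum-0 n)
  homogeneous-var         (suc i) = homogeneous-var i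
homogeneous-toPoly (a ⊕ b) t with ∧-elim t
... | ta , t′ with ∧-elim t′
...   | tb , eq = homogeneous-+ (homogeneous-toPoly a ta)
  (≡.subst (λ d → Homogeneous d (toPoly b)) (ℕ.≡ᵇ⇒≡ _ _ eq) (homogeneous-toPoly b tb))
homogeneous-toPoly (a ⊗ b) t with ∧-elim t
... | ta , tb = homogeneous-* (toPoly a) (toPoly b) (homogeneous-toPoly a ta) (homogeneous-toPoly b tb)
homogeneous-toPoly (a ⊖ b) t with ∧-elim t
... | ta , t′ with ∧-elim t′
...   | tb , eq = homogeneous-- (toPoly a) (toPoly b) (homogeneous-toPoly a ta)
  (≡.subst (λ d → Homogeneous d (toPoly b)) (ℕ.≡ᵇ⇒≡ _ _ eq) (homogeneous-toPoly b tb))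
homogeneous-toPoly (⊝ a) t =
  homogeneous-* (constᴾ (ℚ.- 1ℚ)) (toPoly a) (homogeneous-const (ℚ.- 1ℚ)) (homogeneous-toPoly a t)
homogeneous-toPoly (a ⊛ k) t = homogeneous-^ (toPoly a) k (homogeneous-toPoly a t)

module PolynomialExpressions {c ℓ} (K : FieldOverℚ c ℓ) where
  open FieldOverℚ K
  open Identities K
  open FieldLemmas K

  eval-toPoly : ∀ {n} (a : Expr n) ρ → eval (toPoly a) (lookup ρ) ≈ ⟦ a ⟧ₑ ρ
  eval-toPoly (con z)  ρ = trans (eval-const (z ℚ./ 1) (lookup ρ)) (sym (⟦⟧ᶻ≈ι z))
  eval-toPoly (slot i) ρ = eval-var i (lookup ρ)
  eval-toPoly (a ⊕ b)  ρ = trans (eval-+ (toPoly a) (toPoly b) _) (+-cong (eval-toPoly a ρ) (eval-toPoly b ρ))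
  eval-toPoly (a ⊗ b)  ρ = trans (eval-* (toPoly a) (toPoly b) _) (*-cong (eval-toPoly a ρ) (eval-toPoly b ρ))
  eval-toPoly (a ⊖ b)  ρ =
    trans (eval-- (toPoly a) (toPoly b) _) (+-cong (eval-toPoly a ρ) (-‿cong (eval-toPoly b ρ)))
  eval-toPoly (⊝ a)    ρ = trans (eval-* (constᴾ (ℚ.- 1ℚ)) (toPoly a) _)
    (trans (*-cong (trans (eval-const (ℚ.- 1ℚ) (lookup ρ)) (trans (ι-neg 1ℚ) (-‿cong ι-1))) (eval-toPoly a ρ))
      (solve 1 (λ a → ⊝ κ 1 ⊗ a ⊜ ⊝ a) (⟦ a ⟧ₑ ρ ∷ [])))
  eval-toPoly (a ⊛ k)  ρ = trans (eval-^ (toPoly a) k _) (^-congˡ k (eval-toPoly a ρ))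

  ⟦⟧-cong : ∀ {n} (a : Expr n) {ρ σ} → (∀ i → lookup ρ i ≈ lookup σ i) → ⟦ a ⟧ₑ ρ ≈ ⟦ a ⟧ₑ σ
  ⟦⟧-cong a {ρ} {σ} ρ≈σ = trans (sym (eval-toPoly a ρ)) (trans (eval-cong (toPoly a) ρ≈σ) (eval-toPoly a σ))

  ⟦⟧-cong₁ : ∀ {n} (a : Expr (suc n)) {x y} ρ → x ≈ y → ⟦ a ⟧ₑ (x ∷ ρ) ≈ ⟦ a ⟧ₑ (y ∷ ρ)
  ⟦⟧-cong₁ a ρ x≈y = ⟦⟧-cong a λ { zero → x≈y ; (suc i) → refl }

  ⟦⟧-scale : ∀ {n} (a : Expr n) {_ : T (isForm a)} k {ρ σ} → (∀ i → lookup σ i ≈ k * lookup ρ i) →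
    ⟦ a ⟧ₑ σ ≈ k ^ degree a * ⟦ a ⟧ₑ ρ
  ⟦⟧-scale a {t} k {ρ} {σ} σ≈kρ = trans (sym (eval-toPoly a σ)) (trans (eval-cong (toPoly a) σ≈kρ)
    (trans (eval-scale (toPoly a) (homogeneous-toPoly a t) (lookup ρ) k) (*-congˡ (eval-toPoly a ρ))))

module _ {F : Poly 3} {c ℓ} (C : FunctionField F c ℓ) where
  open FunctionField C
  open Identities fieldOverℚ
  open PolynomialExpressions fieldOverℚ
  open GenericPoint C
  module ℚ-Identities = Identities rational
  module ℚ-Expressions = PolynomialExpressions rational

  module RationalPointExpressions (pt : Vec ℚ 3) (F-pt : evalℚ F (lookup pt) ≡ 0ℚ) where
    open RationalPoint (lookup pt) F-pt public

    nonzero-form : (a : Expr 3) {_ : T (isForm a)} → ℚ-Identities.⟦ a ⟧ₑ pt ≢ 0ℚ →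
      ⟦ a ⟧ₑ (ξ 0F ∷ ξ 1F ∷ ξ 2F ∷ []) ≉ 0#
    nonzero-form a {t} a≢0 aρ≈0 = nonvanishing (toPoly a) (homogeneous-toPoly a t)
      (λ eq → a≢0 (≡.trans (≡.sym (ℚ-Expressions.eval-toPoly a pt)) eq))
      (trans (FieldLemmas.eval-cong fieldOverℚ (toPoly a) λ { 0F → refl ; 1F → refl ; 2F → refl })
        (trans (eval-toPoly a (ξ 0F ∷ ξ 1F ∷ ξ 2F ∷ [])) aρ≈0))

    ↦-expr : ∀ {n} (a : Expr n) {ρ : Vec Carrier n} {s : Vec ℚ n} → (∀ i → lookup ρ i ↦ lookup s i) →
      ⟦ a ⟧ₑ ρ ↦ ℚ-Identities.⟦ a ⟧ₑ s
    ↦-expr (con z)  h = ≡.subst (⟦ z ⟧ᶻ ↦_) (≡.sym (ℚ-Identities.⟦⟧ᶻ≈ι z)) (↦-cong (sym (⟦⟧ᶻ≈ι z)) (↦-ι (z ℚ./ 1)))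
    ↦-expr (slot i) h = h i
    ↦-expr (a ⊕ b)  h = ↦-+ (↦-expr a h) (↦-expr b h)
    ↦-expr (a ⊗ b)  h = ↦-* (↦-expr a h) (↦-expr b h)
    ↦-expr (a ⊖ b)  h = ↦-- (↦-expr a h) (↦-expr b h)
    ↦-expr (⊝ a) {ρ} {s} h = ≡.subst (- ⟦ a ⟧ₑ ρ ↦_) (ℚ.+-identityˡ _)
      (↦-cong (solve 1 (λ a → κ 0 ⊖ a ⊜ ⊝ a) (⟦ a ⟧ₑ ρ ∷ [])) (↦-- (↦-expr (κ 0) {ρ} {s} h) (↦-expr a h)))
    ↦-expr (a ⊛ zero)  {ρ} {s} h = ↦-expr (κ 1) {ρ} {s} h
    ↦-expr (a ⊛ suc k) h = ↦-* (↦-expr a h) (↦-expr (a ⊛ k) h)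

-- The Wiman sextic

eₑ rₑ sexticₑ : ∀ {n} → Expr n → Expr n → Expr n → Expr n
eₑ x y z = x ⊛ 2 ⊗ y ⊛ 2 ⊕ y ⊛ 2 ⊗ z ⊛ 2 ⊕ z ⊛ 2 ⊗ x ⊛ 2
rₑ x y z = x ⊛ 2 ⊕ y ⊛ 2 ⊕ z ⊛ 2
sexticₑ x y z = x ⊛ 6 ⊕ y ⊛ 6 ⊕ z ⊛ 6 ⊕ rₑ x y z ⊗ (x ⊛ 4 ⊕ y ⊛ 4 ⊕ z ⊛ 4) ⊖ κ 12 ⊗ x ⊛ 2 ⊗ y ⊛ 2 ⊗ z ⊛ 2

-- β = N(w)/D(w) for w = e/r².
Nₑ Qₑ Dₑ : ∀ {n} → Expr n → Expr n
Nₑ w = κ 3125 ⊗ (κ 3 ⊗ w ⊖ κ 1) ⊛ 2 ⊗ (w ⊕ κ 5) ⊛ 3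
Qₑ w = ⊝ (κ 75 ⊗ w ⊛ 2) ⊕ κ 1010 ⊗ w ⊕ κ 13
Dₑ w = (κ 5 ⊗ w ⊖ κ 2) ⊗ Qₑ w ⊛ 2

Xₑ Yₑ Zₑ : Expr 3
Xₑ = slot 0F
Yₑ = slot 1F
Zₑ = slot 2F

module WimanBasics {c ℓ} (W̃ : FunctionField wiman c ℓ) where
  open FunctionField W̃
  open Identities fieldOverℚ
  open FieldLemmas fieldOverℚ
  open PolynomialExpressions fieldOverℚ
  open Wiman W̃ using (numerator; denominator; β)
  open import Relation.Binary.Reasoning.Setoid setoid

  Point : Set c
  Point = Fin 3 → Carrier

  coordinates : Point → Vec Carrier 3
  coordinates P = P 0F ∷ P 1F ∷ P 2F ∷ []

  ⟨_⟩ : Expr 3 → Point → Carrier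
  ⟨ a ⟩ P = ⟦ a ⟧ₑ (coordinates P)

  coordinates-lookup : ∀ (P : Point) i → lookup (coordinates P) i ≈ P i
  coordinates-lookup P 0F = refl
  coordinates-lookup P 1F = refl
  coordinates-lookup P 2F = refl

  ⟨⟩-cong : ∀ a {P Q : Point} → (∀ i → P i ≈ Q i) → ⟨ a ⟩ P ≈ ⟨ a ⟩ Q
  ⟨⟩-cong a {P} {Q} P≈Q = ⟦⟧-cong a {coordinates P} {coordinates Q}
    λ { 0F → P≈Q 0F ; 1F → P≈Q 1F ; 2F → P≈Q 2F }

  eval-form : ∀ a (P : Point) → eval (toPoly a) P ≈ ⟨ a ⟩ P
  eval-form a P = trans (eval-cong (toPoly a) (λ i → sym (coordinates-lookup P i))) (eval-toPoly a (coordinates P))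

  e r sextic : Point → Carrier
  e = ⟨ eₑ Xₑ Yₑ Zₑ ⟩
  r = ⟨ rₑ Xₑ Yₑ Zₑ ⟩
  sextic = ⟨ sexticₑ Xₑ Yₑ Zₑ ⟩

  eval-wiman : ∀ P → eval wiman P ≈ sextic P
  eval-wiman = eval-form (sexticₑ Xₑ Yₑ Zₑ)

  N Q D : Carrier → Carrier
  N w = ⟦ Nₑ (slot 0F) ⟧ₑ (w ∷ [])
  Q w = ⟦ Qₑ (slot 0F) ⟧ₑ (w ∷ [])
  D w = ⟦ Dₑ (slot 0F) ⟧ₑ (w ∷ [])

  expr-cong : ∀ (a : Expr 1) {x y} → x ≈ y → ⟦ a ⟧ₑ (x ∷ []) ≈ ⟦ a ⟧ₑ (y ∷ [])
  expr-cong a = ⟦⟧-cong₁ a []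

  -- The singular points (1:1:1), (1:-1:1) and (1:1:-1) are convenient for
  -- showing that a function does not vanish identically.
  module At₁ = RationalPointExpressions W̃ (1ℚ ∷ 1ℚ ∷ 1ℚ ∷ []) ≡.refl
  module At₂ = RationalPointExpressions W̃ (1ℚ ∷ ℚ.- 1ℚ ∷ 1ℚ ∷ []) ≡.refl
  module At₃ = RationalPointExpressions W̃ (1ℚ ∷ 1ℚ ∷ ℚ.- 1ℚ ∷ []) ≡.refl

  private
    X = ξ 0F
    Y = ξ 1F
    Z = ξ 2F

  ξ-nonzero : ∀ i → ξ i ≉ 0#
  ξ-nonzero 0F = At₁.nonzero-form Xₑ λ ()
  ξ-nonzero 1F = At₁.nonzero-form Yₑ λ ()
  ξ-nonzero 2F = At₁.nonzero-form Zₑ λ ()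

  r-nonzero : r ξ ≉ 0#
  r-nonzero = At₁.nonzero-form (rₑ Xₑ Yₑ Zₑ) λ ()

  -- X² - Y² vanishes at all four nodes, but each of its linear factors is nonzero at one of them.
  X²-Y²-nonzero : X ^ 2 - Y ^ 2 ≉ 0#
  X²-Y²-nonzero = nonzero-cong (solve 2 (λ x y → (x ⊖ y) ⊗ (x ⊕ y) ⊜ x ⊛ 2 ⊖ y ⊛ 2) (X ∷ Y ∷ []))
    (*-nonzero (At₂.nonzero-form (Xₑ ⊖ Yₑ) λ ()) (At₁.nonzero-form (Xₑ ⊕ Yₑ) λ ()))

  X²-Z²-nonzero : X ^ 2 - Z ^ 2 ≉ 0#
  X²-Z²-nonzero = nonzero-cong (solve 2 (λ x y → (x ⊖ y) ⊗ (x ⊕ y) ⊜ x ⊛ 2 ⊖ y ⊛ 2) (X ∷ Z ∷ []))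
    (*-nonzero (At₃.nonzero-form (Xₑ ⊖ Zₑ) λ ()) (At₁.nonzero-form (Xₑ ⊕ Zₑ) λ ()))

  Y²-Z²-nonzero : Y ^ 2 - Z ^ 2 ≉ 0#
  Y²-Z²-nonzero = nonzero-cong (solve 2 (λ x y → (x ⊖ y) ⊗ (x ⊕ y) ⊜ x ⊛ 2 ⊖ y ⊛ 2) (Y ∷ Z ∷ []))
    (*-nonzero (At₃.nonzero-form (Yₑ ⊖ Zₑ) λ ()) (At₁.nonzero-form (Yₑ ⊕ Zₑ) λ ()))

  sextic-ξ : sextic ξ ≈ 0#
  sextic-ξ = trans (sym (eval-wiman ξ)) (Equivalence.from (vanishing wiman
    (homogeneous-toPoly (sexticₑ Xₑ Yₑ Zₑ) tt)) (constᴾ 1ℚ , λ e → ≡.cong (λ p → coeff p e) (≡.sym (constᴾ-1-* wiman))))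

  w : Carrier
  w = e ξ / r ξ ^ 2

  w-r² : w * r ξ ^ 2 ≈ e ξ
  w-r² = /-*-cancel (^-nonzero 2 r-nonzero)

  -- At (1:1:1) both e and r are 3. This value settles the nonvanishing of every factor of N, D and
  -- N - D apart from 3w - 1, which is treated separately.
  w↦⅓ : w At₁.↦ (+ 1 ℚ./ 3)
  w↦⅓ = At₁.regular (4 , toPoly (eₑ Xₑ Yₑ Zₑ) , toPoly (rₑ Xₑ Yₑ Zₑ ⊛ 2) ,
    homogeneous-toPoly (eₑ Xₑ Yₑ Zₑ) tt , homogeneous-toPoly (rₑ Xₑ Yₑ Zₑ ⊛ 2) tt , (λ ()) , ≡.refl ,
    trans (*-congˡ (eval-form (rₑ Xₑ Yₑ Zₑ ⊛ 2) ξ)) (trans w-r² (sym (eval-form (eₑ Xₑ Yₑ Zₑ) ξ))))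

  expr-w-nonzero : (a : Expr 1) → Identities.⟦_⟧ₑ rational a ((+ 1 ℚ./ 3) ∷ []) ≢ 0ℚ → ⟦ a ⟧ₑ (w ∷ []) ≉ 0#
  expr-w-nonzero a a≢0 = At₁.↦-nonzero (At₁.↦-expr a {w ∷ []} {(+ 1 ℚ./ 3) ∷ []} λ { 0F → w↦⅓ }) a≢0

  D-nonzero : D w ≉ 0#
  D-nonzero = expr-w-nonzero (Dₑ (slot 0F)) λ ()

  Q-nonzero : Q w ≉ 0#
  Q-nonzero = expr-w-nonzero (Qₑ (slot 0F)) λ ()

  w+5-nonzero : w + # 5 ≉ 0#
  w+5-nonzero = expr-w-nonzero (slot 0F ⊕ κ 5) λ ()

  25w-19-nonzero : # 25 * w - # 19 ≉ 0#
  25w-19-nonzero = expr-w-nonzero (κ 25 ⊗ slot 0F ⊖ κ 19) λ ()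

  -- If 3 e = r² then X², Y² and Z² are the roots of (3 T − r)³ = 0.
  3w-1-nonzero : # 3 * w - 1# ≉ 0#
  3w-1-nonzero 3w-1≈0 = X²-Y²-nonzero (x≈y⇒x-y≈0 (*-cancelˡ-nonzero (#-nonzero 2)
    (trans (root X (solve 3 (λ x y z → cubeₑ x x y z) (X ∷ Y ∷ Z ∷ [])))
      (sym (root Y (solve 3 (λ x y z → cubeₑ y x y z) (X ∷ Y ∷ Z ∷ [])))))))
    where
    δ : Carrier
    δ = # 3 * e ξ - r ξ ^ 2
    -- In symmetric functions the sextic is 2r³ - 5re - 9X²Y²Z². For a root T of T³ - rT² + eT -
    -- X²Y²Z² one has (3T - r)³ = 27X²Y²Z² - 27eT + 9r²T - r³, and eliminating X²Y²Z² leaves a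
    -- multiple of 3e - r².
    cubeₑ : Expr 3 → Expr 3 → Expr 3 → Expr 3 → Expr 3 × Expr 3
    cubeₑ a x y z = (κ 3 ⊗ a ⊛ 2 ⊖ rₑ x y z) ⊛ 3 ⊜
      ⊝ ((κ 9 ⊗ a ⊛ 2 ⊕ κ 5 ⊗ rₑ x y z) ⊗ (κ 3 ⊗ eₑ x y z ⊖ rₑ x y z ⊛ 2)) ⊖ κ 3 ⊗ sexticₑ x y z
    δ≈0 : δ ≈ 0#
    δ≈0 = begin
      # 3 * e ξ - r ξ ^ 2 ≈⟨ +-congʳ (*-congˡ w-r²) ⟨
      # 3 * (w * r ξ ^ 2) - r ξ ^ 2
        ≈⟨ solve 2 (λ w r → κ 3 ⊗ (w ⊗ r ⊛ 2) ⊖ r ⊛ 2 ⊜ (κ 3 ⊗ w ⊖ κ 1) ⊗ r ⊛ 2) (w ∷ r ξ ∷ []) ⟩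
      (# 3 * w - 1#) * r ξ ^ 2 ≈⟨ trans (*-congʳ 3w-1≈0) (zeroˡ _) ⟩
      0# ∎
    root : ∀ x → (# 3 * x ^ 2 - r ξ) ^ 3 ≈ - ((# 9 * x ^ 2 + # 5 * r ξ) * δ) - # 3 * sextic ξ →
      # 3 * x ^ 2 ≈ r ξ
    root x cube with (# 3 * x ^ 2 - r ξ) ≟ 0#
    ... | yes eq = x-y≈0⇒x≈y _ _ eq
    ... | no  ≉0 = ⊥-elim (^-nonzero 3 ≉0 (begin
      (# 3 * x ^ 2 - r ξ) ^ 3 ≈⟨ cube ⟩
      - ((# 9 * x ^ 2 + # 5 * r ξ) * δ) - # 3 * sextic ξ
        ≈⟨ +-cong (-‿cong (*-congˡ δ≈0)) (-‿cong (*-congˡ sextic-ξ)) ⟩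
      - ((# 9 * x ^ 2 + # 5 * r ξ) * 0#) - # 3 * 0#
        ≈⟨ solve 1 (λ a → ⊝ (a ⊗ κ 0) ⊖ κ 3 ⊗ κ 0 ⊜ κ 0) (# 9 * x ^ 2 + # 5 * r ξ ∷ []) ⟩
      0# ∎))

  r⁻¹ : Carrier
  r⁻¹ = r ξ ⁻¹

  r²⁻¹ : (r ξ ^ 2) ⁻¹ ≈ r⁻¹ ^ 2
  r²⁻¹ = sym (⁻¹-unique (begin
    r ξ ^ 2 * r⁻¹ ^ 2
      ≈⟨ solve 2 (λ r i → r ⊛ 2 ⊗ i ⊛ 2 ⊜ (r ⊗ i) ⊛ 2) (r ξ ∷ r⁻¹ ∷ []) ⟩
    (r ξ * r⁻¹) ^ 2 ≈⟨ ^-congˡ 2 (⁻¹-inverseʳ r-nonzero) ⟩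
    1# ^ 2 ≈⟨ solve 0 (κ 1 ⊛ 2 ⊜ κ 1) [] ⟩
    1# ∎))

  numerator≈N : numerator ≈ N w
  numerator≈N = solve 2 (λ e i → κ 3125 ⊗ (κ 3 ⊗ e ⊗ i ⊖ κ 1) ⊛ 2 ⊗ (e ⊗ i ⊕ κ 5) ⊛ 3 ⊜ Nₑ (e ⊗ i))
    (e ξ ∷ (r ξ ^ 2) ⁻¹ ∷ [])

  denominator≈D : denominator ≈ D w
  denominator≈D = begin
    denominator
      ≈⟨ *-congˡ (^-congˡ 2 (+-congʳ (+-congʳ (-‿cong (*-congˡ r⁴⁻¹))))) ⟩
    (# 5 * e ξ / r ξ ^ 2 - # 2) *
      (- (# 75 * e ξ ^ 2 * ((r ξ ^ 2) ⁻¹) ^ 2) + # 1010 * e ξ / r ξ ^ 2 + # 13) ^ 2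
      ≈⟨ solve 2 (λ e i → (κ 5 ⊗ e ⊗ i ⊖ κ 2) ⊗ (⊝ (κ 75 ⊗ e ⊛ 2 ⊗ i ⊛ 2) ⊕ κ 1010 ⊗ e ⊗ i ⊕ κ 13) ⊛ 2 ⊜ Dₑ (e ⊗ i))
           (e ξ ∷ (r ξ ^ 2) ⁻¹ ∷ []) ⟩
    D w ∎
    where
    r⁴⁻¹ : (r ξ ^ 4) ⁻¹ ≈ ((r ξ ^ 2) ⁻¹) ^ 2
    r⁴⁻¹ = sym (⁻¹-unique (begin
      r ξ ^ 4 * ((r ξ ^ 2) ⁻¹) ^ 2
        ≈⟨ solve 2 (λ r i → r ⊛ 4 ⊗ i ⊛ 2 ⊜ (r ⊛ 2 ⊗ i) ⊛ 2) (r ξ ∷ (r ξ ^ 2) ⁻¹ ∷ []) ⟩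
      (r ξ ^ 2 * (r ξ ^ 2) ⁻¹) ^ 2 ≈⟨ ^-congˡ 2 (⁻¹-inverseʳ (^-nonzero 2 r-nonzero)) ⟩
      1# ^ 2 ≈⟨ solve 0 (κ 1 ⊛ 2 ⊜ κ 1) [] ⟩
      1# ∎))

  denominator-nonzero : denominator ≉ 0#
  denominator-nonzero = nonzero-cong (sym denominator≈D) D-nonzero

  β-D : β * D w ≈ N w
  β-D = trans (*-congˡ (sym denominator≈D)) (trans (/-*-cancel denominator-nonzero) numerator≈N)

  N-nonzero : N w ≉ 0#
  N-nonzero = *-nonzero (*-nonzero (#-nonzero 3124) (^-nonzero 2 3w-1-nonzero)) (^-nonzero 3 w+5-nonzero)

  β-nonzero : β ≉ 0#
  β-nonzero = nonzero-*ˡ (nonzero-cong (sym β-D) N-nonzero)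

  β-1-D : (β - 1#) * D w ≈ # 3 * (# 25 * w - # 19) ^ 4
  β-1-D = begin
    (β - 1#) * D w ≈⟨ solve 2 (λ b d → (b ⊖ κ 1) ⊗ d ⊜ b ⊗ d ⊖ d) (β ∷ D w ∷ []) ⟩
    β * D w - D w ≈⟨ +-congʳ β-D ⟩
    N w - D w ≈⟨ solve 1 (λ w → Nₑ w ⊖ Dₑ w ⊜ κ 3 ⊗ (κ 25 ⊗ w ⊖ κ 19) ⊛ 4) (w ∷ []) ⟩
    # 3 * (# 25 * w - # 19) ^ 4 ∎

  β-1-nonzero : β - 1# ≉ 0#
  β-1-nonzero = nonzero-*ˡ (nonzero-cong (sym β-1-D) (*-nonzero (#-nonzero 2) (^-nonzero 4 25w-19-nonzero)))

  -- The numerator has the factor (3w - 1)², which vanishes at w = 1/3, while D(1/3) is nonzero.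
  β↦0 : β At₁.↦ 0ℚ
  β↦0 = At₁.↦-zero-/
    (At₁.↦-cong (sym numerator≈N) (At₁.↦-expr (Nₑ (slot 0F)) {w ∷ []} {(+ 1 ℚ./ 3) ∷ []} λ { 0F → w↦⅓ }))
    (At₁.↦-cong (sym denominator≈D) (At₁.↦-expr (Dₑ (slot 0F)) {w ∷ []} {(+ 1 ℚ./ 3) ∷ []} λ { 0F → w↦⅓ }))
    λ ()

  -- β vanishes at a rational point but is not the zero function, so p(β) = 0
  -- forces p(0) = 0, and then p(t)/t is another equation of β.
  β-transcendental : ∀ (p : Poly 1) → eval p (λ _ → β) ≈ 0# → p ≋ []
  β-transcendental p pβ≈0 (k ∷ []) = coefficient k p pβ≈0
    where
    eval-↦ : ∀ p → eval p (λ _ → β) At₁.↦ coeff p (0 ∷ [])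
    eval-↦ [] = At₁.↦-cong ι-0 (At₁.↦-ι 0ℚ)
    eval-↦ ((a , zero ∷ []) ∷ p) =
      At₁.↦-+ (At₁.↦-cong (solve 1 (λ a → a ⊜ a ⊗ (κ 1 ⊗ κ 1)) (ι a ∷ [])) (At₁.↦-ι a)) (eval-↦ p)
    eval-↦ ((a , suc k ∷ []) ∷ p) =
      ≡.subst (ι a * (β ^ suc k * 1#) + eval p (λ _ → β) At₁.↦_) (ℚ.+-identityˡ (coeff p (0 ∷ [])))
        (At₁.↦-+ vanishing-term (eval-↦ p))
      where
      β^ : ∀ k → ∃[ b ] β ^ k At₁.↦ b
      β^ zero    = 1ℚ , At₁.↦-cong ι-1 (At₁.↦-ι 1ℚ)
      β^ (suc k) = _ , At₁.↦-* β↦0 (proj₂ (β^ k))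
      vanishing-term : ι a * (β ^ suc k * 1#) At₁.↦ 0ℚ
      vanishing-term = ≡.subst (ι a * (β ^ suc k * 1#) At₁.↦_) (ℚ.*-zeroˡ (a ℚ.* proj₁ (β^ k)))
        (At₁.↦-cong (solve 3 (λ a b c → b ⊗ (a ⊗ c) ⊜ a ⊗ (b ⊗ c ⊗ κ 1)) (ι a ∷ β ∷ β ^ k ∷ []))
          (At₁.↦-* β↦0 (At₁.↦-* (At₁.↦-ι a) (proj₂ (β^ k)))))

    eval-shift : ∀ p → eval p (λ _ → β) ≈ ι (coeff p (0 ∷ [])) + β * eval (shift p) (λ _ → β)
    eval-shift [] = sym (trans (+-cong ι-0 (zeroʳ β)) (+-identityˡ 0#))
    eval-shift ((a , zero ∷ []) ∷ p) = begin
      ι a * (1# * 1#) + eval p (λ _ → β) ≈⟨ +-congˡ (eval-shift p) ⟩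
      ι a * (1# * 1#) + (ι (coeff p (0 ∷ [])) + β * eval (shift p) (λ _ → β))
        ≈⟨ solve 3 (λ a c s → a ⊗ (κ 1 ⊗ κ 1) ⊕ (c ⊕ s) ⊜ a ⊕ c ⊕ s)
             (ι a ∷ ι (coeff p (0 ∷ [])) ∷ β * eval (shift p) (λ _ → β) ∷ []) ⟩
      ι a + ι (coeff p (0 ∷ [])) + β * eval (shift p) (λ _ → β) ≈⟨ +-congʳ (ι-+ a _) ⟨
      _ ∎
    eval-shift ((a , suc k ∷ []) ∷ p) = begin
      ι a * (β * β ^ k * 1#) + eval p (λ _ → β) ≈⟨ +-congˡ (eval-shift p) ⟩
      ι a * (β * β ^ k * 1#) + (ι (coeff p (0 ∷ [])) + β * eval (shift p) (λ _ → β))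
        ≈⟨ solve 5 (λ a b k c s → a ⊗ (b ⊗ k ⊗ κ 1) ⊕ (c ⊕ b ⊗ s) ⊜ c ⊕ b ⊗ (a ⊗ (k ⊗ κ 1) ⊕ s))
             (ι a ∷ β ∷ β ^ k ∷ ι (coeff p (0 ∷ [])) ∷ eval (shift p) (λ _ → β) ∷ []) ⟩
      _ ∎

    constant-term : ∀ p → eval p (λ _ → β) ≈ 0# → coeff p (0 ∷ []) ≡ 0ℚ
    constant-term p pβ≈0 = decidable-stable (coeff p (0 ∷ []) ℚ.≟ 0ℚ) λ ≢0 → At₁.↦-nonzero (eval-↦ p) ≢0 pβ≈0

    coefficient : ∀ k p → eval p (λ _ → β) ≈ 0# → coeff p (k ∷ []) ≡ 0ℚ
    coefficient zero    p pβ≈0 = constant-term p pβ≈0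
    coefficient (suc k) p pβ≈0 = ≡.trans (≡.sym (coeff-shift p k)) (coefficient k (shift p)
      (*-zero-product (begin
        β * eval (shift p) (λ _ → β) ≈⟨ +-identityˡ _ ⟨
        0# + β * eval (shift p) (λ _ → β)
          ≈⟨ +-congʳ (trans (ι-cong (constant-term p pβ≈0)) ι-0) ⟨
        ι (coeff p (0 ∷ [])) + β * eval (shift p) (λ _ → β) ≈⟨ eval-shift p ⟨
        eval p (λ _ → β) ≈⟨ pβ≈0 ⟩
        0# ∎) β-nonzero))

  τ : Fin 3 → Carrier
  τ i = ξ i ^ 2 / r ξ

  τ-sum : τ 0F + τ 1F + τ 2F ≈ 1#
  τ-sum = trans (solve 4 (λ x y z i → x ⊛ 2 ⊗ i ⊕ y ⊛ 2 ⊗ i ⊕ z ⊛ 2 ⊗ i ⊜ rₑ x y z ⊗ i) (X ∷ Y ∷ Z ∷ r⁻¹ ∷ []))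
    (⁻¹-inverseʳ r-nonzero)

  τ-e₂ : τ 0F * τ 1F + τ 1F * τ 2F + τ 2F * τ 0F ≈ w
  τ-e₂ = trans (solve 4 (λ x y z i →
      x ⊛ 2 ⊗ i ⊗ (y ⊛ 2 ⊗ i) ⊕ y ⊛ 2 ⊗ i ⊗ (z ⊛ 2 ⊗ i) ⊕ z ⊛ 2 ⊗ i ⊗ (x ⊛ 2 ⊗ i) ⊜ eₑ x y z ⊗ i ⊛ 2)
      (X ∷ Y ∷ Z ∷ r⁻¹ ∷ []))
    (*-congˡ (sym r²⁻¹))

  -- The sextic, written as 2r³ - 5re - 9X²Y²Z² and divided by r³.
  τ-e₃ : # 9 * (τ 0F * τ 1F * τ 2F) ≈ # 2 - # 5 * w
  τ-e₃ = begin
    # 9 * (τ 0F * τ 1F * τ 2F)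
      ≈⟨ solve 4 (λ x y z i →
           κ 9 ⊗ (x ⊛ 2 ⊗ i ⊗ (y ⊛ 2 ⊗ i) ⊗ (z ⊛ 2 ⊗ i)) ⊜
           κ 2 ⊗ (rₑ x y z ⊗ i) ⊛ 3 ⊖ κ 5 ⊗ (rₑ x y z ⊗ i) ⊗ (eₑ x y z ⊗ i ⊛ 2) ⊖ sexticₑ x y z ⊗ i ⊛ 3)
           (X ∷ Y ∷ Z ∷ r⁻¹ ∷ []) ⟩
    # 2 * (r ξ * r⁻¹) ^ 3 - # 5 * (r ξ * r⁻¹) * (e ξ * r⁻¹ ^ 2) - sextic ξ * r⁻¹ ^ 3
      ≈⟨ +-cong (+-cong (*-congˡ (^-congˡ 3 ri≈1)) (-‿cong (*-cong (*-congˡ ri≈1) (*-congˡ (sym r²⁻¹)))))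
           (-‿cong (*-congʳ sextic-ξ)) ⟩
    # 2 * 1# ^ 3 - # 5 * 1# * w - 0# * r⁻¹ ^ 3
      ≈⟨ solve 2 (λ w i → κ 2 ⊗ κ 1 ⊛ 3 ⊖ κ 5 ⊗ κ 1 ⊗ w ⊖ κ 0 ⊗ i ⊜ κ 2 ⊖ κ 5 ⊗ w) (w ∷ r⁻¹ ^ 3 ∷ []) ⟩
    # 2 - # 5 * w ∎
    where
    ri≈1 : r ξ * r⁻¹ ≈ 1#
    ri≈1 = ⁻¹-inverseʳ r-nonzero

-- The symmetric correspondence between w and w∘h for the Cremona involution h
-- below: (w − v) M(w, v) = (N(w) D(v) − N(v) D(w)) / 9375, in homogeneous
-- coordinates w = e/s and v = f/t.
Mₑ : ∀ {n} → Expr n → Expr n → Expr n → Expr n → Expr n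
Mₑ {n} e s f t =
    e ⊛ 4 ⊗             row (con (ℤ.- + 3515625)) (κ 10687500) (con (ℤ.- + 12183750)) (κ 6173100) (con (ℤ.- + 1172889))
  ⊕ e ⊛ 3 ⊗ s ⊗         row (κ 10687500) (κ 369910000) (κ 101070600) (con (ℤ.- + 176363664)) (κ 32016716)
  ⊕ e ⊛ 2 ⊗ (s ⊛ 2) ⊗   row (con (ℤ.- + 12183750)) (κ 101070600) (con (ℤ.- + 1789036164)) (κ 1235516616) (con (ℤ.- + 224805606))
  ⊕ e ⊗ (s ⊛ 3) ⊗       row (κ 6173100) (con (ℤ.- + 176363664)) (κ 1235516616) (con (ℤ.- + 665315856)) (κ 79297260)
  ⊕ s ⊛ 4 ⊗             row (con (ℤ.- + 1172889)) (κ 32016716) (con (ℤ.- + 224805606)) (κ 79297260) (κ 2229175)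
  where
  row : Expr n → Expr n → Expr n → Expr n → Expr n → Expr n
  row a b c d g = a ⊗ f ⊛ 4 ⊕ b ⊗ f ⊛ 3 ⊗ t ⊕ c ⊗ f ⊛ 2 ⊗ t ⊛ 2 ⊕ d ⊗ f ⊗ t ⊛ 3 ⊕ g ⊗ t ⊛ 4

triple : ∀ {a} {A : Set a} → A → A → A → Fin 3 → A
triple x y z 0F = x
triple x y z 1F = y
triple x y z 2F = z

flipₑ : Fin 3 → Fin 3 → Expr 3
flipₑ i j = if does (i Fin.≟ j) then ⊝ slot j else slot j

-- In the coordinates a = Y + Z, b = X + Z, c = X + Y this is the standard
-- Cremona involution (a : b : c) ↦ (bc : ca : ab).
cremonaₑ : Fin 3 → Expr 3
cremonaₑ = triple (⊝ (b ⊗ c) ⊕ c ⊗ a ⊕ a ⊗ b) (b ⊗ c ⊖ c ⊗ a ⊕ a ⊗ b) (b ⊗ c ⊕ c ⊗ a ⊖ a ⊗ b)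
  where
  a b c : Expr 3
  a = Yₑ ⊕ Zₑ
  b = Xₑ ⊕ Zₑ
  c = Xₑ ⊕ Yₑ

-- Involutions of the sextic and their action on functions of degree zero.

module WimanSymmetries {c ℓ} (W̃ : FunctionField wiman c ℓ) where
  open FunctionField W̃
  open Curve W̃ using (Automorphism; ⟦_⟧; _∘ₐ_)
  open Identities fieldOverℚ
  open FieldLemmas fieldOverℚ
  open PolynomialExpressions fieldOverℚ
  open GenericPoint W̃
  open WimanBasics W̃
  open import Relation.Binary.Reasoning.Setoid setoid

  private
    X = ξ 0F
    Y = ξ 1F
    Z = ξ 2F

  act : (Fin 3 → Expr 3) → Point → Point
  act g P i = ⟨ g i ⟩ P

  Induces : Automorphism → Point → Set (c ⊔ ℓ)
  Induces σ P = ∃[ μ ] μ ≉ 0# × (∀ i → ⟦ σ ⟧ (ξ i) ≈ μ * P i)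

  ⟨⟩-scale : ∀ a {_ : T (isForm a)} k {P P′ : Point} → (∀ i → P′ i ≈ k * P i) → ⟨ a ⟩ P′ ≈ k ^ degree a * ⟨ a ⟩ P
  ⟨⟩-scale a {t} k {P} {P′} eq = ⟦⟧-scale a {t} k {coordinates P} {coordinates P′}
    λ { 0F → eq 0F ; 1F → eq 1F ; 2F → eq 2F }

  σ-⟨⟩ : ∀ σ a {_ : T (isForm a)} {P μ} → (∀ i → ⟦ σ ⟧ (ξ i) ≈ μ * P i) → ⟦ σ ⟧ (⟨ a ⟩ ξ) ≈ μ ^ degree a * ⟨ a ⟩ P
  σ-⟨⟩ σ a {t} {P} {μ} ind =
    trans (AutomorphismLemmas.σ-expr σ a (coordinates ξ)) (⟨⟩-scale a {t} μ {P} {λ i → ⟦ σ ⟧ (ξ i)} ind)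

  -- `P` represents the image of `ξ` only up to a factor μ, whose powers cancel because numerator
  -- and denominator have the same degree.
  fraction-image : ∀ {σ P} p q {_ : T (isForm p)} {_ : T (isForm q)} → degree p ≡ degree q → Induces σ P →
    ⟨ q ⟩ ξ ≉ 0# → ∀ {y} → y * ⟨ q ⟩ ξ ≈ ⟨ p ⟩ ξ → ⟨ q ⟩ P ≉ 0# × ⟦ σ ⟧ y * ⟨ q ⟩ P ≈ ⟨ p ⟩ P
  fraction-image {σ} {P} p q {tp} {tq} deg (μ , μ≉0 , ind) q≉0 {y} eq =
    nonzero-*ʳ (nonzero-cong (σ-⟨⟩ σ q {tq} {P} ind) (σ-nonzero q≉0)) ,
    *-cancelˡ-nonzero (^-nonzero (degree q) μ≉0) (begin
      μ ^ degree q * (⟦ σ ⟧ y * ⟨ q ⟩ P)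
        ≈⟨ solve 3 (λ m y q → m ⊗ (y ⊗ q) ⊜ y ⊗ (m ⊗ q)) (μ ^ degree q ∷ ⟦ σ ⟧ y ∷ ⟨ q ⟩ P ∷ []) ⟩
      ⟦ σ ⟧ y * (μ ^ degree q * ⟨ q ⟩ P) ≈⟨ *-congˡ (σ-⟨⟩ σ q {tq} {P} ind) ⟨
      ⟦ σ ⟧ y * ⟦ σ ⟧ (⟨ q ⟩ ξ) ≈⟨ σ-* y (⟨ q ⟩ ξ) ⟨
      ⟦ σ ⟧ (y * ⟨ q ⟩ ξ) ≈⟨ ⟦σ⟧-cong eq ⟩
      ⟦ σ ⟧ (⟨ p ⟩ ξ) ≈⟨ σ-⟨⟩ σ p {tp} {P} ind ⟩
      μ ^ degree p * ⟨ p ⟩ P ≡⟨ ≡.cong (λ d → μ ^ d * ⟨ p ⟩ P) deg ⟩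
      μ ^ degree q * ⟨ p ⟩ P ∎)
    where open AutomorphismLemmas σ renaming (⟦⟧-cong to ⟦σ⟧-cong)

  w-image : ∀ {σ P} → Induces σ P → r P ≉ 0# × ⟦ σ ⟧ w * r P ^ 2 ≈ e P
  w-image {σ} {P} ind =
    (λ r≈0 → proj₁ image (trans (*-congʳ r≈0) (zeroˡ _))) , proj₂ image
    where
    image : r P ^ 2 ≉ 0# × ⟦ σ ⟧ w * r P ^ 2 ≈ e P
    image = fraction-image {σ} {P} (eₑ Xₑ Yₑ Zₑ) (rₑ Xₑ Yₑ Zₑ ⊛ 2) ≡.refl ind (^-nonzero 2 r-nonzero) w-r²

  w-unique : ∀ {σ P} → Induces σ P → ∀ {y} → y * r P ^ 2 ≈ e P → ⟦ σ ⟧ w ≈ y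
  w-unique {σ} {P} ind {y} eq = *-cancelˡ-nonzero (^-nonzero 2 (proj₁ (w-image {σ} {P} ind)))
    (trans (*-comm _ _) (trans (trans (proj₂ (w-image {σ} {P} ind)) (sym eq)) (*-comm _ _)))

  -- The points may differ by more than the scaling `k`. Sign changes and permutations preserve r
  -- and e, so automorphisms that agree up to these have the same effect on `w`.
  w-compare : ∀ {σ τ P P′} → Induces σ P → Induces τ P′ → ∀ k → r P ≈ k ^ 2 * r P′ → e P ≈ k ^ 4 * e P′ →
    ⟦ σ ⟧ w ≈ ⟦ τ ⟧ w
  w-compare {σ} {τ} {P} {P′} indσ indτ k r≈ e≈ = w-unique {σ} {P} indσ (begin
    ⟦ τ ⟧ w * r P ^ 2 ≈⟨ *-congˡ (^-congˡ 2 r≈) ⟩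
    ⟦ τ ⟧ w * (k ^ 2 * r P′) ^ 2
      ≈⟨ solve 3 (λ w k r → w ⊗ (k ⊛ 2 ⊗ r) ⊛ 2 ⊜ k ⊛ 4 ⊗ (w ⊗ r ⊛ 2)) (⟦ τ ⟧ w ∷ k ∷ r P′ ∷ []) ⟩
    k ^ 4 * (⟦ τ ⟧ w * r P′ ^ 2) ≈⟨ *-congˡ (proj₂ (w-image {τ} {P′} indτ)) ⟩
    k ^ 4 * e P′ ≈⟨ e≈ ⟨
    e P ∎)

  -- An automorphism commutes with the polynomial map `g`, so σ(g(ξ)) = g(σ(ξ)): the map of the
  -- inner automorphism is applied last to points.
  induces-∘ : ∀ {σ τ P} g {d} → (∀ i → T (isForm (g i)) × degree (g i) ≡ d) →
    Induces σ P → Induces τ (act g ξ) → Induces (σ ∘ₐ τ) (act g P)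
  induces-∘ {σ} {τ} {P} g {d} forms (μ , μ≉0 , indσ) (ν , ν≉0 , indτ) =
    ⟦ σ ⟧ ν * μ ^ d , *-nonzero (σ-nonzero ν≉0) (^-nonzero d μ≉0) , λ i → begin
      ⟦ σ ⟧ (⟦ τ ⟧ (ξ i)) ≈⟨ ⟦σ⟧-cong (indτ i) ⟩
      ⟦ σ ⟧ (ν * act g ξ i) ≈⟨ σ-* ν (act g ξ i) ⟩
      ⟦ σ ⟧ ν * ⟦ σ ⟧ (act g ξ i) ≈⟨ *-congˡ (σ-⟨⟩ σ (g i) {proj₁ (forms i)} {P} indσ) ⟩
      ⟦ σ ⟧ ν * (μ ^ degree (g i) * act g P i)
        ≡⟨ ≡.cong (λ d → ⟦ σ ⟧ ν * (μ ^ d * act g P i)) (proj₂ (forms i)) ⟩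
      ⟦ σ ⟧ ν * (μ ^ d * act g P i) ≈⟨ *-assoc _ _ _ ⟨
      ⟦ σ ⟧ ν * μ ^ d * act g P i ∎
    where open AutomorphismLemmas σ renaming (⟦⟧-cong to ⟦σ⟧-cong)

  -- Only involutions are constructed directly (sign changes, transpositions and `cremona`); the
  -- other automorphisms used are composites of them.
  record Symmetry (g : Fin 3 → Expr 3) : Set (c ⊔ ℓ) where
    field
      {d}        : ℕ
      forms      : ∀ i → T (isForm (g i)) × degree (g i) ≡ d
      σ          : Automorphism
      induces    : Induces σ (act g ξ)
      involutive : ∀ f → ⟦ σ ⟧ (⟦ σ ⟧ f) ≈ f

  symmetry : ∀ g {d} → (∀ i → T (isForm (g i)) × degree (g i) ≡ d) → sextic (act g ξ) ≈ 0# →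
    ∀ {k} → k ≉ 0# → (∀ i → act g (act g ξ) i ≈ k * ξ i) → Symmetry g
  symmetry g {d} forms curve {k} k≉0 twice = record
    { forms = forms ; σ = automorphism ; involutive = map-involutive
    ; induces = μ , μ≉0 , λ i → trans (ind i) (*-congˡ (eval-form (g i) ξ)) }
    where
    η : Point
    η i = eval (toPoly (g i)) ξ
    point : ∀ i → η i ≈ act g ξ i
    point i = eval-form (g i) ξ
    open Involution {d = d} (toPoly ∘ g)
      (λ i → ≡.subst (λ d → Homogeneous d (toPoly (g i))) (proj₂ (forms i)) (homogeneous-toPoly (g i) (proj₁ (forms i))))
      (trans (eval-wiman η) (trans (⟨⟩-cong (sexticₑ Xₑ Yₑ Zₑ) {η} {act g ξ} point) curve))
      k≉0
      (λ i → trans (eval-form (g i) η) (trans (⟨⟩-cong (g i) {η} {act g ξ} point) (twice i)))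
      using (automorphism; map-involutive; automorphism-ξ)
    μ-data = automorphism-ξ (ξ-nonzero 0F)
    μ = proj₁ μ-data
    μ≉0 = proj₁ (proj₂ μ-data)
    ind = proj₂ (proj₂ μ-data)

  sextic-vanishes : ∀ {x} k → x ≈ k * sextic ξ → x ≈ 0#
  sextic-vanishes k eq = trans eq (trans (*-congˡ sextic-ξ) (zeroʳ k))

  private
    minus-minus : ∀ x → - (- x) ≈ 1# * x
    minus-minus x = solve 1 (λ x → ⊝ (⊝ x) ⊜ κ 1 ⊗ x) (x ∷ [])
    one* : ∀ x → x ≈ 1# * x
    one* x = sym (*-identityˡ x)

  flip : ∀ i → Symmetry (flipₑ i)
  flip i = symmetry (flipₑ i) {1} (forms i) (curve i) 1≉0 (twice i)
    where
    forms : ∀ i j → T (isForm (flipₑ i j)) × degree (flipₑ i j) ≡ 1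
    forms i j with does (i Fin.≟ j)
    ... | true  = tt , ≡.refl
    ... | false = tt , ≡.refl
    curve : ∀ i → sextic (act (flipₑ i) ξ) ≈ 0#
    curve 0F = sextic-vanishes 1# (solve 3 (λ x y z → sexticₑ (⊝ x) y z ⊜ κ 1 ⊗ sexticₑ x y z) (X ∷ Y ∷ Z ∷ []))
    curve 1F = sextic-vanishes 1# (solve 3 (λ x y z → sexticₑ x (⊝ y) z ⊜ κ 1 ⊗ sexticₑ x y z) (X ∷ Y ∷ Z ∷ []))
    curve 2F = sextic-vanishes 1# (solve 3 (λ x y z → sexticₑ x y (⊝ z) ⊜ κ 1 ⊗ sexticₑ x y z) (X ∷ Y ∷ Z ∷ []))
    twice : ∀ i j → act (flipₑ i) (act (flipₑ i) ξ) j ≈ 1# * ξ j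
    twice 0F 0F = minus-minus X
    twice 0F 1F = one* Y
    twice 0F 2F = one* Z
    twice 1F 0F = one* X
    twice 1F 1F = minus-minus Y
    twice 1F 2F = one* Z
    twice 2F 0F = one* X
    twice 2F 1F = one* Y
    twice 2F 2F = minus-minus Z

  private
    slots : ∀ i j k → ∀ m → T (isForm (triple {A = Expr 3} (slot i) (slot j) (slot k) m)) ×
      degree (triple {A = Expr 3} (slot i) (slot j) (slot k) m) ≡ 1
    slots i j k 0F = tt , ≡.refl
    slots i j k 1F = tt , ≡.refl
    slots i j k 2F = tt , ≡.refl

  swapXY : Symmetry (triple Yₑ Xₑ Zₑ)
  swapXY = symmetry _ (slots 1F 0F 2F)
    (sextic-vanishes 1# (solve 3 (λ x y z → sexticₑ y x z ⊜ κ 1 ⊗ sexticₑ x y z) (X ∷ Y ∷ Z ∷ []))) 1≉0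
    λ { 0F → one* X ; 1F → one* Y ; 2F → one* Z }

  swapXZ : Symmetry (triple Zₑ Yₑ Xₑ)
  swapXZ = symmetry _ (slots 2F 1F 0F)
    (sextic-vanishes 1# (solve 3 (λ x y z → sexticₑ z y x ⊜ κ 1 ⊗ sexticₑ x y z) (X ∷ Y ∷ Z ∷ []))) 1≉0
    λ { 0F → one* X ; 1F → one* Y ; 2F → one* Z }

  swapYZ : Symmetry (triple Xₑ Zₑ Yₑ)
  swapYZ = symmetry _ (slots 0F 2F 1F)
    (sextic-vanishes 1# (solve 3 (λ x y z → sexticₑ x z y ⊜ κ 1 ⊗ sexticₑ x y z) (X ∷ Y ∷ Z ∷ []))) 1≉0
    λ { 0F → one* X ; 1F → one* Y ; 2F → one* Z }

  -- The elementary symmetric functions of a = Y + Z, b = X + Z and c = X + Y.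
  t₁ₑ t₂ₑ t₃ₑ : ∀ {n} → Expr n → Expr n → Expr n → Expr n
  t₁ₑ x y z = (y ⊕ z) ⊕ (x ⊕ z) ⊕ (x ⊕ y)
  t₂ₑ x y z = (y ⊕ z) ⊗ (x ⊕ z) ⊕ (x ⊕ z) ⊗ (x ⊕ y) ⊕ (x ⊕ y) ⊗ (y ⊕ z)
  t₃ₑ x y z = (y ⊕ z) ⊗ (x ⊕ z) ⊗ (x ⊕ y)

  t₁ t₂ t₃ : Carrier
  t₁ = ⟨ t₁ₑ Xₑ Yₑ Zₑ ⟩ ξ
  t₂ = ⟨ t₂ₑ Xₑ Yₑ Zₑ ⟩ ξ
  t₃ = ⟨ t₃ₑ Xₑ Yₑ Zₑ ⟩ ξ

  t₃-nonzero : t₃ ≉ 0#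
  t₃-nonzero = At₁.nonzero-form (t₃ₑ Xₑ Yₑ Zₑ) λ ()

  -- The components of `cremonaₑ` as functions of three expressions, so that composites can be given
  -- to the solver.
  h₀ h₁ h₂ : Expr 3 → Expr 3 → Expr 3 → Expr 3
  h₀ x y z = ⊝ ((x ⊕ z) ⊗ (x ⊕ y)) ⊕ (x ⊕ y) ⊗ (y ⊕ z) ⊕ (y ⊕ z) ⊗ (x ⊕ z)
  h₁ x y z = (x ⊕ z) ⊗ (x ⊕ y) ⊖ (x ⊕ y) ⊗ (y ⊕ z) ⊕ (y ⊕ z) ⊗ (x ⊕ z)
  h₂ x y z = (x ⊕ z) ⊗ (x ⊕ y) ⊕ (x ⊕ y) ⊗ (y ⊕ z) ⊖ (y ⊕ z) ⊗ (x ⊕ z)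

  -- The base points are double points of the sextic, so its pullback, of degree 12, contains the
  -- lines a = 0, b = 0 and c = 0 twice each, and the sextic remains. In these coordinates the map
  -- is a ↦ 2bc and cyclically; applied twice it sends a to 8abc·a, whence the factor 8 t₃.
  cremona : Symmetry cremonaₑ
  cremona = symmetry cremonaₑ {2} (λ { 0F → tt , ≡.refl ; 1F → tt , ≡.refl ; 2F → tt , ≡.refl })
    (sextic-vanishes (# 64 * t₃ ^ 2) (solve 3 (λ x y z →
      sexticₑ (h₀ x y z) (h₁ x y z) (h₂ x y z) ⊜ κ 64 ⊗ t₃ₑ x y z ⊛ 2 ⊗ sexticₑ x y z) (X ∷ Y ∷ Z ∷ [])))
    (*-nonzero (#-nonzero 7) t₃-nonzero)
    λ { 0F → solve 3 (λ x y z → h₀ (h₀ x y z) (h₁ x y z) (h₂ x y z) ⊜ κ 8 ⊗ t₃ₑ x y z ⊗ x) (X ∷ Y ∷ Z ∷ [])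
      ; 1F → solve 3 (λ x y z → h₁ (h₀ x y z) (h₁ x y z) (h₂ x y z) ⊜ κ 8 ⊗ t₃ₑ x y z ⊗ y) (X ∷ Y ∷ Z ∷ [])
      ; 2F → solve 3 (λ x y z → h₂ (h₀ x y z) (h₁ x y z) (h₂ x y z) ⊜ κ 8 ⊗ t₃ₑ x y z ⊗ z) (X ∷ Y ∷ Z ∷ []) }

-- Invariance of β and the five conjugates of w.

module WimanInvariance {c ℓ} (W̃ : FunctionField wiman c ℓ) where
  open FunctionField W̃
  open Curve W̃ using (Automorphism; ⟦_⟧; _∘ₐ_)
  open Identities fieldOverℚ
  open FieldLemmas fieldOverℚ
  open PolynomialExpressions fieldOverℚ
  open GenericPoint W̃ using (module AutomorphismLemmas)
  open WimanBasics W̃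
  open WimanSymmetries W̃
  open Wiman W̃
    using (β; sign; permutation; quintic; apply; InducedBy; Generated; generator; identity; compose; invert)
  open import Relation.Binary.Reasoning.Setoid setoid

  private
    X = ξ 0F
    Y = ξ 1F
    Z = ξ 2F

  h : Automorphism
  h = Symmetry.σ cremona

  flipₐ : Fin 3 → Automorphism
  flipₐ i = Symmetry.σ (flip i)

  v : Carrier
  v = ⟦ h ⟧ w

  M : Carrier → Carrier → Carrier
  M x y = ⟦ Mₑ (slot 0F) (κ 1) (slot 1F) (κ 1) ⟧ₑ (x ∷ y ∷ [])

  private
    -- Multiples of the numerators and denominators of w and of v as
    -- polynomials in t₁, t₂ and z = 9 t₃, in terms of which the equation of
    -- the curve is monic in z.
    Eₑ Rₑ E′ₑ R′ₑ : ∀ {n} → Expr n → Expr n → Expr n → Expr n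
    Eₑ z a b = κ 27 ⊗ a ⊛ 4 ⊖ κ 144 ⊗ a ⊛ 2 ⊗ b ⊕ κ 144 ⊗ b ⊛ 2 ⊕ κ 16 ⊗ a ⊗ z
    Rₑ z a b = κ 9 ⊗ (κ 3 ⊗ a ⊛ 2 ⊖ κ 8 ⊗ b) ⊛ 2
    E′ₑ z a b = κ 243 ⊗ b ⊛ 4 ⊖ κ 144 ⊗ a ⊗ b ⊛ 2 ⊗ z ⊕ κ 16 ⊗ (a ⊛ 2 ⊕ b) ⊗ z ⊛ 2
    R′ₑ z a b = (κ 27 ⊗ b ⊛ 2 ⊖ κ 8 ⊗ a ⊗ z) ⊛ 2

    9t₃ : Carrier
    9t₃ = # 9 * t₃

    ⟦_⟧ₜ : (Expr 3 → Expr 3 → Expr 3 → Expr 3) → Carrier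
    ⟦ a ⟧ₜ = ⟦ a (slot 0F) (slot 1F) (slot 2F) ⟧ₑ (9t₃ ∷ t₁ ∷ t₂ ∷ [])

    hξ : Point
    hξ = act cremonaₑ ξ

    Bₑ Aₑ : Expr 2
    Bₑ = κ 6 ⊗ slot 0F ⊛ 3 ⊖ κ 19 ⊗ slot 0F ⊗ slot 1F
    Aₑ = κ 54 ⊗ slot 1F ⊛ 3 ⊖ κ 18 ⊗ slot 0F ⊛ 2 ⊗ slot 1F ⊛ 2

    curve-equation : 9t₃ * 9t₃ + (⟦ Bₑ ⟧ₑ (t₁ ∷ t₂ ∷ []) * 9t₃ + ⟦ Aₑ ⟧ₑ (t₁ ∷ t₂ ∷ [])) ≈ 0#
    curve-equation = sextic-vanishes (- # 9) (solve 3 (λ x y z → f (t₁ₑ x y z) (t₂ₑ x y z) (κ 9 ⊗ t₃ₑ x y z) ⊜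
      ⊝ κ 9 ⊗ sexticₑ x y z) (X ∷ Y ∷ Z ∷ []))
      where
      f : Expr 3 → Expr 3 → Expr 3 → Expr 3
      f a b z = z ⊗ z ⊕ ((κ 6 ⊗ a ⊛ 3 ⊖ κ 19 ⊗ a ⊗ b) ⊗ z ⊕ (κ 54 ⊗ b ⊛ 3 ⊖ κ 18 ⊗ a ⊛ 2 ⊗ b ⊛ 2))

    R≈ : # 144 * r ξ ^ 2 ≈ ⟦ Rₑ ⟧ₜ
    R≈ = solve 3 (λ x y z → κ 144 ⊗ rₑ x y z ⊛ 2 ⊜ Rₑ (κ 9 ⊗ t₃ₑ x y z) (t₁ₑ x y z) (t₂ₑ x y z)) (X ∷ Y ∷ Z ∷ [])

    E≈ : # 144 * e ξ ≈ ⟦ Eₑ ⟧ₜ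
    E≈ = solve 3 (λ x y z → κ 144 ⊗ eₑ x y z ⊜ Eₑ (κ 9 ⊗ t₃ₑ x y z) (t₁ₑ x y z) (t₂ₑ x y z)) (X ∷ Y ∷ Z ∷ [])

    R′≈ : # 81 * r hξ ^ 2 ≈ ⟦ R′ₑ ⟧ₜ
    R′≈ = solve 3 (λ x y z → κ 81 ⊗ rₑ (h₀ x y z) (h₁ x y z) (h₂ x y z) ⊛ 2 ⊜
      R′ₑ (κ 9 ⊗ t₃ₑ x y z) (t₁ₑ x y z) (t₂ₑ x y z)) (X ∷ Y ∷ Z ∷ [])

    E′≈ : # 81 * e hξ ≈ ⟦ E′ₑ ⟧ₜ
    E′≈ = solve 3 (λ x y z → κ 81 ⊗ eₑ (h₀ x y z) (h₁ x y z) (h₂ x y z) ⊜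
      E′ₑ (κ 9 ⊗ t₃ₑ x y z) (t₁ₑ x y z) (t₂ₑ x y z)) (X ∷ Y ∷ Z ∷ [])

    rescale : ∀ {y r e n r′ e′} → n * r ≈ r′ → n * e ≈ e′ → y * r ≈ e → y * r′ ≈ e′
    rescale {y} {r} {e} {n} {r′} {e′} nr ne yr = begin
      y * r′ ≈⟨ *-congˡ nr ⟨
      y * (n * r) ≈⟨ solve 3 (λ y n r → y ⊗ (n ⊗ r) ⊜ n ⊗ (y ⊗ r)) (y ∷ n ∷ r ∷ []) ⟩
      n * (y * r) ≈⟨ *-congˡ yr ⟩
      n * e ≈⟨ ne ⟩
      e′ ∎

    v-data : r hξ ≉ 0# × v * r hξ ^ 2 ≈ e hξ
    v-data = w-image {h} {hξ} (Symmetry.induces cremona)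

    Mʰ : Expr 4
    Mʰ = Mₑ (slot 0F) (slot 1F) (slot 2F) (slot 3F)

    -- In the variables `t₁`, `t₂` and `9t₃` the curve is a monic quadratic in the last one, so this
    -- relation on the curve is verified by a remainder computation.
    Mʰ-zero : ⟦ Mʰ ⟧ₑ (⟦ Eₑ ⟧ₜ ∷ ⟦ Rₑ ⟧ₜ ∷ ⟦ E′ₑ ⟧ₜ ∷ ⟦ R′ₑ ⟧ₜ ∷ []) ≈ 0#
    Mʰ-zero = reduce 9t₃ t₁ t₂ curve-equation
      where
      Mₜ : Expr 3
      Mₜ = Mₑ (Eₑ (slot 0F) (slot 1F) (slot 2F)) (Rₑ (slot 0F) (slot 1F) (slot 2F))
        (E′ₑ (slot 0F) (slot 1F) (slot 2F)) (R′ₑ (slot 0F) (slot 1F) (slot 2F))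
      reduce : ∀ z a b → z * z + (⟦ Bₑ ⟧ₑ (a ∷ b ∷ []) * z + ⟦ Aₑ ⟧ₑ (a ∷ b ∷ [])) ≈ 0# →
        ⟦ Mₜ ⟧ₑ (z ∷ a ∷ b ∷ []) ≈ 0#
      reduce z a b = solve-mod² 2 Bₑ Aₑ Mₜ z (a ∷ b ∷ [])

  M-w-v : M w v ≈ 0#
  M-w-v = *-zero-product (begin
    ⟦ Rₑ ⟧ₜ ^ 4 * ⟦ R′ₑ ⟧ₜ ^ 4 * M w v
      ≈⟨ solve 4 (λ w s v t → s ⊛ 4 ⊗ t ⊛ 4 ⊗ Mₑ w (κ 1) v (κ 1) ⊜ Mₑ (w ⊗ s) s (v ⊗ t) t) (w ∷ ⟦ Rₑ ⟧ₜ ∷ v ∷ ⟦ R′ₑ ⟧ₜ ∷ []) ⟩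
    ⟦ Mʰ ⟧ₑ (w * ⟦ Rₑ ⟧ₜ ∷ ⟦ Rₑ ⟧ₜ ∷ v * ⟦ R′ₑ ⟧ₜ ∷ ⟦ R′ₑ ⟧ₜ ∷ [])
      ≈⟨ ⟦⟧-cong Mʰ {w * ⟦ Rₑ ⟧ₜ ∷ ⟦ Rₑ ⟧ₜ ∷ v * ⟦ R′ₑ ⟧ₜ ∷ ⟦ R′ₑ ⟧ₜ ∷ []} {⟦ Eₑ ⟧ₜ ∷ ⟦ Rₑ ⟧ₜ ∷ ⟦ E′ₑ ⟧ₜ ∷ ⟦ R′ₑ ⟧ₜ ∷ []}
           (λ { 0F → rescale R≈ E≈ w-r² ; 1F → refl ; 2F → rescale R′≈ E′≈ (proj₂ v-data) ; 3F → refl }) ⟩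
    ⟦ Mʰ ⟧ₑ (⟦ Eₑ ⟧ₜ ∷ ⟦ Rₑ ⟧ₜ ∷ ⟦ E′ₑ ⟧ₜ ∷ ⟦ R′ₑ ⟧ₜ ∷ []) ≈⟨ Mʰ-zero ⟩
    0# ∎)
    (*-nonzero (^-nonzero 4 (nonzero-cong R≈ (*-nonzero (#-nonzero 143) (^-nonzero 2 r-nonzero))))
      (^-nonzero 4 (nonzero-cong R′≈ (*-nonzero (#-nonzero 80) (^-nonzero 2 (proj₁ v-data))))))

  -- M is a difference quotient, so on the diagonal it becomes (N′D - ND′)/9375. All factors of this
  -- are nonzero at `w`, whereas `M w v` vanishes.
  w≉v : w ≉ v
  w≉v w≈v = *-nonzero (*-nonzero (*-nonzero 3w-1-nonzero (^-nonzero 2 w+5-nonzero)) Q-nonzero)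
    (^-nonzero 3 25w-19-nonzero) (begin
      (# 3 * w - 1#) * (w + # 5) ^ 2 * Q w * (# 25 * w - # 19) ^ 3
        ≈⟨ solve 1 (λ w → (κ 3 ⊗ w ⊖ κ 1) ⊗ (w ⊕ κ 5) ⊛ 2 ⊗ Qₑ w ⊗ (κ 25 ⊗ w ⊖ κ 19) ⊛ 3 ⊜ Mₑ w (κ 1) w (κ 1)) (w ∷ []) ⟩
      M w w
        ≈⟨ ⟦⟧-cong (Mₑ (slot 0F) (κ 1) (slot 1F) (κ 1)) {w ∷ w ∷ []} {w ∷ v ∷ []} (λ { 0F → refl ; 1F → w≈v }) ⟩
      M w v ≈⟨ M-w-v ⟩
      0# ∎)

  M-correspondence : ∀ y → M w y ≈ 0# → N w * D y ≈ N y * D w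
  M-correspondence y M≈0 = x-y≈0⇒x≈y _ _ (begin
    N w * D y - N y * D w
      ≈⟨ solve 2 (λ w y → Nₑ w ⊗ Dₑ y ⊖ Nₑ y ⊗ Dₑ w ⊜ (w ⊖ y) ⊗ κ 9375 ⊗ Mₑ w (κ 1) y (κ 1)) (w ∷ y ∷ []) ⟩
    (w - y) * # 9375 * M w y ≈⟨ trans (*-congˡ M≈0) (zeroʳ _) ⟩
    0# ∎)

  β-fixed : ∀ σ → N w * D (⟦ σ ⟧ w) ≈ N (⟦ σ ⟧ w) * D w → ⟦ σ ⟧ β ≈ β
  β-fixed σ eq = *-cancelˡ-nonzero (*-nonzero Dσ≉0 D-nonzero) (begin
    D (⟦ σ ⟧ w) * D w * ⟦ σ ⟧ β
      ≈⟨ solve 3 (λ d d′ b → d ⊗ d′ ⊗ b ⊜ b ⊗ d ⊗ d′) (D (⟦ σ ⟧ w) ∷ D w ∷ ⟦ σ ⟧ β ∷ []) ⟩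
    ⟦ σ ⟧ β * D (⟦ σ ⟧ w) * D w ≈⟨ *-congʳ (*-congˡ (σ-expr (Dₑ (slot 0F)) (w ∷ []))) ⟨
    ⟦ σ ⟧ β * ⟦ σ ⟧ (D w) * D w ≈⟨ *-congʳ (trans (sym (σ-* β (D w))) (σ-cong β-D)) ⟩
    ⟦ σ ⟧ (N w) * D w ≈⟨ *-congʳ (σ-expr (Nₑ (slot 0F)) (w ∷ [])) ⟩
    N (⟦ σ ⟧ w) * D w ≈⟨ eq ⟨
    N w * D (⟦ σ ⟧ w) ≈⟨ *-congʳ β-D ⟨
    β * D w * D (⟦ σ ⟧ w)
      ≈⟨ solve 3 (λ d d′ b → b ⊗ d′ ⊗ d ⊜ d ⊗ d′ ⊗ b) (D (⟦ σ ⟧ w) ∷ D w ∷ β ∷ []) ⟩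
    D (⟦ σ ⟧ w) * D w * β ∎)
    where
    open AutomorphismLemmas σ renaming (⟦⟧-cong to σ-cong)
    Dσ≉0 : D (⟦ σ ⟧ w) ≉ 0#
    Dσ≉0 = nonzero-cong (σ-expr (Dₑ (slot 0F)) (w ∷ [])) (σ-nonzero D-nonzero)

  β-fixed-w : ∀ σ → ⟦ σ ⟧ w ≈ w → ⟦ σ ⟧ β ≈ β
  β-fixed-w σ eq = β-fixed σ (trans (*-congˡ (expr-cong (Dₑ (slot 0F)) eq)) (*-congʳ (sym (expr-cong (Nₑ (slot 0F)) eq))))

  w-fixed : ∀ {σ P} → Induces σ P → r P ≈ r ξ → e P ≈ e ξ → ⟦ σ ⟧ w ≈ w
  w-fixed {σ} {P} ind r≈ e≈ = w-unique {σ} {P} ind (trans (*-congˡ (^-congˡ 2 r≈)) (trans w-r² (sym e≈)))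

  r-flip : ∀ j → r (act (flipₑ j) ξ) ≈ r ξ
  r-flip 0F = solve 3 (λ x y z → rₑ (⊝ x) y z ⊜ rₑ x y z) (X ∷ Y ∷ Z ∷ [])
  r-flip 1F = solve 3 (λ x y z → rₑ x (⊝ y) z ⊜ rₑ x y z) (X ∷ Y ∷ Z ∷ [])
  r-flip 2F = solve 3 (λ x y z → rₑ x y (⊝ z) ⊜ rₑ x y z) (X ∷ Y ∷ Z ∷ [])

  e-flip : ∀ j → e (act (flipₑ j) ξ) ≈ e ξ
  e-flip 0F = solve 3 (λ x y z → eₑ (⊝ x) y z ⊜ eₑ x y z) (X ∷ Y ∷ Z ∷ [])
  e-flip 1F = solve 3 (λ x y z → eₑ x (⊝ y) z ⊜ eₑ x y z) (X ∷ Y ∷ Z ∷ [])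
  e-flip 2F = solve 3 (λ x y z → eₑ x y (⊝ z) ⊜ eₑ x y z) (X ∷ Y ∷ Z ∷ [])

  flip-w : ∀ j → ⟦ flipₐ j ⟧ w ≈ w
  flip-w j = w-fixed {flipₐ j} (Symmetry.induces (flip j)) (r-flip j) (e-flip j)

  flip-h-induces : ∀ j → Induces (flipₐ j ∘ₐ h) (act cremonaₑ (act (flipₑ j) ξ))
  flip-h-induces j = induces-∘ {flipₐ j} {h} {act (flipₑ j) ξ} cremonaₑ (Symmetry.forms cremona)
    (Symmetry.induces (flip j)) (Symmetry.induces cremona)

  h-involutive : ∀ f → ⟦ h ⟧ (⟦ h ⟧ f) ≈ f
  h-involutive = Symmetry.involutive cremona

  flip-involutive : ∀ j f → ⟦ flipₐ j ⟧ (⟦ flipₐ j ⟧ f) ≈ f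
  flip-involutive j = Symmetry.involutive (flip j)

  private
    -- A transposition of two coordinates with a sign change of the third, which cannot be seen by r
    -- and e. It is the correction in the relation `braid` between `cremonaₑ` and a sign change.
    twist : Fin 3 → Point → Point
    twist 0F P = triple (- P 0F) (P 2F) (P 1F)
    twist 1F P = triple (P 2F) (- P 1F) (P 0F)
    twist 2F P = triple (P 1F) (P 0F) (- P 2F)

    r-twist : ∀ j k (P G : Point) → (∀ i → G i ≈ k * twist j P i) → r G ≈ k ^ 2 * r P
    r-twist j k P G eq = trans (⟨⟩-cong (rₑ Xₑ Yₑ Zₑ) {G} {λ i → k * twist j P i} eq) (scaled j)
      where
      scaled : ∀ j → r (λ i → k * twist j P i) ≈ k ^ 2 * r P
      scaled 0F = solve 4 (λ k x y z → rₑ (k ⊗ ⊝ x) (k ⊗ z) (k ⊗ y) ⊜ k ⊛ 2 ⊗ rₑ x y z) (k ∷ coordinates P)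
      scaled 1F = solve 4 (λ k x y z → rₑ (k ⊗ z) (k ⊗ ⊝ y) (k ⊗ x) ⊜ k ⊛ 2 ⊗ rₑ x y z) (k ∷ coordinates P)
      scaled 2F = solve 4 (λ k x y z → rₑ (k ⊗ y) (k ⊗ x) (k ⊗ ⊝ z) ⊜ k ⊛ 2 ⊗ rₑ x y z) (k ∷ coordinates P)

    e-twist : ∀ j k (P G : Point) → (∀ i → G i ≈ k * twist j P i) → e G ≈ k ^ 4 * e P
    e-twist j k P G eq = trans (⟨⟩-cong (eₑ Xₑ Yₑ Zₑ) {G} {λ i → k * twist j P i} eq) (scaled j)
      where
      scaled : ∀ j → e (λ i → k * twist j P i) ≈ k ^ 4 * e P
      scaled 0F = solve 4 (λ k x y z → eₑ (k ⊗ ⊝ x) (k ⊗ z) (k ⊗ y) ⊜ k ⊛ 4 ⊗ eₑ x y z) (k ∷ coordinates P)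
      scaled 1F = solve 4 (λ k x y z → eₑ (k ⊗ z) (k ⊗ ⊝ y) (k ⊗ x) ⊜ k ⊛ 4 ⊗ eₑ x y z) (k ∷ coordinates P)
      scaled 2F = solve 4 (λ k x y z → eₑ (k ⊗ y) (k ⊗ x) (k ⊗ ⊝ z) ⊜ k ⊛ 4 ⊗ eₑ x y z) (k ∷ coordinates P)

    hfₑ : Fin 3 → Fin 3 → Expr 3
    hfₑ j = triple (h₀ x y z) (h₁ x y z) (h₂ x y z)
      where
      x y z : Expr 3
      x = flipₑ j 0F
      y = flipₑ j 1F
      z = flipₑ j 2F

    hf hfh : Fin 3 → Point
    hf j = act (hfₑ j) ξ
    hfh j = act (hfₑ j) (act cremonaₑ ξ)

    -- The composite of two quadratic maps has components of degree 4. Here they share a quadratic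
    -- factor, up to a constant the product of two of the lines a, b, c = 0, and a quadratic map
    -- remains.
    k : Fin 3 → Carrier
    k 0F = # 4 * ((X + Y) * (X + Z))
    k 1F = # 4 * ((Y + X) * (Y + Z))
    k 2F = # 4 * ((Z + X) * (Z + Y))

    braid : ∀ j i → hfh j i ≈ k j * twist j (hf j) i
    braid 0F 0F = solve 3 (λ x y z → h₀ (⊝ h₀ x y z) (h₁ x y z) (h₂ x y z) ⊜
      κ 4 ⊗ ((x ⊕ y) ⊗ (x ⊕ z)) ⊗ (⊝ h₀ (⊝ x) y z)) (X ∷ Y ∷ Z ∷ [])
    braid 0F 1F = solve 3 (λ x y z → h₁ (⊝ h₀ x y z) (h₁ x y z) (h₂ x y z) ⊜
      κ 4 ⊗ ((x ⊕ y) ⊗ (x ⊕ z)) ⊗ h₂ (⊝ x) y z) (X ∷ Y ∷ Z ∷ [])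
    braid 0F 2F = solve 3 (λ x y z → h₂ (⊝ h₀ x y z) (h₁ x y z) (h₂ x y z) ⊜
      κ 4 ⊗ ((x ⊕ y) ⊗ (x ⊕ z)) ⊗ h₁ (⊝ x) y z) (X ∷ Y ∷ Z ∷ [])
    braid 1F 0F = solve 3 (λ x y z → h₀ (h₀ x y z) (⊝ h₁ x y z) (h₂ x y z) ⊜
      κ 4 ⊗ ((y ⊕ x) ⊗ (y ⊕ z)) ⊗ h₂ x (⊝ y) z) (X ∷ Y ∷ Z ∷ [])
    braid 1F 1F = solve 3 (λ x y z → h₁ (h₀ x y z) (⊝ h₁ x y z) (h₂ x y z) ⊜
      κ 4 ⊗ ((y ⊕ x) ⊗ (y ⊕ z)) ⊗ (⊝ h₁ x (⊝ y) z)) (X ∷ Y ∷ Z ∷ [])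
    braid 1F 2F = solve 3 (λ x y z → h₂ (h₀ x y z) (⊝ h₁ x y z) (h₂ x y z) ⊜
      κ 4 ⊗ ((y ⊕ x) ⊗ (y ⊕ z)) ⊗ h₀ x (⊝ y) z) (X ∷ Y ∷ Z ∷ [])
    braid 2F 0F = solve 3 (λ x y z → h₀ (h₀ x y z) (h₁ x y z) (⊝ h₂ x y z) ⊜
      κ 4 ⊗ ((z ⊕ x) ⊗ (z ⊕ y)) ⊗ h₁ x y (⊝ z)) (X ∷ Y ∷ Z ∷ [])
    braid 2F 1F = solve 3 (λ x y z → h₁ (h₀ x y z) (h₁ x y z) (⊝ h₂ x y z) ⊜
      κ 4 ⊗ ((z ⊕ x) ⊗ (z ⊕ y)) ⊗ h₀ x y (⊝ z)) (X ∷ Y ∷ Z ∷ [])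
    braid 2F 2F = solve 3 (λ x y z → h₂ (h₀ x y z) (h₁ x y z) (⊝ h₂ x y z) ⊜
      κ 4 ⊗ ((z ⊕ x) ⊗ (z ⊕ y)) ⊗ (⊝ h₂ x y (⊝ z))) (X ∷ Y ∷ Z ∷ [])

    hfₑ-forms : ∀ j i → T (isForm (hfₑ j i)) × degree (hfₑ j i) ≡ 2
    hfₑ-forms 0F 0F = tt , ≡.refl
    hfₑ-forms 0F 1F = tt , ≡.refl
    hfₑ-forms 0F 2F = tt , ≡.refl
    hfₑ-forms 1F 0F = tt , ≡.refl
    hfₑ-forms 1F 1F = tt , ≡.refl
    hfₑ-forms 1F 2F = tt , ≡.refl
    hfₑ-forms 2F 0F = tt , ≡.refl
    hfₑ-forms 2F 1F = tt , ≡.refl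
    hfₑ-forms 2F 2F = tt , ≡.refl

    hf-induces : ∀ j → Induces (flipₐ j ∘ₐ h) (hf j)
    hf-induces j = μ , μ≉0 , λ { 0F → eq 0F ; 1F → eq 1F ; 2F → eq 2F }
      where
      data′ : Induces (flipₐ j ∘ₐ h) (act cremonaₑ (act (flipₑ j) ξ))
      data′ = flip-h-induces j
      μ = proj₁ data′
      μ≉0 = proj₁ (proj₂ data′)
      eq = proj₂ (proj₂ data′)

  -- With h = (4 5) and flip j = (1 4)(2 3) up to relabelling, this reflects
  -- (4 5)(1 4)(2 3)(4 5) = (1 4)(2 3)(4 5)(1 4) in S₅.
  h-flip-h : ∀ j → ⟦ h ⟧ (⟦ flipₐ j ⟧ v) ≈ ⟦ flipₐ j ⟧ v
  h-flip-h j = w-compare {h ∘ₐ (flipₐ j ∘ₐ h)} {flipₐ j ∘ₐ h} {hfh j} {hf j}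
    (induces-∘ {h} {flipₐ j ∘ₐ h} {act cremonaₑ ξ} (hfₑ j) (hfₑ-forms j) (Symmetry.induces cremona) (hf-induces j))
    (hf-induces j) (k j)
    (r-twist j (k j) (hf j) (hfh j) (braid j)) (e-twist j (k j) (hf j) (hfh j) (braid j))

  -- Up to the sign of all coordinates flip a ∘ flip b is flip c.
  flip-flip : ∀ {a b c} → (∀ i → act (hfₑ b) (act (flipₑ a) ξ) i ≈ hf c i) →
    ⟦ flipₐ a ⟧ (⟦ flipₐ b ⟧ v) ≈ ⟦ flipₐ c ⟧ v
  flip-flip {a} {b} {c} eq = w-compare {flipₐ a ∘ₐ (flipₐ b ∘ₐ h)} {flipₐ c ∘ₐ h} {P} {hf c}
    (induces-∘ {flipₐ a} {flipₐ b ∘ₐ h} {act (flipₑ a) ξ} (hfₑ b) (hfₑ-forms b)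
      (Symmetry.induces (flip a)) (hf-induces b))
    (hf-induces c) 1#
    (trans (⟨⟩-cong (rₑ Xₑ Yₑ Zₑ) {P} {hf c} eq) (solve 1 (λ r → r ⊜ κ 1 ⊛ 2 ⊗ r) (r (hf c) ∷ [])))
    (trans (⟨⟩-cong (eₑ Xₑ Yₑ Zₑ) {P} {hf c} eq) (solve 1 (λ r → r ⊜ κ 1 ⊛ 4 ⊗ r) (e (hf c) ∷ [])))
    where
    P : Point
    P = act (hfₑ b) (act (flipₑ a) ξ)

  w≉flip-v : ∀ j → w ≉ ⟦ flipₐ j ⟧ v
  w≉flip-v j eq = w≉v (injective (trans (flip-w j) eq))
    where open AutomorphismLemmas (flipₐ j)

  v≉flip-v : ∀ j → v ≉ ⟦ flipₐ j ⟧ v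
  v≉flip-v j eq = w≉v (begin
    w ≈⟨ h-involutive w ⟨
    ⟦ h ⟧ v ≈⟨ AutomorphismLemmas.⟦⟧-cong h eq ⟩
    ⟦ h ⟧ (⟦ flipₐ j ⟧ v) ≈⟨ h-flip-h j ⟩
    ⟦ flipₐ j ⟧ v ≈⟨ eq ⟨
    v ∎)

  flip-v≉flip-v : ∀ {a b c} → (∀ i → act (hfₑ b) (act (flipₑ a) ξ) i ≈ hf c i) →
    ⟦ flipₐ a ⟧ v ≉ ⟦ flipₐ b ⟧ v
  flip-v≉flip-v {a} {b} {c} same eq = v≉flip-v c (begin
    v ≈⟨ flip-involutive a v ⟨
    ⟦ flipₐ a ⟧ (⟦ flipₐ a ⟧ v) ≈⟨ AutomorphismLemmas.⟦⟧-cong (flipₐ a) eq ⟩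
    ⟦ flipₐ a ⟧ (⟦ flipₐ b ⟧ v) ≈⟨ flip-flip {a} {b} {c} same ⟩
    ⟦ flipₐ c ⟧ v ∎)

  -- The sign changes and permutations, a group S₄, fix `w`. Its five cosets in S₅ give these images
  -- of `w`, under the identity, `h` and the three composites `flipₐ j ∘ₐ h`.
  conjugates : Vec Carrier 5
  conjugates = w ∷ v ∷ ⟦ flipₐ 0F ⟧ v ∷ ⟦ flipₐ 1F ⟧ v ∷ ⟦ flipₐ 2F ⟧ v ∷ []

  conjugates-distinct : AllPairs _≉_ conjugates
  conjugates-distinct =
    (w≉v ∷ w≉flip-v 0F ∷ w≉flip-v 1F ∷ w≉flip-v 2F ∷ []) ∷
    (v≉flip-v 0F ∷ v≉flip-v 1F ∷ v≉flip-v 2F ∷ []) ∷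
    (flip-v≉flip-v {0F} {1F} {2F} same₀₁ ∷ flip-v≉flip-v {0F} {2F} {1F} same₀₂ ∷ []) ∷
    (flip-v≉flip-v {1F} {2F} {0F} same₁₂ ∷ []) ∷ [] ∷ []
    where
    same₀₁ : ∀ i → act (hfₑ 1F) (act (flipₑ 0F) ξ) i ≈ hf 2F i
    same₀₁ 0F = solve 3 (λ x y z → h₀ (⊝ x) (⊝ y) z ⊜ h₀ x y (⊝ z)) (X ∷ Y ∷ Z ∷ [])
    same₀₁ 1F = solve 3 (λ x y z → h₁ (⊝ x) (⊝ y) z ⊜ h₁ x y (⊝ z)) (X ∷ Y ∷ Z ∷ [])
    same₀₁ 2F = solve 3 (λ x y z → h₂ (⊝ x) (⊝ y) z ⊜ h₂ x y (⊝ z)) (X ∷ Y ∷ Z ∷ [])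
    same₀₂ : ∀ i → act (hfₑ 2F) (act (flipₑ 0F) ξ) i ≈ hf 1F i
    same₀₂ 0F = solve 3 (λ x y z → h₀ (⊝ x) y (⊝ z) ⊜ h₀ x (⊝ y) z) (X ∷ Y ∷ Z ∷ [])
    same₀₂ 1F = solve 3 (λ x y z → h₁ (⊝ x) y (⊝ z) ⊜ h₁ x (⊝ y) z) (X ∷ Y ∷ Z ∷ [])
    same₀₂ 2F = solve 3 (λ x y z → h₂ (⊝ x) y (⊝ z) ⊜ h₂ x (⊝ y) z) (X ∷ Y ∷ Z ∷ [])
    same₁₂ : ∀ i → act (hfₑ 2F) (act (flipₑ 1F) ξ) i ≈ hf 0F i
    same₁₂ 0F = solve 3 (λ x y z → h₀ x (⊝ y) (⊝ z) ⊜ h₀ (⊝ x) y z) (X ∷ Y ∷ Z ∷ [])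
    same₁₂ 1F = solve 3 (λ x y z → h₁ x (⊝ y) (⊝ z) ⊜ h₁ (⊝ x) y z) (X ∷ Y ∷ Z ∷ [])
    same₁₂ 2F = solve 3 (λ x y z → h₂ x (⊝ y) (⊝ z) ⊜ h₂ (⊝ x) y z) (X ∷ Y ∷ Z ∷ [])

  β-fixed-generator : ∀ g {σ} → InducedBy g σ → ⟦ σ ⟧ β ≈ β
  β-fixed-generator (sign j) {σ} ind = β-fixed-w σ (w-fixed {σ} {apply (sign j) ξ} ind (r-sign j) (e-sign j))
    where
    r-sign : ∀ j → r (apply (sign j) ξ) ≈ r ξ
    r-sign 0F = r-flip 0F
    r-sign 1F = r-flip 1F
    r-sign 2F = r-flip 2F
    e-sign : ∀ j → e (apply (sign j) ξ) ≈ e ξ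
    e-sign 0F = e-flip 0F
    e-sign 1F = e-flip 1F
    e-sign 2F = e-flip 2F
  β-fixed-generator (permutation π) {σ} ind =
    β-fixed-w σ (w-fixed {σ} {apply (permutation π) ξ} ind (proj₁ symmetric) (proj₂ symmetric))
    where
    permuted : ∀ i j k → i ≢ j → i ≢ k → j ≢ k →
      r (triple (ξ i) (ξ j) (ξ k)) ≈ r ξ × e (triple (ξ i) (ξ j) (ξ k)) ≈ e ξ
    permuted 0F 0F k  i≢j i≢k j≢k = ⊥-elim (i≢j ≡.refl)
    permuted 0F 1F 0F i≢j i≢k j≢k = ⊥-elim (i≢k ≡.refl)
    permuted 0F 1F 1F i≢j i≢k j≢k = ⊥-elim (j≢k ≡.refl)
    permuted 0F 1F 2F i≢j i≢k j≢k = refl , refl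
    permuted 0F 2F 0F i≢j i≢k j≢k = ⊥-elim (i≢k ≡.refl)
    permuted 0F 2F 1F i≢j i≢k j≢k =
      solve 3 (λ x y z → rₑ x z y ⊜ rₑ x y z) (X ∷ Y ∷ Z ∷ []) , solve 3 (λ x y z → eₑ x z y ⊜ eₑ x y z) (X ∷ Y ∷ Z ∷ [])
    permuted 0F 2F 2F i≢j i≢k j≢k = ⊥-elim (j≢k ≡.refl)
    permuted 1F 0F 0F i≢j i≢k j≢k = ⊥-elim (j≢k ≡.refl)
    permuted 1F 0F 1F i≢j i≢k j≢k = ⊥-elim (i≢k ≡.refl)
    permuted 1F 0F 2F i≢j i≢k j≢k =
      solve 3 (λ x y z → rₑ y x z ⊜ rₑ x y z) (X ∷ Y ∷ Z ∷ []) , solve 3 (λ x y z → eₑ y x z ⊜ eₑ x y z) (X ∷ Y ∷ Z ∷ [])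
    permuted 1F 1F k  i≢j i≢k j≢k = ⊥-elim (i≢j ≡.refl)
    permuted 1F 2F 0F i≢j i≢k j≢k =
      solve 3 (λ x y z → rₑ y z x ⊜ rₑ x y z) (X ∷ Y ∷ Z ∷ []) , solve 3 (λ x y z → eₑ y z x ⊜ eₑ x y z) (X ∷ Y ∷ Z ∷ [])
    permuted 1F 2F 1F i≢j i≢k j≢k = ⊥-elim (i≢k ≡.refl)
    permuted 1F 2F 2F i≢j i≢k j≢k = ⊥-elim (j≢k ≡.refl)
    permuted 2F 0F 0F i≢j i≢k j≢k = ⊥-elim (j≢k ≡.refl)
    permuted 2F 0F 1F i≢j i≢k j≢k =
      solve 3 (λ x y z → rₑ z x y ⊜ rₑ x y z) (X ∷ Y ∷ Z ∷ []) , solve 3 (λ x y z → eₑ z x y ⊜ eₑ x y z) (X ∷ Y ∷ Z ∷ [])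
    permuted 2F 0F 2F i≢j i≢k j≢k = ⊥-elim (i≢k ≡.refl)
    permuted 2F 1F 0F i≢j i≢k j≢k =
      solve 3 (λ x y z → rₑ z y x ⊜ rₑ x y z) (X ∷ Y ∷ Z ∷ []) , solve 3 (λ x y z → eₑ z y x ⊜ eₑ x y z) (X ∷ Y ∷ Z ∷ [])
    permuted 2F 1F 1F i≢j i≢k j≢k = ⊥-elim (j≢k ≡.refl)
    permuted 2F 1F 2F i≢j i≢k j≢k = ⊥-elim (i≢k ≡.refl)
    permuted 2F 2F k  i≢j i≢k j≢k = ⊥-elim (i≢j ≡.refl)
    distinct : ∀ {i j} → i ≢ j → π ⟨$⟩ʳ i ≢ π ⟨$⟩ʳ j
    distinct i≢j eq = i≢j (≡.trans (≡.sym (inverseˡ π)) (≡.trans (≡.cong (π ⟨$⟩ˡ_) eq) (inverseˡ π)))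
    symmetric = permuted (π ⟨$⟩ʳ 0F) (π ⟨$⟩ʳ 1F) (π ⟨$⟩ʳ 2F) (distinct λ ()) (distinct λ ()) (distinct λ ())
  -- Up to sign and a transposition of coordinates the quintic map is h ∘ flip 0.
  β-fixed-generator quintic {σ} ind = β-fixed σ (begin
    N w * D (⟦ σ ⟧ w) ≈⟨ *-congˡ (expr-cong (Dₑ (slot 0F)) σw≈fv) ⟩
    N w * D fv ≈⟨ M-correspondence fv M-w-fv ⟩
    N fv * D w ≈⟨ *-congʳ (expr-cong (Nₑ (slot 0F)) σw≈fv) ⟨
    N (⟦ σ ⟧ w) * D w ∎)
    where
    open AutomorphismLemmas (flipₐ 0F) using (σ-expr; σ-0) renaming (⟦⟧-cong to flip-cong)
    fv : Carrier
    fv = ⟦ flipₐ 0F ⟧ v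
    q₀ q₁ q₂ : Expr 3 → Expr 3 → Expr 3 → Expr 3
    q₀ x y z = ⊝ (x ⊛ 2) ⊕ x ⊗ y ⊖ y ⊛ 2 ⊕ x ⊗ z ⊖ y ⊗ z ⊕ z ⊛ 2
    q₁ x y z = ⊝ (x ⊛ 2) ⊕ x ⊗ y ⊕ y ⊛ 2 ⊕ x ⊗ z ⊖ y ⊗ z ⊖ z ⊛ 2
    q₂ x y z = x ⊛ 2 ⊕ x ⊗ y ⊖ y ⊛ 2 ⊕ x ⊗ z ⊖ y ⊗ z ⊖ z ⊛ 2
    σw≈fv : ⟦ σ ⟧ w ≈ fv
    σw≈fv = w-compare {σ} {flipₐ 0F ∘ₐ h} {apply quintic ξ} {hf 0F} ind (hf-induces 0F) 1#
      (solve 3 (λ x y z → rₑ (q₀ x y z) (q₁ x y z) (q₂ x y z) ⊜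
        κ 1 ⊛ 2 ⊗ rₑ (h₀ (⊝ x) y z) (h₁ (⊝ x) y z) (h₂ (⊝ x) y z)) (X ∷ Y ∷ Z ∷ []))
      (solve 3 (λ x y z → eₑ (q₀ x y z) (q₁ x y z) (q₂ x y z) ⊜
        κ 1 ⊛ 4 ⊗ eₑ (h₀ (⊝ x) y z) (h₁ (⊝ x) y z) (h₂ (⊝ x) y z)) (X ∷ Y ∷ Z ∷ []))
    M-w-fv : M w fv ≈ 0#
    M-w-fv = begin
      M w fv ≈⟨ ⟦⟧-cong₁ (Mₑ (slot 0F) (κ 1) (slot 1F) (κ 1)) (fv ∷ []) (sym (flip-w 0F)) ⟩
      M (⟦ flipₐ 0F ⟧ w) fv ≈⟨ σ-expr (Mₑ (slot 0F) (κ 1) (slot 1F) (κ 1)) (w ∷ v ∷ []) ⟨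
      ⟦ flipₐ 0F ⟧ (M w v) ≈⟨ trans (flip-cong M-w-v) σ-0 ⟩
      0# ∎

  β-invariant : ∀ {σ} → Generated σ → ⟦ σ ⟧ β ≈ β
  β-invariant {σ} (generator g ind) = β-fixed-generator g {σ} ind
  β-invariant (identity σ≈id)   = σ≈id β
  β-invariant (compose {σ} {τ} {ρ} gτ gρ σ≈τρ) =
    trans (σ≈τρ β) (trans (AutomorphismLemmas.⟦⟧-cong τ (β-invariant gρ)) (β-invariant gτ))
  β-invariant (invert {σ} {τ} gτ στ≈id) =
    trans (AutomorphismLemmas.⟦⟧-cong σ (sym (β-invariant gτ))) (στ≈id β)

-- The tower between ℚ(β) and the function field, with the equations of its generators.

monicₑ monic′ₑ : ∀ {n k} → Vec (Expr n) k → Expr n → Expr n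
monicₑ []      x = κ 1
monicₑ (a ∷ g) x = a ⊕ x ⊗ monicₑ g x
monic′ₑ []      x = κ 0
monic′ₑ (a ∷ g) x = monicₑ g x ⊕ x ⊗ monic′ₑ g x

-- The equation N(t) = β D(t) of w, made monic with u = 1/(28125 (1 − β)).
w-equationₑ : ∀ {n} → Expr n → Expr n → Vec (Expr n) 5
w-equationₑ β u =
  u ⊗ (κ 390625 ⊕ κ 338 ⊗ β) ∷ u ⊗ (κ 51675 ⊗ β ⊖ κ 2109375) ∷ u ⊗ (κ 2156250 ⊕ κ 1905000 ⊗ β) ∷
  u ⊗ (κ 1831250 ⊖ κ 5393750 ⊗ β) ∷ u ⊗ (κ 403125 ⊕ κ 768750 ⊗ β) ∷ []

module WimanTower {c ℓ} (W̃ : FunctionField wiman c ℓ) where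
  open FunctionField W̃
  open Curve W̃ using (_∈ℚ⟨_⟩)
  open Identities fieldOverℚ
  open FieldLemmas fieldOverℚ
  open PolynomialExpressions fieldOverℚ
  open Subfields fieldOverℚ
  open WimanBasics W̃
  open Wiman W̃ using (β)
  open import Relation.Binary.Reasoning.Setoid setoid

  private
    X = ξ 0F
    Y = ξ 1F
    Z = ξ 2F

  k₀ : Carrier → Set ℓ
  k₀ f = f ∈ℚ⟨ β ⟩

  k₀-∋ι : ∀ q → k₀ (ι q)
  k₀-∋ι q = constᴾ q , constᴾ 1ℚ , nonzero-cong (sym one) 1≉0 ,
    trans (*-congˡ one) (trans (*-identityʳ _) (sym (eval-const {1} q (λ _ → β))))
    where
    one : eval {1} (constᴾ 1ℚ) (λ _ → β) ≈ 1#
    one = trans (eval-const {1} 1ℚ (λ _ → β)) ι-1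

  k₀-∋β : k₀ β
  k₀-∋β = var 0F , constᴾ 1ℚ , nonzero-cong (sym one) 1≉0 ,
    trans (*-congˡ one) (trans (*-identityʳ _) (sym (eval-var {1} 0F (λ _ → β))))
    where
    one : eval {1} (constᴾ 1ℚ) (λ _ → β) ≈ 1#
    one = trans (eval-const {1} 1ℚ (λ _ → β)) ι-1

  k₀-isSubfield : IsSubfield k₀
  k₀-isSubfield = record
    { isSubring = record
      { resp = resp
      ; 0-closed = resp ι-0 (k₀-∋ι 0ℚ)
      ; 1-closed = resp ι-1 (k₀-∋ι 1ℚ)
      ; +-closed = λ {f} {g} (p , q , q≉0 , eq) (p′ , q′ , q′≉0 , eq′) →
          p *ᴾ q′ +ᴾ p′ *ᴾ q , q *ᴾ q′ , nonzero-cong (sym (eval-* q q′ b)) (*-nonzero q≉0 q′≉0) ,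
          eval-fraction-+ p q p′ q′ b eq eq′
      ; *-closed = times
      ; neg-closed = λ {f} kf → resp (trans (*-congʳ (trans (ι-neg 1ℚ) (-‿cong ι-1)))
          (solve 1 (λ f → ⊝ κ 1 ⊗ f ⊜ ⊝ f) (f ∷ []))) (times (k₀-∋ι (ℚ.- 1ℚ)) kf)
      }
    ; ⁻¹-closed = λ {f} f≉0 (p , q , q≉0 , eq) → q , p , nonzero-cong eq (*-nonzero f≉0 q≉0) , fraction-⁻¹ f≉0 eq
    }
    where
    b : Fin 1 → Carrier
    b _ = β
    resp : ∀ {f g} → f ≈ g → k₀ f → k₀ g
    resp f≈g (p , q , q≉0 , eq) = p , q , q≉0 , trans (*-congʳ (sym f≈g)) eq
    times : ∀ {f g} → k₀ f → k₀ g → k₀ (f * g)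
    times {f} {g} (p , q , q≉0 , eq) (p′ , q′ , q′≉0 , eq′) =
      p *ᴾ p′ , q *ᴾ q′ , nonzero-cong (sym (eval-* q q′ b)) (*-nonzero q≉0 q′≉0) , eval-fraction-* p q p′ q′ b eq eq′

  x y : Carrier
  x = X / Z
  y = Y / Z

  k₁ k₂ k₃ k₄ k₅ : Carrier → Set (c ⊔ ℓ)
  k₁ = Adjoin k₀ w
  k₂ = Adjoin k₁ (τ 0F)
  k₃ = Adjoin k₂ (τ 1F)
  k₄ = Adjoin k₃ x
  k₅ = Adjoin k₄ y

  k₁-isSubfield : IsSubfield k₁
  k₁-isSubfield = adjoin-isSubfield k₀-isSubfield w
  k₂-isSubfield : IsSubfield k₂
  k₂-isSubfield = adjoin-isSubfield k₁-isSubfield (τ 0F)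
  k₃-isSubfield : IsSubfield k₃
  k₃-isSubfield = adjoin-isSubfield k₂-isSubfield (τ 1F)
  k₄-isSubfield : IsSubfield k₄
  k₄-isSubfield = adjoin-isSubfield k₃-isSubfield x
  k₅-isSubfield : IsSubfield k₅
  k₅-isSubfield = adjoin-isSubfield k₄-isSubfield y

  module K₀ = IsSubfield k₀-isSubfield
  module K₁ = IsSubfield k₁-isSubfield
  module K₂ = IsSubfield k₂-isSubfield
  module K₃ = IsSubfield k₃-isSubfield
  module K₅ = IsSubfield k₅-isSubfield

  module _ {s} {k : Carrier → Set s} (isSubfield : IsSubfield k) (∋ι : ∀ q → k (ι q)) where
    open IsSubfield isSubfield

    eval-closed : ∀ {n} (P : Poly n) {ρ : Fin n → Carrier} → (∀ i → k (ρ i)) → k (eval P ρ)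
    eval-closed []            kρ = 0-closed
    eval-closed ((a , m) ∷ P) kρ = +-closed (*-closed (∋ι a) (monomial-closed m kρ)) (eval-closed P kρ)
      where
      monomial-closed : ∀ {n} (m : Vec ℕ n) {ρ : Fin n → Carrier} → (∀ i → k (ρ i)) → k (monomial m ρ)
      monomial-closed []      kρ = 1-closed
      monomial-closed (a ∷ m) kρ = *-closed (^-closed a (kρ 0F)) (monomial-closed m (kρ ∘ suc))

  k₁-∋ι : ∀ q → k₁ (ι q)
  k₁-∋ι q = adjoin-⊇ k₀-isSubfield w (k₀-∋ι q)

  k₅-∋ι : ∀ q → k₅ (ι q)
  k₅-∋ι q = adjoin-⊇ k₄-isSubfield y (adjoin-⊇ k₃-isSubfield x
    (adjoin-⊇ k₂-isSubfield (τ 1F) (adjoin-⊇ k₁-isSubfield (τ 0F) (k₁-∋ι q))))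

  -- Dividing the coordinates by Z turns a quotient of forms of equal degree into a fraction in `x`
  -- and `y`.
  everything : ∀ f → k₅ f
  everything f = fraction (generated f)
    where
    χ : Fin 3 → Carrier
    χ = triple x y 1#
    k₅χ : ∀ i → k₅ (χ i)
    k₅χ 0F = adjoin-⊇ k₄-isSubfield y (adjoin-∋ k₃-isSubfield x)
    k₅χ 1F = adjoin-∋ k₄-isSubfield y
    k₅χ 2F = K₅.1-closed
    ξ≈Zχ : ∀ i → ξ i ≈ Z * χ i
    ξ≈Zχ 0F = trans (sym (/-*-cancel (ξ-nonzero 2F))) (*-comm _ _)
    ξ≈Zχ 1F = trans (sym (/-*-cancel (ξ-nonzero 2F))) (*-comm _ _)
    ξ≈Zχ 2F = sym (*-identityʳ Z)
    dehomogenise : ∀ {d} P → Homogeneous d P → eval P ξ ≈ Z ^ d * eval P χ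
    dehomogenise P hP = trans (eval-cong P ξ≈Zχ) (eval-scale P hP χ Z)
    fraction : ∃[ d ] ∃[ P ] ∃[ Q ] Homogeneous d P × Homogeneous d Q × eval Q ξ ≉ 0# × f * eval Q ξ ≈ eval P ξ → k₅ f
    fraction (d , P , Q , hP , hQ , Q≉0 , eq) = K₅.resp (begin
      eval P χ * eval Q χ ⁻¹ ≈⟨ *-congʳ quotient ⟨
      f * eval Q χ * eval Q χ ⁻¹ ≈⟨ *-assoc _ _ _ ⟩
      f * (eval Q χ * eval Q χ ⁻¹) ≈⟨ *-congˡ (⁻¹-inverseʳ Qχ≉0) ⟩
      f * 1# ≈⟨ *-identityʳ f ⟩
      f ∎)
      (K₅.*-closed (eval-closed k₅-isSubfield k₅-∋ι P k₅χ) (K₅.⁻¹-closed Qχ≉0 (eval-closed k₅-isSubfield k₅-∋ι Q k₅χ)))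
      where
      Qχ≉0 : eval Q χ ≉ 0#
      Qχ≉0 = nonzero-*ʳ (nonzero-cong (dehomogenise Q hQ) Q≉0)
      quotient : f * eval Q χ ≈ eval P χ
      quotient = *-cancelˡ-nonzero (^-nonzero d (ξ-nonzero 2F)) (begin
        Z ^ d * (f * eval Q χ)
          ≈⟨ solve 3 (λ z f q → z ⊗ (f ⊗ q) ⊜ f ⊗ (z ⊗ q)) (Z ^ d ∷ f ∷ eval Q χ ∷ []) ⟩
        f * (Z ^ d * eval Q χ) ≈⟨ *-congˡ (dehomogenise Q hQ) ⟨
        f * eval Q ξ ≈⟨ eq ⟩
        eval P ξ ≈⟨ dehomogenise P hP ⟩
        Z ^ d * eval P χ ∎)

  -- N and D both have leading coefficient 28125, so N - βD has leading coefficient 28125 (1 - β).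
  u : Carrier
  u = (# 28125 * (1# - β)) ⁻¹

  lead-nonzero : # 28125 * (1# - β) ≉ 0#
  lead-nonzero = *-nonzero (#-nonzero 28124) λ eq → β-1-nonzero (begin
    β - 1# ≈⟨ solve 1 (λ b → b ⊖ κ 1 ⊜ ⊝ (κ 1 ⊖ b)) (β ∷ []) ⟩
    - (1# - β) ≈⟨ -‿cong eq ⟩
    - 0# ≈⟨ solve 0 (⊝ κ 0 ⊜ κ 0) [] ⟩
    0# ∎)

  u-lead : u * (# 28125 * (1# - β)) ≈ 1#
  u-lead = trans (*-comm _ _) (⁻¹-inverseʳ lead-nonzero)

  w-equation : Vec Carrier 5
  w-equation = Vec.map (λ a → ⟦ a ⟧ₑ (β ∷ u ∷ [])) (w-equationₑ (slot 0F) (slot 1F))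

  w-root : monic w-equation w ≈ 0#
  w-root = begin
    monic w-equation w
      ≈⟨ solve 3 (λ w b u → monicₑ (w-equationₑ b u) w ⊜
           u ⊗ (Nₑ w ⊖ b ⊗ Dₑ w) ⊕ (κ 1 ⊖ u ⊗ (κ 28125 ⊗ (κ 1 ⊖ b))) ⊗ w ⊛ 5) (w ∷ β ∷ u ∷ []) ⟩
    u * (N w - β * D w) + (1# - u * (# 28125 * (1# - β))) * w ^ 5
      ≈⟨ +-cong (*-congˡ (x≈y⇒x-y≈0 (sym β-D))) (*-congʳ (x≈y⇒x-y≈0 (sym u-lead))) ⟩
    u * 0# + 0# * w ^ 5 ≈⟨ trans (+-cong (zeroʳ u) (zeroˡ _)) (+-identityˡ 0#) ⟩
    0# ∎

  -- Multiplying u (N′ - βD′) by D and replacing βD by N gives u (N′D - ND′). The solver needs the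
  -- two relations as explicit error terms, which then vanish.
  w-derivative : monic′ w-equation w * D w ≈
    u * (# 9375 * ((# 3 * w - 1#) * (w + # 5) ^ 2 * Q w * (# 25 * w - # 19) ^ 3))
  w-derivative = begin
    monic′ w-equation w * D w
      ≈⟨ solve 3 (λ w b u → monic′ₑ (w-equationₑ b u) w ⊗ Dₑ w ⊜
           u ⊗ (κ 9375 ⊗ ((κ 3 ⊗ w ⊖ κ 1) ⊗ (w ⊕ κ 5) ⊛ 2 ⊗ Qₑ w ⊗ (κ 25 ⊗ w ⊖ κ 19) ⊛ 3)) ⊕
           (u ⊗ D′ₑ w ⊗ (Nₑ w ⊖ b ⊗ Dₑ w) ⊕ (κ 1 ⊖ u ⊗ (κ 28125 ⊗ (κ 1 ⊖ b))) ⊗ (κ 5 ⊗ w ⊛ 4 ⊗ Dₑ w)))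
           (w ∷ β ∷ u ∷ []) ⟩
    _ + (u * ⟦ D′ₑ (slot 0F) ⟧ₑ (w ∷ []) * (N w - β * D w) + (1# - u * (# 28125 * (1# - β))) * (# 5 * w ^ 4 * D w))
      ≈⟨ +-congˡ (+-cong (trans (*-congˡ (x≈y⇒x-y≈0 (sym β-D))) (zeroʳ _))
           (trans (*-congʳ (x≈y⇒x-y≈0 (sym u-lead))) (zeroˡ _))) ⟩
    _ + (0# + 0#) ≈⟨ trans (+-congˡ (+-identityˡ 0#)) (+-identityʳ _) ⟩
    _ ∎
    where
    D′ₑ : ∀ {n} → Expr n → Expr n
    D′ₑ w = κ 5 ⊗ Qₑ w ⊛ 2 ⊕ (κ 5 ⊗ w ⊖ κ 2) ⊗ κ 2 ⊗ Qₑ w ⊗ (κ 1010 ⊖ κ 150 ⊗ w)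

  τ₀ τ₁ τ₂ : Carrier
  τ₀ = τ 0F
  τ₁ = τ 1F
  τ₂ = τ 2F

  cubic : Vec Carrier 3
  cubic = - (τ₀ * τ₁ * τ₂) ∷ w ∷ - 1# ∷ []

  private
    -- 1 and w are the first two elementary symmetric functions of the τᵢ.
    symmetrise : ∀ (a : Expr 5) → ⟦ a ⟧ₑ (1# ∷ w ∷ τ₀ ∷ τ₁ ∷ τ₂ ∷ []) ≈
      ⟦ a ⟧ₑ (τ₀ + τ₁ + τ₂ ∷ τ₀ * τ₁ + τ₁ * τ₂ + τ₂ * τ₀ ∷ τ₀ ∷ τ₁ ∷ τ₂ ∷ [])
    symmetrise a = ⟦⟧-cong a {1# ∷ w ∷ τ₀ ∷ τ₁ ∷ τ₂ ∷ []}
      {τ₀ + τ₁ + τ₂ ∷ τ₀ * τ₁ + τ₁ * τ₂ + τ₂ * τ₀ ∷ τ₀ ∷ τ₁ ∷ τ₂ ∷ []}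
      λ { 0F → sym τ-sum ; 1F → sym τ-e₂ ; 2F → refl ; 3F → refl ; 4F → refl }

    cubicₑ : ∀ {n} → Expr n → Expr n → Expr n → Expr n → Expr n → Vec (Expr n) 3
    cubicₑ s w a b c = ⊝ (a ⊗ b ⊗ c) ∷ w ∷ ⊝ s ∷ []

    σ₁ₑ σ₂ₑ : ∀ {n} → Expr n → Expr n → Expr n → Expr n
    σ₁ₑ a b c = a ⊕ b ⊕ c
    σ₂ₑ a b c = a ⊗ b ⊕ b ⊗ c ⊕ c ⊗ a

    cubic-at : Expr 5 → Expr 5
    cubic-at = monicₑ (cubicₑ (slot 0F) (slot 1F) (slot 2F) (slot 3F) (slot 4F))

  cubic-root : ∀ i → monic cubic (τ i) ≈ 0#
  cubic-root 0F = trans (symmetrise (cubic-at (slot 2F)))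
    (solve 3 (λ a b c → monicₑ (cubicₑ (σ₁ₑ a b c) (σ₂ₑ a b c) a b c) a ⊜ κ 0) (τ₀ ∷ τ₁ ∷ τ₂ ∷ []))
  cubic-root 1F = trans (symmetrise (cubic-at (slot 3F)))
    (solve 3 (λ a b c → monicₑ (cubicₑ (σ₁ₑ a b c) (σ₂ₑ a b c) a b c) b ⊜ κ 0) (τ₀ ∷ τ₁ ∷ τ₂ ∷ []))
  cubic-root 2F = trans (symmetrise (cubic-at (slot 4F)))
    (solve 3 (λ a b c → monicₑ (cubicₑ (σ₁ₑ a b c) (σ₂ₑ a b c) a b c) c ⊜ κ 0) (τ₀ ∷ τ₁ ∷ τ₂ ∷ []))

  cubic-derivative : monic′ cubic τ₀ ≈ (τ₀ - τ₁) * (τ₀ - τ₂)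
  cubic-derivative = trans (symmetrise (monic′ₑ (cubicₑ (slot 0F) (slot 1F) (slot 2F) (slot 3F) (slot 4F)) (slot 2F)))
    (solve 3 (λ a b c → monic′ₑ (cubicₑ (σ₁ₑ a b c) (σ₂ₑ a b c) a b c) a ⊜ (a ⊖ b) ⊗ (a ⊖ c)) (τ₀ ∷ τ₁ ∷ τ₂ ∷ []))

  cubic-discriminant : # 9 * ((τ₀ - τ₁) * (τ₀ - τ₂) * (τ₁ - τ₂)) ^ 2 ≈ - (# 4 * (# 3 * w - 1#) ^ 2 * (w + # 5))
  cubic-discriminant = begin
    # 9 * ((τ₀ - τ₁) * (τ₀ - τ₂) * (τ₁ - τ₂)) ^ 2
      ≈⟨ solve 3 (λ a b c → κ 9 ⊗ ((a ⊖ b) ⊗ (a ⊖ c) ⊗ (b ⊖ c)) ⊛ 2 ⊜ f (σ₁ₑ a b c) (σ₂ₑ a b c) (κ 9 ⊗ (a ⊗ b ⊗ c)))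
           (τ₀ ∷ τ₁ ∷ τ₂ ∷ []) ⟩
    ⟦ f₅ ⟧ₑ (τ₀ + τ₁ + τ₂ ∷ τ₀ * τ₁ + τ₁ * τ₂ + τ₂ * τ₀ ∷ τ₀ ∷ τ₁ ∷ τ₂ ∷ []) ≈⟨ symmetrise f₅ ⟨
    ⟦ f₅ ⟧ₑ (1# ∷ w ∷ τ₀ ∷ τ₁ ∷ τ₂ ∷ [])
      ≈⟨ ⟦⟧-cong₁ (f (κ 1) (slot 1F) (slot 0F)) (w ∷ []) τ-e₃ ⟩
    ⟦ f (κ 1) (slot 1F) (slot 0F) ⟧ₑ (# 2 - # 5 * w ∷ w ∷ [])
      ≈⟨ solve 1 (λ w → f (κ 1) w (κ 2 ⊖ κ 5 ⊗ w) ⊜ ⊝ (κ 4 ⊗ (κ 3 ⊗ w ⊖ κ 1) ⊛ 2 ⊗ (w ⊕ κ 5))) (w ∷ []) ⟩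
    - (# 4 * (# 3 * w - 1#) ^ 2 * (w + # 5)) ∎
    where
    -- Nine times the discriminant of t³ − s₁ t² + s₂ t − s₃, where n = 9 s₃.
    f : ∀ {n} → Expr n → Expr n → Expr n → Expr n
    f s₁ s₂ n = κ 9 ⊗ s₁ ⊛ 2 ⊗ s₂ ⊛ 2 ⊖ κ 36 ⊗ s₂ ⊛ 3 ⊖ κ 4 ⊗ s₁ ⊛ 3 ⊗ n ⊖ κ 3 ⊗ n ⊛ 2 ⊕ κ 18 ⊗ s₁ ⊗ s₂ ⊗ n
    f₅ : Expr 5
    f₅ = f (slot 0F) (slot 1F) (κ 9 ⊗ (slot 2F ⊗ slot 3F ⊗ slot 4F))

  quadratic-τ : Vec Carrier 2
  quadratic-τ = τ₁ * τ₂ ∷ - (τ₁ + τ₂) ∷ []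

  quadratic-τ-root : monic quadratic-τ τ₁ ≈ 0#
  quadratic-τ-root = solve 2 (λ b c → monicₑ (b ⊗ c ∷ ⊝ (b ⊕ c) ∷ []) b ⊜ κ 0) (τ₁ ∷ τ₂ ∷ [])

  quadratic-τ-derivative : monic′ quadratic-τ τ₁ ≈ τ₁ - τ₂
  quadratic-τ-derivative = solve 2 (λ b c → monic′ₑ (b ⊗ c ∷ ⊝ (b ⊕ c) ∷ []) b ⊜ b ⊖ c) (τ₁ ∷ τ₂ ∷ [])

  square : Carrier → Vec Carrier 2
  square z = - (z ^ 2) ∷ 0# ∷ []

  square-root : ∀ z → monic (square z) z ≈ 0#
  square-root z = solve 1 (λ z → monicₑ (⊝ (z ⊛ 2) ∷ κ 0 ∷ []) z ⊜ κ 0) (z ∷ [])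

  square-derivative : ∀ z → monic′ (square z) z ≈ # 2 * z
  square-derivative z = solve 1 (λ z → monic′ₑ (⊝ (z ⊛ 2) ∷ κ 0 ∷ []) z ⊜ κ 2 ⊗ z) (z ∷ [])

  -- Hence x² = τ₀/τ₂ and y² = τ₁/τ₂ already lie in `k₃`, and the last two steps of the tower are
  -- square roots.
  coordinate-ratio : ∀ i → (ξ i / Z) ^ 2 * τ₂ ≈ τ i
  coordinate-ratio i = begin
    (ξ i * Z ⁻¹) ^ 2 * (Z ^ 2 * r⁻¹)
      ≈⟨ solve 4 (λ x z j r → (x ⊗ j) ⊛ 2 ⊗ (z ⊛ 2 ⊗ r) ⊜ x ⊛ 2 ⊗ r ⊗ (z ⊗ j) ⊛ 2) (ξ i ∷ Z ∷ Z ⁻¹ ∷ r⁻¹ ∷ []) ⟩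
    ξ i ^ 2 * r⁻¹ * (Z * Z ⁻¹) ^ 2 ≈⟨ *-congˡ (^-congˡ 2 (⁻¹-inverseʳ (ξ-nonzero 2F))) ⟩
    ξ i ^ 2 * r⁻¹ * 1# ^ 2 ≈⟨ solve 1 (λ t → t ⊗ κ 1 ⊛ 2 ⊜ t) (τ i ∷ []) ⟩
    τ i ∎

  τ-nonzero : ∀ i → τ i ≉ 0#
  τ-nonzero i = *-nonzero (^-nonzero 2 (ξ-nonzero i)) (⁻¹-nonzero r-nonzero)

  module _ {s} {k : Carrier → Set s} (isSubfield : IsSubfield k) (∋τ₂ : k τ₂) where
    open IsSubfield isSubfield

    square-closed : ∀ i → k (τ i) → Allⱽ k (square (ξ i / Z))
    square-closed i kτ = neg-closed (resp (begin
      τ i * τ₂ ⁻¹ ≈⟨ *-congʳ (coordinate-ratio i) ⟨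
      (ξ i / Z) ^ 2 * τ₂ * τ₂ ⁻¹ ≈⟨ *-assoc _ _ _ ⟩
      (ξ i / Z) ^ 2 * (τ₂ * τ₂ ⁻¹) ≈⟨ *-congˡ (⁻¹-inverseʳ (τ-nonzero 2F)) ⟩
      (ξ i / Z) ^ 2 * 1# ≈⟨ *-identityʳ _ ⟩
      (ξ i / Z) ^ 2 ∎) (*-closed kτ (⁻¹-closed (τ-nonzero 2F) ∋τ₂))) ∷ 0-closed ∷ []

  w-equation-closed : Allⱽ k₀ w-equation
  w-equation-closed = Allⱽ.map⁺ (Allⱽ.universal member (w-equationₑ (slot 0F) (slot 1F)))
    where
    ku : k₀ u
    ku = K₀.⁻¹-closed lead-nonzero (K₀.*-closed (k₀-∋ι _) (K₀.minus-closed K₀.1-closed k₀-∋β))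
    member : ∀ a → k₀ (⟦ a ⟧ₑ (β ∷ u ∷ []))
    member a = K₀.expr-closed k₀-∋ι a {β ∷ u ∷ []} λ { 0F → k₀-∋β ; 1F → ku }

  cubic-closed : Allⱽ k₁ cubic
  cubic-closed = K₁.neg-closed (K₁.resp (*-cancelˡ-nonzero (#-nonzero 8) (begin
      # 9 * ((# 9) ⁻¹ * (# 2 - # 5 * w))
        ≈⟨ solve 3 (λ n j z → n ⊗ (j ⊗ z) ⊜ n ⊗ j ⊗ z) (# 9 ∷ (# 9) ⁻¹ ∷ # 2 - # 5 * w ∷ []) ⟩
      # 9 * (# 9) ⁻¹ * (# 2 - # 5 * w) ≈⟨ *-congʳ (⁻¹-inverseʳ (#-nonzero 8)) ⟩
      1# * (# 2 - # 5 * w) ≈⟨ *-identityˡ _ ⟩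
      # 2 - # 5 * w ≈⟨ τ-e₃ ⟨
      # 9 * (τ₀ * τ₁ * τ₂) ∎))
      (K₁.*-closed (K₁.⁻¹-closed (#-nonzero 8) (k₁-∋ι _))
        (K₁.minus-closed (k₁-∋ι _) (K₁.*-closed (k₁-∋ι _) ∋w)))) ∷ ∋w ∷ K₁.neg-closed K₁.1-closed ∷ []
    where
    ∋w : k₁ w
    ∋w = adjoin-∋ k₀-isSubfield w

  k₂-∋τ₀ : k₂ τ₀
  k₂-∋τ₀ = adjoin-∋ k₁-isSubfield τ₀

  quadratic-τ-closed : Allⱽ k₂ quadratic-τ
  quadratic-τ-closed = K₂.resp product (K₂.minus-closed ∋w (K₂.*-closed k₂-∋τ₀ ∋sum)) ∷
    K₂.neg-closed (K₂.resp sum ∋sum) ∷ []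
    where
    ∋w : k₂ w
    ∋w = adjoin-⊇ k₁-isSubfield τ₀ (adjoin-∋ k₀-isSubfield w)
    ∋sum : k₂ (1# - τ₀)
    ∋sum = K₂.minus-closed K₂.1-closed k₂-∋τ₀
    sum : 1# - τ₀ ≈ τ₁ + τ₂
    sum = trans (symmetrise (slot 0F ⊖ slot 2F))
      (solve 3 (λ a b c → σ₁ₑ a b c ⊖ a ⊜ b ⊕ c) (τ₀ ∷ τ₁ ∷ τ₂ ∷ []))
    product : w - τ₀ * (1# - τ₀) ≈ τ₁ * τ₂
    product = trans (symmetrise (slot 1F ⊖ slot 2F ⊗ (slot 0F ⊖ slot 2F)))
      (solve 3 (λ a b c → σ₂ₑ a b c ⊖ a ⊗ (σ₁ₑ a b c ⊖ a) ⊜ b ⊗ c) (τ₀ ∷ τ₁ ∷ τ₂ ∷ []))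

  k₃-∋τ₀ : k₃ τ₀
  k₃-∋τ₀ = adjoin-⊇ k₂-isSubfield τ₁ k₂-∋τ₀

  k₃-∋τ₁ : k₃ τ₁
  k₃-∋τ₁ = adjoin-∋ k₂-isSubfield τ₁

  k₃-∋τ₂ : k₃ τ₂
  k₃-∋τ₂ = K₃.resp (trans (symmetrise (slot 0F ⊖ slot 2F ⊖ slot 3F))
      (solve 3 (λ a b c → σ₁ₑ a b c ⊖ a ⊖ b ⊜ c) (τ₀ ∷ τ₁ ∷ τ₂ ∷ [])))
    (K₃.minus-closed (K₃.minus-closed K₃.1-closed k₃-∋τ₀) k₃-∋τ₁)

  x-equation-closed : Allⱽ k₃ (square x)
  x-equation-closed = square-closed k₃-isSubfield k₃-∋τ₂ 0F k₃-∋τ₀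

  y-equation-closed : Allⱽ k₄ (square y)
  y-equation-closed =
    square-closed k₄-isSubfield (adjoin-⊇ k₃-isSubfield x k₃-∋τ₂) 1F (adjoin-⊇ k₃-isSubfield x k₃-∋τ₁)

-- Descent of invariant functions to ℚ(β).

module WimanDescent {c ℓ} (W̃ : FunctionField wiman c ℓ) where
  open FunctionField W̃
  open Curve W̃ using (Automorphism; ⟦_⟧; _∘ₐ_; Invariant)
  open Identities fieldOverℚ
  open FieldLemmas fieldOverℚ
  open Subfields fieldOverℚ
  open GenericPoint W̃ using (module AutomorphismLemmas)
  open WimanBasics W̃
  open WimanSymmetries W̃
  open WimanInvariance W̃
  open WimanTower W̃
  open Wiman W̃ using (β)
  open import Relation.Binary.Reasoning.Setoid setoid

  private
    X = ξ 0F
    Y = ξ 1F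
    Z = ξ 2F

  module FixedFields (σ : Automorphism) where
    open AutomorphismLemmas σ renaming (⟦⟧-cong to σ-cong)

    σ-eval : ∀ {n} (P : Poly n) ρ → ⟦ σ ⟧ (eval P ρ) ≈ eval P (λ i → ⟦ σ ⟧ (ρ i))
    σ-eval []            ρ = σ-0
    σ-eval ((a , m) ∷ P) ρ = trans (σ-+ _ _)
      (+-cong (trans (σ-* _ _) (*-cong (Automorphism.fixesℚ σ a) (σ-monomial m ρ))) (σ-eval P ρ))
      where
      σ-monomial : ∀ {n} (m : Vec ℕ n) ρ → ⟦ σ ⟧ (monomial m ρ) ≈ monomial m (λ i → ⟦ σ ⟧ (ρ i))
      σ-monomial []      ρ = σ-1
      σ-monomial (a ∷ m) ρ = trans (σ-* _ _) (*-cong (σ-^ (ρ 0F) a) (σ-monomial m (ρ ∘ suc)))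

    fixes-quotient : ∀ {f p q} → q ≉ 0# → f * q ≈ p → ⟦ σ ⟧ p ≈ p → ⟦ σ ⟧ q ≈ q → ⟦ σ ⟧ f ≈ f
    fixes-quotient {f} {p} {q} q≉0 eq σp σq = *-cancelˡ-nonzero q≉0 (begin
      q * ⟦ σ ⟧ f ≈⟨ *-comm _ _ ⟩
      ⟦ σ ⟧ f * q ≈⟨ *-congˡ σq ⟨
      ⟦ σ ⟧ f * ⟦ σ ⟧ q ≈⟨ σ-* f q ⟨
      ⟦ σ ⟧ (f * q) ≈⟨ σ-cong eq ⟩
      ⟦ σ ⟧ p ≈⟨ trans σp (sym eq) ⟩
      f * q ≈⟨ *-comm _ _ ⟩
      q * f ∎)

    fixes-k₀ : ⟦ σ ⟧ β ≈ β → ∀ {f} → k₀ f → ⟦ σ ⟧ f ≈ f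
    fixes-k₀ σβ {f} (p , q , q≉0 , eq) = fixes-quotient q≉0 eq (fixed p) (fixed q)
      where
      fixed : ∀ (p : Poly 1) → ⟦ σ ⟧ (eval p (λ _ → β)) ≈ eval p (λ _ → β)
      fixed p = trans (σ-eval p (λ _ → β)) (eval-cong p (λ _ → σβ))

    fixes-adjoin : ∀ {s} {k : Carrier → Set s} {α} → (∀ {a} → k a → ⟦ σ ⟧ a ≈ a) → ⟦ σ ⟧ α ≈ α →
      ∀ {f} → Adjoin k α f → ⟦ σ ⟧ f ≈ f
    fixes-adjoin {α = α} fixes σα (p , q , kp , kq , q≉0 , eq) = fixes-quotient q≉0 eq (fixed kp) (fixed kq)
      where
      fixed : ∀ {p} → All _ p → ⟦ σ ⟧ (evalᵁ p α) ≈ evalᵁ p α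
      fixed {p} kp = trans (σ-evalᵁ (All.map fixes kp) α) (evalᵁ-cong p σα)

  τ-r : ∀ i → τ i * r ξ ≈ ξ i ^ 2
  τ-r i = /-*-cancel r-nonzero

  τ-image : ∀ {σ P} → Induces σ P → r P ≈ r ξ → ∀ i j → P i ^ 2 ≈ ξ j ^ 2 → ⟦ σ ⟧ (τ i) ≈ τ j
  τ-image {σ} {P} ind rP≈r i j P²≈ξ² = *-cancelˡ-nonzero r-nonzero (begin
    r ξ * ⟦ σ ⟧ (τ i) ≈⟨ *-comm _ _ ⟩
    ⟦ σ ⟧ (τ i) * r ξ ≈⟨ *-congˡ rP≈r ⟨
    ⟦ σ ⟧ (τ i) * r P
      ≈⟨ proj₂ (fraction-image {σ} {P} (slot i ⊛ 2) (rₑ Xₑ Yₑ Zₑ) ≡.refl ind r-nonzero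
           (trans (τ-r i) (^-congˡ 2 (sym (coordinates-lookup ξ i))))) ⟩
    lookup (coordinates P) i ^ 2 ≈⟨ trans (^-congˡ 2 (coordinates-lookup P i)) P²≈ξ² ⟩
    ξ j ^ 2 ≈⟨ τ-r j ⟨
    τ j * r ξ ≈⟨ *-comm _ _ ⟩
    r ξ * τ j ∎)

  flip-square : ∀ j i → act (flipₑ j) ξ i ^ 2 ≈ ξ i ^ 2
  flip-square j i with does (j Fin.≟ i)
  ... | true  = trans (solve 1 (λ x → (⊝ x) ⊛ 2 ⊜ x ⊛ 2) (lookup (coordinates ξ) i ∷ [])) (^-congˡ 2 (coordinates-lookup ξ i))
  ... | false = ^-congˡ 2 (coordinates-lookup ξ i)

  flip-τ : ∀ j i → ⟦ flipₐ j ⟧ (τ i) ≈ τ i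
  flip-τ j i = τ-image {flipₐ j} {act (flipₑ j) ξ} (Symmetry.induces (flip j))
    (+-cong (+-cong (flip-square j 0F) (flip-square j 1F)) (flip-square j 2F)) i i (flip-square j i)

  ratio-image : ∀ {σ P} → Induces σ P → P 2F ≈ Z → ∀ i {z} → z * Z ≈ P i → ⟦ σ ⟧ (ξ i / Z) ≈ z
  ratio-image {σ} {P} ind P₂≈Z i {z} eq = *-cancelˡ-nonzero (ξ-nonzero 2F) (begin
    Z * ⟦ σ ⟧ (ξ i / Z) ≈⟨ *-comm _ _ ⟩
    ⟦ σ ⟧ (ξ i / Z) * Z ≈⟨ *-congˡ P₂≈Z ⟨
    ⟦ σ ⟧ (ξ i / Z) * P 2F
      ≈⟨ proj₂ (fraction-image {σ} {P} (slot i) Zₑ ≡.refl ind (ξ-nonzero 2F)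
           (trans (/-*-cancel (ξ-nonzero 2F)) (sym (coordinates-lookup ξ i)))) ⟩
    lookup (coordinates P) i ≈⟨ trans (coordinates-lookup P i) (sym eq) ⟩
    z * Z ≈⟨ *-comm _ _ ⟩
    Z * z ∎)

  -ratio : ∀ i → - (ξ i / Z) * Z ≈ - ξ i
  -ratio i = trans (solve 2 (λ a z → ⊝ a ⊗ z ⊜ ⊝ (a ⊗ z)) (ξ i / Z ∷ Z ∷ [])) (-‿cong (/-*-cancel (ξ-nonzero 2F)))

  flip₀-x : ⟦ flipₐ 0F ⟧ x ≈ - x
  flip₀-x = ratio-image {flipₐ 0F} {act (flipₑ 0F) ξ} (Symmetry.induces (flip 0F)) refl 0F (-ratio 0F)

  flip₁-x : ⟦ flipₐ 1F ⟧ x ≈ x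
  flip₁-x = ratio-image {flipₐ 1F} {act (flipₑ 1F) ξ} (Symmetry.induces (flip 1F)) refl 0F (/-*-cancel (ξ-nonzero 2F))

  flip₁-y : ⟦ flipₐ 1F ⟧ y ≈ - y
  flip₁-y = ratio-image {flipₐ 1F} {act (flipₑ 1F) ξ} (Symmetry.induces (flip 1F)) refl 1F (-ratio 1F)

  opposite-distinct : ∀ i → ξ i / Z ≉ - (ξ i / Z)
  opposite-distinct i eq = *-nonzero (#-nonzero 1) (*-nonzero (ξ-nonzero i) (⁻¹-nonzero (ξ-nonzero 2F))) (begin
    # 2 * (ξ i / Z) ≈⟨ solve 1 (λ a → κ 2 ⊗ a ⊜ a ⊖ ⊝ a) (ξ i / Z ∷ []) ⟩
    ξ i / Z - - (ξ i / Z) ≈⟨ x≈y⇒x-y≈0 eq ⟩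
    0# ∎)

  τ-distinct : ∀ {i j} → ξ i ^ 2 - ξ j ^ 2 ≉ 0# → τ i ≉ τ j
  τ-distinct {i} {j} ξ≉ eq = ξ≉ (x≈y⇒x-y≈0 (trans (sym (τ-r i)) (trans (*-congʳ eq) (τ-r j))))

  h-β : ⟦ h ⟧ β ≈ β
  h-β = β-fixed h (M-correspondence v M-w-v)

  module SwapAction {g} (s : Symmetry g) (r≈ : r (act g ξ) ≈ r ξ) (e≈ : e (act g ξ) ≈ e ξ) where
    swap-w : ⟦ Symmetry.σ s ⟧ w ≈ w
    swap-w = w-fixed {Symmetry.σ s} {act g ξ} (Symmetry.induces s) r≈ e≈

    open FixedFields (Symmetry.σ s)

    swap-k₁ : ∀ {f} → k₁ f → ⟦ Symmetry.σ s ⟧ f ≈ f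
    swap-k₁ = fixes-adjoin {k = k₀} (fixes-k₀ (β-fixed-w (Symmetry.σ s) swap-w)) swap-w

    swap-τ : ∀ i j → act g ξ i ^ 2 ≈ ξ j ^ 2 → ⟦ Symmetry.σ s ⟧ (τ i) ≈ τ j
    swap-τ = τ-image {Symmetry.σ s} {act g ξ} (Symmetry.induces s) r≈

  module XY = SwapAction swapXY
    (solve 3 (λ x y z → rₑ y x z ⊜ rₑ x y z) (X ∷ Y ∷ Z ∷ [])) (solve 3 (λ x y z → eₑ y x z ⊜ eₑ x y z) (X ∷ Y ∷ Z ∷ []))
  module XZ = SwapAction swapXZ
    (solve 3 (λ x y z → rₑ z y x ⊜ rₑ x y z) (X ∷ Y ∷ Z ∷ [])) (solve 3 (λ x y z → eₑ z y x ⊜ eₑ x y z) (X ∷ Y ∷ Z ∷ []))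
  module YZ = SwapAction swapYZ
    (solve 3 (λ x y z → rₑ x z y ⊜ rₑ x y z) (X ∷ Y ∷ Z ∷ [])) (solve 3 (λ x y z → eₑ x z y ⊜ eₑ x y z) (X ∷ Y ∷ Z ∷ []))

  flip-k₃ : ∀ j {f} → k₃ f → ⟦ flipₐ j ⟧ f ≈ f
  flip-k₃ j = fixes-adjoin {k = k₂} (fixes-adjoin {k = k₁} (fixes-adjoin {k = k₀}
    (fixes-k₀ (β-fixed-w (flipₐ j) (flip-w j))) (flip-w j)) (flip-τ j 0F)) (flip-τ j 1F)
    where open FixedFields (flipₐ j)

  module _ {f} (invariant : Invariant f) where
    private
      itself : ∀ {s} {k : Carrier → Set s} {α} → Conjugate k f α α
      itself p q kp kq eq = eq

      conjugate-by : ∀ {s} {k : Carrier → Set s} σ → (∀ {a} → k a → ⟦ σ ⟧ a ≈ a) → ∀ {α α′} → ⟦ σ ⟧ α ≈ α′ →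
        Conjugate k f α α′
      conjugate-by {k = k} σ fixes = AutomorphismLemmas.conjugate σ {k = k} fixes (invariant σ)

    -- In this and the following steps, automorphisms fixing the smaller field carry the generator
    -- to its other conjugates. The sign change of Y sends y to -y and fixes x, that of X sends x to
    -- -x. Exchanging Y and Z fixes τ₀ and sends τ₁ to τ₂; exchanging X with Y or Z sends τ₀ to τ₁
    -- or τ₂. Over ℚ(β) the list is `conjugates`.
    invariant-k₄ : k₄ f
    invariant-k₄ = descent k₄-isSubfield {g = square y} y-equation-closed (square-root y) (y ∷ - y ∷ [])
      ((opposite-distinct 1F ∷ []) ∷ [] ∷ [])
      (itself {k = k₄} ∷ conjugate-by {k = k₄} (flipₐ 1F)
        (FixedFields.fixes-adjoin (flipₐ 1F) {k = k₃} (flip-k₃ 1F) flip₁-x) flip₁-y ∷ [])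
      (everything f)

    invariant-k₃ : k₃ f
    invariant-k₃ = descent k₃-isSubfield {g = square x} x-equation-closed (square-root x) (x ∷ - x ∷ [])
      ((opposite-distinct 0F ∷ []) ∷ [] ∷ [])
      (itself {k = k₃} ∷ conjugate-by {k = k₃} (flipₐ 0F) (flip-k₃ 0F) flip₀-x ∷ [])
      invariant-k₄

    invariant-k₂ : k₂ f
    invariant-k₂ = descent k₂-isSubfield {g = quadratic-τ} quadratic-τ-closed quadratic-τ-root (τ₁ ∷ τ₂ ∷ [])
      ((τ-distinct Y²-Z²-nonzero ∷ []) ∷ [] ∷ [])
      (itself {k = k₂} ∷ conjugate-by {k = k₂} (Symmetry.σ swapYZ)
        (FixedFields.fixes-adjoin (Symmetry.σ swapYZ) {k = k₁} YZ.swap-k₁ (YZ.swap-τ 0F 0F refl)) (YZ.swap-τ 1F 2F refl) ∷ [])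
      invariant-k₃

    invariant-k₁ : k₁ f
    invariant-k₁ = descent k₁-isSubfield {g = cubic} cubic-closed (cubic-root 0F) (τ₀ ∷ τ₁ ∷ τ₂ ∷ [])
      ((τ-distinct X²-Y²-nonzero ∷ τ-distinct X²-Z²-nonzero ∷ []) ∷ (τ-distinct Y²-Z²-nonzero ∷ []) ∷ [] ∷ [])
      (itself {k = k₁} ∷ conjugate-by {k = k₁} (Symmetry.σ swapXY) XY.swap-k₁ (XY.swap-τ 0F 1F refl) ∷
        conjugate-by {k = k₁} (Symmetry.σ swapXZ) XZ.swap-k₁ (XZ.swap-τ 0F 2F refl) ∷ [])
      invariant-k₂

    invariant-k₀ : k₀ f
    invariant-k₀ = descent k₀-isSubfield {g = w-equation} w-equation-closed w-root conjugates conjugates-distinct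
      (itself {k = k₀} ∷ conjugate-by {k = k₀} h (FixedFields.fixes-k₀ h h-β) refl ∷
        flipped 0F ∷ flipped 1F ∷ flipped 2F ∷ [])
      invariant-k₁
      where
      flipped : ∀ j → Conjugate k₀ f w (⟦ flipₐ j ⟧ v)
      flipped j = conjugate-by {k = k₀} (flipₐ j ∘ₐ h) (FixedFields.fixes-k₀ (flipₐ j ∘ₐ h)
        (trans (AutomorphismLemmas.⟦⟧-cong (flipₐ j) h-β) (β-fixed-w (flipₐ j) (flip-w j)))) refl

-- Ramification of β outside 0, 1 and ∞.

module WimanRamification {c ℓ} (W̃ : FunctionField wiman c ℓ) (pt : Curve.ClosedPoint W̃) where
  open FunctionField W̃
  open Curve W̃ using (LocalParameter; Ramified; HasValue; HasPole)
  open Curve.ClosedPoint pt renaming (v to ord; v-* to ord-*; v-cong to ord-cong)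
  open Identities fieldOverℚ
  open FieldLemmas fieldOverℚ
  open Subfields fieldOverℚ
  open Valuations W̃ pt
  open WimanBasics W̃
  open WimanTower W̃
  open Wiman W̃ using (β)
  open import Relation.Binary.Reasoning.Setoid setoid

  private
    module Intᴿ = IsSubring int-isSubring

    int-expr : ∀ {n} (a : Expr n) {ρ} → (∀ i → Int (lookup ρ i)) → Int (⟦ a ⟧ₑ ρ)
    int-expr = Intᴿ.expr-closed atLeast-ι

  #-unit : ∀ n → Unit (# (suc n))
  #-unit n = ι-unit λ q≡0 → #-nonzero n (trans (ι-cong q≡0) ι-0)

  unit-+-pos : ∀ {a b} → Unit a → Pos b → Unit (a + b)
  unit-+-pos {a} {b} ua pb = ¬pos⇒unit (atLeast-+ (unit⇒int ua) (pos⇒int pb)) λ pab → unit⇒¬pos ua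
    (atLeast-cong (solve 2 (λ a b → a ⊕ b ⊖ b ⊜ a) (a ∷ b ∷ [])) (atLeast-+ pab (int-neg pb)))

  unit-neg : ∀ {a} → Unit a → Unit (- a)
  unit-neg {a} ua = ¬pos⇒unit (int-neg (unit⇒int ua)) λ p → unit⇒¬pos ua
    (atLeast-cong (solve 1 (λ a → ⊝ (⊝ a) ⊜ a) (a ∷ [])) (int-neg p))

  unit-^ : ∀ {a} n → Unit a → Unit (a ^ n)
  unit-^ zero    ua = unit-1
  unit-^ (suc n) ua = unit-* ua (unit-^ n ua)

  unit-root : ∀ {a} n → Int a → Unit (a ^ suc n) → Unit a
  unit-root n ia = unit-factorˡ ia (Intᴿ.^-closed n ia)

  -- A positive value on ℚ(β) is at least `ord π` by minimality, so dividing by π lowers it without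
  -- making it negative; induction on a bound exhausts it. Negative values are reduced to positive
  -- ones by inversion.
  parameter-divides : ∀ {π} → LocalParameter pt β π → ∀ {f} → k₀ f → f ≉ 0# → ord π ∣ ord f
  parameter-divides {π} (kπ , π≉0 , 0<π , minimal) {f} kf f≉0 = by-sign (ℤ.≤-total 0ℤ (ord f))
    where
    positive : ∀ b {f} → k₀ f → f ≉ 0# → 0ℤ ℤ.≤ ord f → ord f ℤ.≤ + b → ord π ∣ ord f
    positive b {f} kf f≉0 0≤f f≤b = decide (ord f ℤ.≟ 0ℤ)
      where
      g : Carrier
      g = f * π ⁻¹
      g≉0 : g ≉ 0#
      g≉0 = *-nonzero f≉0 (⁻¹-nonzero π≉0)
      ord-g : ord g ≡ ord f ℤ.- ord π
      ord-g = ≡.trans (ord-* f≉0 (⁻¹-nonzero π≉0)) (≡.cong (λ t → ord f ℤ.+ t) (v-⁻¹ π≉0))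
      split : ord g ℤ.+ ord π ≡ ord f
      split = ≡.trans (≡.cong (ℤ._+ ord π) ord-g) (≡.trans (ℤ.+-assoc (ord f) (ℤ.- ord π) (ord π))
        (≡.trans (≡.cong (λ t → ord f ℤ.+ t) (ℤ.+-inverseˡ (ord π))) (ℤ.+-identityʳ (ord f))))
      0≤g : 0ℤ ℤ.< ord f → 0ℤ ℤ.≤ ord g
      0≤g 0<f = ≡.subst (0ℤ ℤ.≤_) (≡.sym ord-g) (ℤ.i≤j⇒0≤j-i (minimal f kf f≉0 0<f))
      g<f : ord g ℤ.< ord f
      g<f = ≡.subst₂ ℤ._<_ (ℤ.+-identityʳ (ord g)) split (ℤ.+-monoʳ-< (ord g) 0<π)
      recurse : ∀ b → 0ℤ ℤ.< ord f → ord f ℤ.≤ + b → ord π ∣ ord g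
      recurse zero    0<f f≤0 = ⊥-elim (ℤ.<⇒≱ 0<f f≤0)
      recurse (suc b) 0<f f≤b = positive b (K₀.*-closed kf (K₀.⁻¹-closed π≉0 kπ)) g≉0 (0≤g 0<f)
        (ℤ.i<j⇒i≤pred[j] {ord g} {+ suc b} (ℤ.<-≤-trans g<f f≤b))
      decide : Dec (ord f ≡ 0ℤ) → ord π ∣ ord f
      decide (yes f≡0) = ≡.subst (ord π ∣_) (≡.sym f≡0) (divides 0ℤ ≡.refl)
      decide (no  f≢0) = ≡.subst (ord π ∣_) split
        (∣m∣n⇒∣m+n (recurse b (ℤ.≤∧≢⇒< 0≤f (f≢0 ∘ ≡.sym)) f≤b) ∣-refl)
    bounded : ∀ {f} → k₀ f → f ≉ 0# → 0ℤ ℤ.≤ ord f → ord π ∣ ord f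
    bounded {f} kf f≉0 0≤f = positive ℤ.∣ ord f ∣ kf f≉0 0≤f (ℤ.≤-reflexive (≡.sym (ℤ.0≤i⇒+∣i∣≡i 0≤f)))
    by-sign : 0ℤ ℤ.≤ ord f ⊎ ord f ℤ.≤ 0ℤ → ord π ∣ ord f
    by-sign (inj₁ 0≤f) = bounded kf f≉0 0≤f
    by-sign (inj₂ f≤0) = ≡.subst (ord π ∣_) (≡.trans (≡.cong ℤ.-_ (v-⁻¹ f≉0)) (ℤ.neg-involutive (ord f)))
      (∣m⇒∣-m (bounded (K₀.⁻¹-closed f≉0 kf) (⁻¹-nonzero f≉0)
        (≡.subst (0ℤ ℤ.≤_) (≡.sym (v-⁻¹ f≉0)) (ℤ.neg-mono-≤ f≤0))))

  module Unramified (unit-β : Unit β) (unit-β-1 : Unit (β - 1#)) where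

    unit-1-β : Unit (1# - β)
    unit-1-β = unit-cong (solve 1 (λ b → ⊝ (b ⊖ κ 1) ⊜ κ 1 ⊖ b) (β ∷ [])) (unit-neg unit-β-1)

    unit-u : Unit u
    unit-u = unit-⁻¹ (unit-* (#-unit 28124) unit-1-β)

    int-βu : ∀ i → Int (lookup (β ∷ u ∷ []) i)
    int-βu 0F = unit⇒int unit-β
    int-βu 1F = unit⇒int unit-u

    w-equation-int : Allⱽ Int w-equation
    w-equation-int = Allⱽ.map⁺ (Allⱽ.universal (λ a → int-expr a {β ∷ u ∷ []} int-βu) (w-equationₑ (slot 0F) (slot 1F)))

    int-w : Int w
    int-w = integrally-closed {g = w-equation} w-equation-int w-root

    int-expr-w : (a : Expr 1) → Int (⟦ a ⟧ₑ (w ∷ []))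
    int-expr-w a = int-expr a {w ∷ []} λ { 0F → int-w }

    int-D : Int (D w)
    int-D = int-expr-w (Dₑ (slot 0F))

    int-Q : Int (Q w)
    int-Q = int-expr-w (Qₑ (slot 0F))

    ¬pos-N-unit-D : Pos (N w) → ¬ Unit (D w)
    ¬pos-N-unit-D pN uD = unit⇒¬pos (unit-cong β-D (unit-* unit-β uD)) pN

    -- N and D have no common root: if 3w - 1 were in the maximal ideal, N would be too while D
    -- would be a unit, which contradicts βD = N for a unit β.
    unit-3w-1 : Unit (# 3 * w - 1#)
    unit-3w-1 = ¬pos⇒unit (int-expr-w (κ 3 ⊗ slot 0F ⊖ κ 1)) λ pos → ¬pos-N-unit-D
      (atLeast-cong (solve 1 (λ w → (κ 3 ⊗ w ⊖ κ 1) ⊗ (κ 3125 ⊗ (κ 3 ⊗ w ⊖ κ 1) ⊗ (w ⊕ κ 5) ⊛ 3) ⊜ Nₑ w) (w ∷ []))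
        (atLeast-* pos (int-expr-w (κ 3125 ⊗ (κ 3 ⊗ slot 0F ⊖ κ 1) ⊗ (slot 0F ⊕ κ 5) ⊛ 3))))
      (unit-factorʳ (unit⇒int (#-unit 242)) int-D (unit-cong
        -- The constant is 243 D(1/3), and `sₑ` is the quotient of 243 D(w) - 243 D(1/3) by 3w - 1.
        -- The factor 243 = 3⁵ clears the denominators.
        (solve 1 (λ w → ⊝ κ 9437184 ⊕ (κ 3 ⊗ w ⊖ κ 1) ⊗ sₑ w ⊜ κ 243 ⊗ Dₑ w) (w ∷ []))
        (unit-+-pos (unit-neg (#-unit 9437183)) (atLeast-* pos (int-expr-w (sₑ (slot 0F)))))))
      where
      sₑ : ∀ {n} → Expr n → Expr n
      sₑ w = κ 2278125 ⊗ w ⊛ 4 ⊖ κ 61509375 ⊗ w ⊛ 3 ⊕ κ 416390625 ⊗ w ⊛ 2 ⊖ κ 15508125 ⊗ w ⊖ κ 9355050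

    -- As for 3w - 1: D does not vanish at the root -5 of N.
    unit-w+5 : Unit (w + # 5)
    unit-w+5 = ¬pos⇒unit (int-expr-w (slot 0F ⊕ κ 5)) λ pos → ¬pos-N-unit-D
      (atLeast-cong (solve 1 (λ w → (w ⊕ κ 5) ⊗ (κ 3125 ⊗ (κ 3 ⊗ w ⊖ κ 1) ⊛ 2 ⊗ (w ⊕ κ 5) ⊛ 2) ⊜ Nₑ w) (w ∷ []))
        (atLeast-* pos (int-expr-w (κ 3125 ⊗ (κ 3 ⊗ slot 0F ⊖ κ 1) ⊛ 2 ⊗ (slot 0F ⊕ κ 5) ⊛ 2))))
      (unit-cong
        -- The constant is D(-5), and `sₑ` is the quotient of D(w) - D(-5) by w + 5.
        (solve 1 (λ w → ⊝ κ 1289945088 ⊕ (w ⊕ κ 5) ⊗ sₑ w ⊜ Dₑ w) (w ∷ []))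
        (unit-+-pos (unit-neg (#-unit 1289945087)) (atLeast-* pos (int-expr-w (sₑ (slot 0F))))))
      where
      sₑ : ∀ {n} → Expr n → Expr n
      sₑ w = κ 28125 ⊗ w ⊛ 4 ⊖ κ 909375 ⊗ w ⊛ 3 ⊕ κ 9940625 ⊗ w ⊛ 2 ⊖ κ 51608125 ⊗ w ⊕ κ 257988950

    unit-N : Unit (N w)
    unit-N = unit-* (unit-* (#-unit 3124) (unit-^ 2 unit-3w-1)) (unit-^ 3 unit-w+5)

    unit-D : Unit (D w)
    unit-D = unit-factorʳ (unit⇒int unit-β) int-D (unit-cong (sym β-D) unit-N)

    unit-5w-2 : Unit (# 5 * w - # 2)
    unit-5w-2 = unit-factorˡ (int-expr-w (κ 5 ⊗ slot 0F ⊖ κ 2)) (Intᴿ.^-closed 2 int-Q) unit-D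

    unit-Q : Unit (Q w)
    unit-Q = unit-root 1 int-Q (unit-factorʳ (int-expr-w (κ 5 ⊗ slot 0F ⊖ κ 2)) (Intᴿ.^-closed 2 int-Q) unit-D)

    unit-25w-19 : Unit (# 25 * w - # 19)
    unit-25w-19 = unit-root 3 int-25w-19 (unit-factorʳ (unit⇒int (#-unit 2)) (Intᴿ.^-closed 4 int-25w-19)
      (unit-cong β-1-D (unit-* unit-β-1 unit-D)))
      where
      int-25w-19 : Int (# 25 * w - # 19)
      int-25w-19 = int-expr-w (κ 25 ⊗ slot 0F ⊖ κ 19)

    -- Every factor on the right of `w-derivative` is a unit, so the derivative, an integral divisor
    -- of that unit, is one too.
    unit-w-derivative : Unit (monic′ w-equation w)
    unit-w-derivative = unit-factorˡ (int-expr (monic′ₑ (w-equationₑ (slot 1F) (slot 2F)) (slot 0F)) {w ∷ β ∷ u ∷ []}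
        λ { 0F → int-w ; 1F → unit⇒int unit-β ; 2F → unit⇒int unit-u }) int-D
      (unit-cong (sym w-derivative) (unit-* unit-u (unit-* (#-unit 9374)
        (unit-* (unit-* (unit-* unit-3w-1 (unit-^ 2 unit-w+5)) unit-Q) (unit-^ 3 unit-25w-19)))))

    unit-9e₃ : Unit (# 9 * (τ₀ * τ₁ * τ₂))
    unit-9e₃ = unit-cong (sym τ-e₃) (unit-cong
      (solve 1 (λ w → ⊝ (κ 5 ⊗ w ⊖ κ 2) ⊜ κ 2 ⊖ κ 5 ⊗ w) (w ∷ [])) (unit-neg unit-5w-2))

    cubic-int : Allⱽ Int cubic
    cubic-int = int-neg (unit-cancelˡ (#-unit 8) (unit⇒int unit-9e₃)) ∷ int-w ∷ int-neg (unit⇒int unit-1) ∷ []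

    int-τ : ∀ i → Int (τ i)
    int-τ i = integrally-closed {g = cubic} cubic-int (cubic-root i)

    int-difference : ∀ i j → Int (τ i - τ j)
    int-difference i j = atLeast-+ (int-τ i) (int-neg (int-τ j))

    -- Nine times the product is 2 - 5w, and 5w - 2 is a factor of the unit D. So each τᵢ is a unit,
    -- which the square roots x and y require.
    unit-e₃ : Unit (τ₀ * τ₁ * τ₂)
    unit-e₃ = unit-factorʳ (unit⇒int (#-unit 8)) (atLeast-* (atLeast-* (int-τ 0F) (int-τ 1F)) (int-τ 2F)) unit-9e₃

    unit-τ₀τ₁ : Unit (τ₀ * τ₁)
    unit-τ₀τ₁ = unit-factorˡ (atLeast-* (int-τ 0F) (int-τ 1F)) (int-τ 2F) unit-e₃

    unit-τ : ∀ i → Unit (τ i)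
    unit-τ 0F = unit-factorˡ (int-τ 0F) (int-τ 1F) unit-τ₀τ₁
    unit-τ 1F = unit-factorʳ (int-τ 0F) (int-τ 1F) unit-τ₀τ₁
    unit-τ 2F = unit-factorʳ (atLeast-* (int-τ 0F) (int-τ 1F)) (int-τ 2F) unit-e₃

    private
      int-d₀ : Int ((τ₀ - τ₁) * (τ₀ - τ₂))
      int-d₀ = atLeast-* (int-difference 0F 1F) (int-difference 0F 2F)

      unit-d : Unit ((τ₀ - τ₁) * (τ₀ - τ₂) * (τ₁ - τ₂))
      unit-d = unit-root 1 (atLeast-* int-d₀ (int-difference 1F 2F))
        (unit-factorʳ (unit⇒int (#-unit 8)) (Intᴿ.^-closed 2 (atLeast-* int-d₀ (int-difference 1F 2F)))
          (unit-cong (sym cubic-discriminant) (unit-neg (unit-* (unit-* (#-unit 3) (unit-^ 2 unit-3w-1)) unit-w+5))))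

    unit-cubic-derivative : Unit (monic′ cubic τ₀)
    unit-cubic-derivative = unit-cong (sym cubic-derivative) (unit-factorˡ int-d₀ (int-difference 1F 2F) unit-d)

    unit-quadratic-derivative : Unit (monic′ quadratic-τ τ₁)
    unit-quadratic-derivative = unit-cong (sym quadratic-τ-derivative) (unit-factorʳ int-d₀ (int-difference 1F 2F) unit-d)

    square-int : ∀ i → Allⱽ Int (square (ξ i / ξ 2F))
    square-int i = int-neg (unit-cancelˡ (unit-τ 2F) (atLeast-cong
      (trans (sym (coordinate-ratio i)) (*-comm _ _)) (int-τ i))) ∷ atLeast-0 ∷ []

    unit-square-derivative : ∀ i → Unit (monic′ (square (ξ i / ξ 2F)) (ξ i / ξ 2F))
    unit-square-derivative i = unit-cong (sym (square-derivative z)) (unit-* (#-unit 1) (unit-root 1 int-z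
      (unit-factorˡ (Intᴿ.^-closed 2 int-z) (int-τ 2F) (unit-cong (sym (coordinate-ratio i)) (unit-τ i)))))
      where
      z : Carrier
      z = ξ i / ξ 2F
      int-z : Int z
      int-z = integrally-closed {g = square z} (square-int i) (square-root z)

    unramified : ∀ {e} → (∀ {f} → k₀ f → f ≉ 0# → e ∣ ord f) → ∀ f → f ≉ 0# → e ∣ ord f
    unramified {e} e∣k₀ f f≉0 = e∣k₅ (everything f) f≉0
      where
      e∣k₁ : ∀ {f} → k₁ f → f ≉ 0# → e ∣ ord f
      e∣k₁ = étale-step k₀-isSubfield {f = w-equation} (Allⱽ.zip (w-equation-closed , w-equation-int))
        w-root unit-w-derivative e∣k₀
      e∣k₂ : ∀ {f} → k₂ f → f ≉ 0# → e ∣ ord f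
      e∣k₂ = étale-step k₁-isSubfield {f = cubic} (Allⱽ.zip (cubic-closed , cubic-int))
        (cubic-root 0F) unit-cubic-derivative e∣k₁
      e∣k₃ : ∀ {f} → k₃ f → f ≉ 0# → e ∣ ord f
      e∣k₃ = étale-step k₂-isSubfield {f = quadratic-τ} (Allⱽ.zip (quadratic-τ-closed ,
          (atLeast-* (int-τ 1F) (int-τ 2F) ∷ int-neg (atLeast-+ (int-τ 1F) (int-τ 2F)) ∷ [])))
        quadratic-τ-root unit-quadratic-derivative e∣k₂
      e∣k₄ : ∀ {f} → k₄ f → f ≉ 0# → e ∣ ord f
      e∣k₄ = étale-step k₃-isSubfield {f = square x} (Allⱽ.zip (x-equation-closed , square-int 0F))
        (square-root x) (unit-square-derivative 0F) e∣k₃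
      e∣k₅ : ∀ {f} → k₅ f → f ≉ 0# → e ∣ ord f
      e∣k₅ = étale-step k₄-isSubfield {f = square y} (Allⱽ.zip (y-equation-closed , square-int 1F))
        (square-root y) (unit-square-derivative 1F) e∣k₄

    -- The value of a local parameter divides all values on ℚ(β), hence all values on the whole
    -- field, in particular the value 1 of a uniformizer.
    not-ramified : ¬ Ramified pt β
    not-ramified (π , parameter , 1<π) = absurd uniformizer
      where
      absurd : ∃[ t ] t ≉ 0# × ord t ≡ 1ℤ → ⊥
      absurd (t , t≉0 , ord-t) = ℤ.<⇒≢ 1<π (≡.sym (≡.trans (≡.sym (ℤ.0≤i⇒+∣i∣≡i (ℤ.<⇒≤ (ℤ.<-trans (ℤ.+<+ (ℕ.s≤s ℕ.z≤n)) 1<π))))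
        (≡.cong +_ (∣1⇒≡1 (∣⇒∣ᵤ (≡.subst (ord π ∣_) ord-t (unramified (parameter-divides parameter) t t≉0)))))))

  branch-value : Ramified pt β → HasValue pt β 0ℚ ⊎ HasValue pt β 1ℚ ⊎ HasPole pt β
  branch-value ramified = decide (0ℤ ℤ.<? ord β) (0ℤ ℤ.<? ord (β - 1#)) (ord β ℤ.<? 0ℤ)
    where
    decide : Dec (0ℤ ℤ.< ord β) → Dec (0ℤ ℤ.< ord (β - 1#)) → Dec (ord β ℤ.< 0ℤ) →
      HasValue pt β 0ℚ ⊎ HasValue pt β 1ℚ ⊎ HasPole pt β
    decide (yes 0<β) _ _ = inj₁ (inj₂ (≡.subst (0ℤ ℤ.<_)
      (ord-cong (trans (solve 1 (λ b → b ⊜ b ⊖ κ 0) (β ∷ [])) (+-congˡ (-‿cong (sym ι-0))))) 0<β))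
    decide (no _) (yes 0<β-1) _ = inj₂ (inj₁ (inj₂ (≡.subst (0ℤ ℤ.<_) (ord-cong (+-congˡ (-‿cong (sym ι-1)))) 0<β-1)))
    decide (no _) (no _) (yes β<0) = inj₂ (inj₂ (β-nonzero , β<0))
    decide (no 0≮β) (no 0≮β-1) (no β≮0) = ⊥-elim (Unramified.not-ramified unit-β unit-β-1 ramified)
      where
      unit-β : Unit β
      unit-β = β-nonzero , ℤ.≤-antisym (ℤ.≮⇒≥ 0≮β) (ℤ.≮⇒≥ β≮0)
      unit-β-1 : Unit (β - 1#)
      unit-β-1 = β-1-nonzero , ℤ.≤-antisym (ℤ.≮⇒≥ 0≮β-1)
        (atLeast-+ (unit⇒int unit-β) (int-neg (unit⇒int unit-1)) β-1-nonzero)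

theorem1p1 : ∀ {c ℓ} (W̃ : FunctionField wiman c ℓ) →
    Wiman.AutomorphismGroupIsS₅ W̃ →
    Wiman.βIsDefined W̃ ×
    Curve.GeneratesInvariantField W̃ (Wiman.β W̃) ×
    Curve.IsBelyiMap W̃ (Wiman.β W̃) ×
    Curve.IsQuotientMapToℙ¹ W̃ (Wiman.β W̃)
theorem1p1 W̃ group =
  (r-nonzero , denominator-nonzero) , generates , (nonconstant , WimanRamification.branch-value W̃) ,
  (β-transcendental , generates)
  where
  open FunctionField W̃
  open Curve W̃ using (GeneratesInvariantField)
  open Wiman W̃ using (β; module AutomorphismGroupIsS₅)
  open WimanBasics W̃
  open WimanInvariance W̃ using (β-invariant)
  open WimanDescent W̃

  generates : GeneratesInvariantField β
  -- The known description of the automorphism group enters here: every automorphism is generated by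
  -- maps that fix β, so it fixes all of ℚ(β).
  generates f = mk⇔ invariant-k₀ λ f∈ σ →
    FixedFields.fixes-k₀ σ (β-invariant (AutomorphismGroupIsS₅.isGenerated group σ)) f∈

  -- If β were a constant `a`, it would be a root of t - a, whose coefficient of t is 1, against
  -- transcendence.
  nonconstant : ∀ a → β ≉ ι a
  nonconstant a β≈a = FieldOverℚ.1≉0 rational (≡.trans (≡.sym (ℚ.+-identityʳ 1ℚ))
    (β-transcendental (var 0F -ᴾ constᴾ a) (begin
      eval {1} (var 0F -ᴾ constᴾ a) (λ _ → β) ≈⟨ eval-- {1} (var 0F) (constᴾ a) (λ _ → β) ⟩
      eval {1} (var 0F) (λ _ → β) - eval {1} (constᴾ a) (λ _ → β)
        ≈⟨ +-cong (trans (eval-var {1} 0F (λ _ → β)) β≈a) (-‿cong (eval-const {1} a (λ _ → β))) ⟩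
      ι a - ι a ≈⟨ -‿inverseʳ (ι a) ⟩
      0# ∎) (1 ∷ [])))
    where
    open FieldLemmas fieldOverℚ
    open import Relation.Binary.Reasoning.Setoid setoid
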